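{- Fix positive integers $n,a$. Consider the signed shuffle algebra and let $\mathcal B_n$ be the set of $2^nn!$ signed permutations of $n$. For each of the linear maps $\frac1{a^n}\tau^+_a,\frac1{a^n}\tau^-_a,\frac1{a^n}\tilde\tau^+_a,\frac1{a^n}\tilde\tau^-_a$ restricted to the span of $\mathcal B_n$ (equivalently, the transition matrix of the corresponding hyperoctahedral riffle-shuffle with rotation or flip), the eigenvalues and their algebraic multiplicities are as follows, writing $[x^k]f$ for the coefficient of $x^k$ in $f$: - $a$ even, any of the four maps: eigenvalue $a^{k-n}$ with multiplicity $[x^k]\,x(x+2)(x+4)\cdots(x+2n-2)$, and eigenvalue $0$ with multiplicity $2^nn!-\frac{(2n)!}{2^nn!}$; - $a$ odd, $\frac1{a^n}\tau^+_a$ or $\frac1{a^n}\tilde\tau^+_a$: eigenvalue $a^{k-n}$ with multiplicity $[x^k]\,(x+1)(x+3)\cdots(x+2n-1)$; - $a$ odd, $\frac1{a^n}\tau^-_a$ or $\frac1{a^n}\tilde\tau^-_a$: eigenvalue $a^{k-n}$ with multiplicity $[x^k]\,(x+n-1)(x+1)(x+3)\cdots(x+2n-3)$, and eigenvalue $-a^{k-n}$ with multiplicity $[x^k]\,n(x+1)(x+3)\cdots(x+2n-3)$.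
   Context: Alphabet $\mathcal A=\{1,\dots,N,\bar1,\dots,\bar N\}$ with $N\ge n$. The signed shuffle algebra has as basis all words on $\mathcal A$ (degree = length), product of two words = sum of all their interleavings (words containing the letters of both in their original relative orders, with multiplicity), coproduct deconcatenation $\Delta(w_1\cdots w_n)=\sum_{i=0}^nw_1\cdots w_i\otimes w_{i+1}\cdots w_n$. Iterated products are written $m$ and $\Delta^{[a]}$ is the iterated coproduct. Define $\tau(w_1\cdots w_n)=\tau(w_1)\cdots\tau(w_n)$ and $\tilde\tau(w_1\cdots w_n)=\tilde\tau(w_n)\cdots\tilde\tau(w_1)$, where on letters $i\mapsto\bar i$, $\bar i\mapsto i$ (rotation, resp. flipping of a deck). For an involution $\theta\in\{\tau,\tilde\tau\}$, $\theta^+_a=m\circ(\mathrm{id}\otimes\theta\otimes\mathrm{id}\otimes\theta\otimes\cdots)\circ\Delta^{[a]}$ and $\theta^-_a=m\circ(\theta\otimes\mathrm{id}\otimes\theta\otimes\mathrm{id}\otimes\cdots)\circ\Delta^{[a]}$ (with $a$ alternating tensor factors). A signed permutation of $n$ is a word of length $n$ in which, for each $i\in\{1,\dots,n\}$, exactly one of $i,\bar i$ appears exactly once; the span of $\mathcal B_n$ is invariant under these operators. -}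

module Defs where

open import Data.Nat as ℕ using (ℕ; zero; suc; _∸_; _≤_; NonZero; _!)
open import Data.Nat.Properties as ℕP using (m^n≢0; m*n≢0; _!≢0)
open import Data.Bool using (Bool; true; false; not; if_then_else_)
import Data.Bool.Properties as BoolP
open import Data.Product using (_×_; _,_; proj₁; proj₂)
import Data.Product.Properties as ProdP
open import Data.List using (List; []; _∷_; _++_; map; concatMap; reverse; length; filter; sum; foldr; lookup; removeAt; allFin; upTo)
import Data.List.Properties as ListP
open import Data.Fin using (toℕ)
open import Data.Integer as ℤ using (ℤ; +_)
open import Data.Rational as ℚ using (ℚ; _+_; _*_; _-_; -_; 0ℚ; 1ℚ)
open import Relation.Binary.PropositionalEquality using (_≡_)
open import Relation.Binary.Definitions using (DecidableEquality)
open import Relation.Nullary.Decidable using (does)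

-- Letters and words.
-- A letter is a pair (i , b): the value i (a positive integer) and
-- b = true meaning the barred letter ī.  Restricted to the span of the
-- signed permutations of n only the letters 1..n, 1̄..n̄ occur, so the
-- bound N ≥ n on the alphabet plays no role.

Letter : Set
Letter = ℕ × Bool

Word : Set
Word = List Letter

_≟L_ : DecidableEquality Letter
_≟L_ = ProdP.≡-dec ℕP._≟_ BoolP._≟_

_≟W_ : DecidableEquality Word
_≟W_ = ListP.≡-dec _≟L_

barL : Letter → Letter
barL (i , b) = (i , not b)

τ : Word → Word
τ = map barL

τ~ : Word → Word
τ~ w = reverse (map barL w)

-- Formal ℕ-linear combinations of words are represented as lists of
-- words (a word occurring k times has coefficient k).

shuffle : Word → Word → List Word
shuffle [] v = v ∷ []
shuffle (x ∷ u) [] = (x ∷ u) ∷ []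
shuffle (x ∷ u) (y ∷ v) =
  map (x ∷_) (shuffle u (y ∷ v)) ++ map (y ∷_) (shuffle (x ∷ u) v)

shuffleL : List Word → Word → List Word
shuffleL ws v = concatMap (λ w → shuffle w v) ws

-- iterated shuffle product m of a list of tensor factors
-- (m (w₁ ⊗ ⋯ ⊗ wₐ) = (⋯ (w₁ ш w₂) ш ⋯) ш wₐ)
mult : List Word → List Word
mult ws = foldr (λ w acc → shuffleL acc w) ([] ∷ []) (reverse ws)

splits : Word → List (Word × Word)
splits [] = ([] , []) ∷ []
splits (x ∷ w) = ([] , x ∷ w) ∷ map (λ p → (x ∷ proj₁ p , proj₂ p)) (splits w)

deconc : ℕ → Word → List (List Word)
deconc zero w = []
deconc (suc zero) w = (w ∷ []) ∷ []
deconc (suc (suc a)) w =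
  concatMap (λ p → map (proj₁ p ∷_) (deconc (suc a) (proj₂ p))) (splits w)

alternate : (Word → Word) → Bool → List Word → List Word
alternate θ b [] = []
alternate θ true (w ∷ ws) = θ w ∷ alternate θ false ws
alternate θ false (w ∷ ws) = w ∷ alternate θ true ws

data Inv : Set where
  rot flip : Inv

data Sign : Set where
  plus minus : Sign

invFun : Inv → Word → Word
invFun rot = τ
invFun flip = τ~

firstApplied : Sign → Bool
firstApplied plus = false
firstApplied minus = true

op : Inv → Sign → ℕ → Word → List Word
op θ s a w = concatMap (λ fs → mult (alternate (invFun θ) (firstApplied s) fs)) (deconc a w)

coeff : Word → List Word → ℕ
coeff u ws = length (filter (λ v → u ≟W v) ws)

occurrences : ℕ → Word → ℕ
occurrences i w = length (filter (λ l → proj₁ l ℕP.≟ i) w)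

IsSignedPerm : ℕ → Word → Set
IsSignedPerm n w = (length w ≡ n) × (∀ i → 1 ≤ i → i ≤ n → occurrences i w ≡ 1)

_^ℚ_ : ℚ → ℕ → ℚ
x ^ℚ zero = 1ℚ
x ^ℚ suc k = x * (x ^ℚ k)

sumℚ : List ℚ → ℚ
sumℚ = foldr _+_ 0ℚ

prodℚ : List ℚ → ℚ
prodℚ = foldr _*_ 1ℚ

-- a^(k - n) for k ≤ n, i.e. 1 / a^(n ∸ k)
apow : (a : ℕ) → .{{NonZero a}} → (k n : ℕ) → ℚ
apow a k n = ℚ._/_ (+ 1) (a ℕ.^ (n ∸ k)) {{m^n≢0 a (n ∸ k)}}

opMatrix : Inv → Sign → (n a : ℕ) → .{{NonZero a}} → Word → Word → ℚ
opMatrix θ s n a u w =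
  ℚ._/_ (+ coeff u (op θ s a w)) (a ℕ.^ n) {{m^n≢0 a n}}

sgn : ℕ → ℚ
sgn zero = 1ℚ
sgn (suc k) = - sgn k

det : {I : Set} → (I → I → ℚ) → List I → List I → ℚ
det M [] cols = 1ℚ
det M (r ∷ rs) cols =
  sumℚ (map (λ j → sgn (toℕ j) * (M r (lookup cols j) * det M rs (removeAt cols j)))
            (allFin (length cols)))

δ : Word → Word → ℚ
δ u w = if does (u ≟W w) then 1ℚ else 0ℚ

charPoly : (Word → Word → ℚ) → List Word → ℚ → ℚ
charPoly M bs x = det (λ u w → x * δ u w - M u w) bs bs

-- Polynomials with ℕ coefficients as coefficient lists (ascending).

Poly : Set
Poly = List ℕ

mulLin : ℕ → Poly → Poly
mulLin c p = zipAdd (0 ∷ p) (map (c ℕ.*_) p)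
  where
  zipAdd : List ℕ → List ℕ → List ℕ
  zipAdd [] q = q
  zipAdd (y ∷ p') [] = y ∷ p'
  zipAdd (y ∷ p') (z ∷ q') = (y ℕ.+ z) ∷ zipAdd p' q'

coeffAt : Poly → ℕ → ℕ
coeffAt [] k = 0
coeffAt (c ∷ p) zero = c
coeffAt (c ∷ p) (suc k) = coeffAt p k

scalePoly : ℕ → Poly → Poly
scalePoly c p = map (c ℕ.*_) p

prodLin : (ℕ → ℕ) → ℕ → Poly
prodLin f zero = 1 ∷ []
prodLin f (suc m) = mulLin (f m) (prodLin f m)

polyEven : ℕ → Poly
polyEven n = prodLin (λ j → 2 ℕ.* j) n

polyOddPlus : ℕ → Poly
polyOddPlus n = prodLin (λ j → 2 ℕ.* j ℕ.+ 1) n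

polyOddMinusPos : ℕ → Poly
polyOddMinusPos n = mulLin (n ∸ 1) (prodLin (λ j → 2 ℕ.* j ℕ.+ 1) (n ∸ 1))

polyOddMinusNeg : ℕ → Poly
polyOddMinusNeg n = scalePoly n (prodLin (λ j → 2 ℕ.* j ℕ.+ 1) (n ∸ 1))

zeroMult : ℕ → ℕ
zeroMult n = (2 ℕ.^ n ℕ.* n !) ∸ ℕ._/_ ((2 ℕ.* n) !) (2 ℕ.^ n ℕ.* n !) {{m*n≢0 (2 ℕ.^ n) (n !) {{m^n≢0 2 n}} {{n !≢0}}}}

eigenProduct : (a : ℕ) → .{{NonZero a}} → (n : ℕ) → Bool → Poly → ℚ → ℚ
eigenProduct a n pos p x =
  prodℚ (map (λ k → (x - sgnB pos * apow a k n) ^ℚ coeffAt p k) (upTo (suc n)))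
  where
  sgnB : Bool → ℚ
  sgnB true = 1ℚ
  sgnB false = - 1ℚ

{-# OPTIONS --safe #-}
-- The coefficient of u in the operator applied to w counts the ways to deal the letters of u into
-- a piles, rotate or flip the marked piles, and concatenate the piles to w.  Because unshuffling
-- is cocommutative and dealing is a coalgebra morphism, two such deals compose to a deal with a
-- composed pattern of marks, and the number of unmarked minus marked piles is multiplicative.
-- A word with distinct values is returned by a deal exactly when the marked piles are empty and
-- the unmarked ones cut the word into consecutive pieces, so with b unmarked piles the trace is
-- 2ⁿ n! · (multisets of size n from b) = ∏_{j<n} (2b + 2j).  This gives the traces of all powers,
-- which are the power sums of the claimed eigenvalues.  Over ℚ they determine the characteristic
-- polynomial: P = det (1 - t M) solves t P′ = - (∑ tr(Mᵏ) tᵏ) P by Jacobi's formula, and so does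
-- ∏ (1 - μ t).
module Submission where

open import Level using (Level; _⊔_)
open import Algebra.Bundles using (CommutativeRing)
import Algebra.Properties.Ring
open import Data.List using (List; []; _∷_; _++_; map)
open import Data.List.Properties using (map-++)
open import Data.List.Membership.Propositional using (_∈_)
open import Data.List.Membership.Propositional.Properties using (∈-map⁺; ∈-++⁺ˡ; ∈-++⁺ʳ)
open import Data.List.Relation.Unary.Any using (here; there)
open import Data.Nat.Base using (ℕ; zero; suc)
open import Data.Product using (_,_)
open import Relation.Binary.PropositionalEquality as ≡ using (_≡_)

-- For rotations a composed pattern of marks need not alternate, so the powers leave the family of
-- the theorem; but a trace sees only the number b of unmarked piles, which treats both involutions
-- alike. Let ε be the number of unmarked minus marked piles of the alternating pattern: 0 for a
-- even, 1 or -1 for a odd according to the sign. The k-fold composite has a^k piles and difference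
-- ε^k, so 2b = a^k + ε^k, and with y = a^k the unnormalised trace is the product of y + ε^k + 2j
-- over j < n. For ε = 0 and ε = 1 this is the value at y of one polynomial, whose coefficients are
-- the multiplicities. For ε = -1 it alternates with the parity of k between ∏ (y - 1 + 2j) and ∏ (y
-- + 1 + 2j); their half sum (y + n - 1)(y + 1)(y + 3)⋯(y + 2n - 3) and half difference n(y + 1)(y +
-- 3)⋯(y + 2n - 3) count the positive and the negative eigenvalues. Zero eigenvalues are invisible
-- in power sums; their number comes from the size 2ⁿ n! of the matrix.

module Determinant {c ℓ : Level} (R : CommutativeRing c ℓ) where
  open CommutativeRing R
  open Algebra.Properties.Ring ring using (-‿distribʳ-*; -0#≈0#; -‿+-comm)
  open import Relation.Binary.Reasoning.Setoid setoid

  -- Finite sums and derivations in a commutative ring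

  interchange : ∀ w x y z → (w + x) + (y + z) ≈ (w + y) + (x + z)
  interchange w x y z = begin
    (w + x) + (y + z) ≈⟨ +-assoc w x (y + z) ⟩
    w + (x + (y + z)) ≈⟨ +-congˡ (+-assoc x y z) ⟨
    w + ((x + y) + z) ≈⟨ +-congˡ (+-congʳ (+-comm x y)) ⟩
    w + ((y + x) + z) ≈⟨ +-congˡ (+-assoc y x z) ⟩
    w + (y + (x + z)) ≈⟨ +-assoc w y (x + z) ⟨
    (w + y) + (x + z) ∎

  mulSwap : ∀ x y z → x * (y * z) ≈ y * (x * z)
  mulSwap x y z = begin
    x * (y * z) ≈⟨ *-assoc x y z ⟨
    (x * y) * z ≈⟨ *-congʳ (*-comm x y) ⟩
    (y * x) * z ≈⟨ *-assoc y x z ⟩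
    y * (x * z) ∎

  module _ {i : Level} {I : Set i} where
    ∑ : (I → Carrier) → List I → Carrier
    ∑ f []       = 0#
    ∑ f (j ∷ js) = f j + ∑ f js

    ∑-cong : ∀ {f g} (js : List I) → (∀ j → j ∈ js → f j ≈ g j) → ∑ f js ≈ ∑ g js
    ∑-cong []       h = refl
    ∑-cong (j ∷ js) h = +-cong (h j (here ≡.refl)) (∑-cong js λ k k∈ → h k (there k∈))

    ∑-zero : ∀ {f} (js : List I) → (∀ j → j ∈ js → f j ≈ 0#) → ∑ f js ≈ 0#
    ∑-zero []       h = refl
    ∑-zero (j ∷ js) h =
      trans (+-cong (h j (here ≡.refl)) (∑-zero js λ k k∈ → h k (there k∈))) (+-identityˡ 0#)

    ∑-++ : ∀ f (js ks : List I) → ∑ f (js ++ ks) ≈ ∑ f js + ∑ f ks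
    ∑-++ f []       ks = sym (+-identityˡ _)
    ∑-++ f (j ∷ js) ks = trans (+-congˡ (∑-++ f js ks)) (sym (+-assoc _ _ _))

    ∑-distribʳ : ∀ f a (js : List I) → ∑ (λ j → f j * a) js ≈ ∑ f js * a
    ∑-distribʳ f a []       = sym (zeroˡ a)
    ∑-distribʳ f a (j ∷ js) = trans (+-congˡ (∑-distribʳ f a js)) (sym (distribʳ a _ _))

    -- The derivative of a determinant replaces one row and keeps the rows on both sides of it, so
    -- the sum runs over positions together with their prefix and suffix.
    ∑split : (List I → I → List I → Carrier) → List I → Carrier
    ∑split F []       = 0#
    ∑split F (j ∷ js) = F [] j js + ∑split (λ pre → F (j ∷ pre)) js

    ∑split-cong : ∀ {F G} (js : List I) →
                  (∀ pre j post → pre ++ j ∷ post ≡ js → F pre j post ≈ G pre j post) →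
                  ∑split F js ≈ ∑split G js
    ∑split-cong []       h = refl
    ∑split-cong (j ∷ js) h =
      +-cong (h [] j js ≡.refl) (∑split-cong js λ pre k post e → h (j ∷ pre) k post (≡.cong (j ∷_) e))

    ∑split-∑ : ∀ f (js : List I) → ∑split (λ _ j _ → f j) js ≈ ∑ f js
    ∑split-∑ f []       = refl
    ∑split-∑ f (j ∷ js) = +-congˡ (∑split-∑ f js)

  record Derivation : Set (c ⊔ ℓ) where
    field
      D      : Carrier → Carrier
      D-0    : D 0# ≈ 0#
      D-1    : D 1# ≈ 0#
      D-neg  : ∀ x → D (- x) ≈ - D x
      D-+    : ∀ x y → D (x + y) ≈ D x + D y
      D-*    : ∀ x y → D (x * y) ≈ D x * y + x * D y

  -- Determinants by row expansion, up to Jacobi's formula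

  module _ {k : Level} {C : Set k} where

    -- Laplace expansion along one row: `F` receives the chosen column and the remaining ones in
    -- order. The nested subtraction produces the signs, which avoids index arithmetic.
    alt : (C → List C → Carrier) → List C → Carrier
    alt F []       = 0#
    alt F (c ∷ cs) = F c cs - alt (λ d ds → F d (c ∷ ds)) cs

    alt-cong : ∀ {F G} (cs : List C) →
               (∀ c ds → c ∈ cs → (∀ {d} → d ∈ ds → d ∈ cs) → F c ds ≈ G c ds) →
               alt F cs ≈ alt G cs
    alt-cong []       h = refl
    alt-cong (c ∷ cs) h =
      +-cong (h c cs (here ≡.refl) there)
             (-‿cong (alt-cong cs λ d ds d∈ ds⊆ →
               h d (c ∷ ds) (there d∈) λ { (here e) → here e ; (there e∈) → there (ds⊆ e∈) }))

    alt-cong′ : ∀ {F G} (cs : List C) → (∀ c ds → F c ds ≈ G c ds) → alt F cs ≈ alt G cs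
    alt-cong′ cs h = alt-cong cs λ c ds _ _ → h c ds

    alt-+ : ∀ F G (cs : List C) → alt (λ c ds → F c ds + G c ds) cs ≈ alt F cs + alt G cs
    alt-+ F G []       = sym (+-identityˡ 0#)
    alt-+ F G (c ∷ cs) = begin
      (F c cs + G c cs) - alt (λ d ds → F d (c ∷ ds) + G d (c ∷ ds)) cs
        ≈⟨ +-congˡ (-‿cong (alt-+ _ _ cs)) ⟩
      (F c cs + G c cs) - (alt _ cs + alt _ cs)
        ≈⟨ +-congˡ (-‿+-comm _ _) ⟨
      (F c cs + G c cs) + (- alt _ cs - alt _ cs)
        ≈⟨ interchange _ _ _ _ ⟩
      (F c cs - alt _ cs) + (G c cs - alt _ cs) ∎

    alt-scale : ∀ a F (cs : List C) → alt (λ c ds → a * F c ds) cs ≈ a * alt F cs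
    alt-scale a F []       = sym (zeroʳ a)
    alt-scale a F (c ∷ cs) = begin
      a * F c cs - alt (λ d ds → a * F d (c ∷ ds)) cs ≈⟨ +-congˡ (-‿cong (alt-scale a _ cs)) ⟩
      a * F c cs - a * alt _ cs                       ≈⟨ +-congˡ (-‿distribʳ-* a _) ⟩
      a * F c cs + a * - alt _ cs                     ≈⟨ distribˡ a _ _ ⟨
      a * (F c cs - alt _ cs)                         ∎

    alt-zero : ∀ {F} (cs : List C) → (∀ c ds → F c ds ≈ 0#) → alt F cs ≈ 0#
    alt-zero []       h = refl
    alt-zero (c ∷ cs) h = begin
      _ - alt _ cs ≈⟨ +-cong (h c cs) (-‿cong (alt-zero cs λ d ds → h d (c ∷ ds))) ⟩
      0# - 0#      ≈⟨ -‿inverseʳ 0# ⟩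
      0#           ∎

    alt² : (C → C → List C → Carrier) → List C → Carrier
    alt² H cs = alt (λ c ds → alt (λ d es → H c d es) ds) cs

    -- Expansion along two rows, sorted by the role of the column `c`: chosen first, chosen second,
    -- or not chosen. In the last case the two sign changes for passing over `c` cancel.
    alt²-∷ : ∀ H c (cs : List C) →
             alt² H (c ∷ cs) ≈
             (alt (H c) cs - alt (λ d → H d c) cs) + alt² (λ d e es → H d e (c ∷ es)) cs
    alt²-∷ H c cs = begin
      alt (H c) cs - alt (λ d ds → H d c ds - inner d ds) cs
        ≈⟨ +-congˡ (-‿cong (alt-cong′ cs λ d ds → +-congˡ (neg (inner d ds)))) ⟩
      alt (H c) cs - alt (λ d ds → H d c ds + - 1# * inner d ds) cs
        ≈⟨ +-congˡ (-‿cong (trans (alt-+ _ _ cs) (+-congˡ (trans (alt-scale (- 1#) inner cs) (sym (neg _)))))) ⟩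
      alt (H c) cs - (alt (λ d → H d c) cs - alt² _ cs)
        ≈⟨ +-congˡ (trans (sym (-‿+-comm _ _)) (+-congˡ (-‿involutive _))) ⟩
      alt (H c) cs + (- alt (λ d → H d c) cs + alt² _ cs)
        ≈⟨ +-assoc _ _ _ ⟨
      (alt (H c) cs - alt (λ d → H d c) cs) + alt² _ cs ∎
      where
      open Algebra.Properties.Ring ring using (-‿involutive; -1*x≈-x)
      inner : C → List C → Carrier
      inner d ds = alt (λ e es → H d e (c ∷ es)) ds
      neg : ∀ x → - x ≈ - 1# * x
      neg x = sym (-1*x≈-x x)

    -- The two orders of choosing a given pair of columns have opposite signs and cancel. Cancelling
    -- in pairs, instead of deducing 2x = 0, keeps the argument valid over every commutative ring,
    -- power series included.
    alt²-symmetric : ∀ H (cs : List C) → (∀ c d es → H c d es ≈ H d c es) → alt² H cs ≈ 0#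
    alt²-symmetric H []       h = refl
    alt²-symmetric H (c ∷ cs) h = begin
      alt² H (c ∷ cs)                                   ≈⟨ alt²-∷ H c cs ⟩
      (alt (H c) cs - alt (λ d → H d c) cs) + alt² _ cs
        ≈⟨ +-cong (trans (+-congʳ (alt-cong′ cs λ d es → h c d es)) (-‿inverseʳ _))
                  (alt²-symmetric _ cs λ d e es → h d e (c ∷ es)) ⟩
      0# + 0#                                           ≈⟨ +-identityˡ 0# ⟩
      0#                                                ∎

    -- Interchanging two rows changes the sign, stated additively; it is the symmetric case applied
    -- to `H` plus its transpose.
    alt²-antisymmetric : ∀ H (cs : List C) → alt² (λ c d → H d c) cs + alt² H cs ≈ 0#
    alt²-antisymmetric H cs = begin
      alt² (λ c d → H d c) cs + alt² H cs
        ≈⟨ trans (alt-cong′ cs λ c ds → alt-+ _ _ ds) (alt-+ _ _ cs) ⟨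
      alt² (λ c d es → H d c es + H c d es) cs
        ≈⟨ alt²-symmetric _ cs (λ c d es → +-comm _ _) ⟩
      0# ∎

    Row : Set (c ⊔ k)
    Row = C → Carrier

    det : List Row → List C → Carrier
    det []       cs = 1#
    det (r ∷ rs) cs = alt (λ c ds → r c * det rs ds) cs

    det-congʳ : ∀ pre {r r′} post cs → (∀ c → c ∈ cs → r c ≈ r′ c) →
                det (pre ++ r ∷ post) cs ≈ det (pre ++ r′ ∷ post) cs
    det-congʳ []        post cs h = alt-cong cs λ c ds c∈ _ → *-congʳ (h c c∈)
    det-congʳ (p ∷ pre) post cs h =
      alt-cong cs λ c ds _ ds⊆ → *-congˡ (det-congʳ pre post ds λ d d∈ → h d (ds⊆ d∈))

    det-zero : ∀ pre post cs → det (pre ++ (λ _ → 0#) ∷ post) cs ≈ 0#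
    det-zero []        post cs = alt-zero cs λ c ds → zeroˡ _
    det-zero (p ∷ pre) post cs = alt-zero cs λ c ds → trans (*-congˡ (det-zero pre post ds)) (zeroʳ _)

    det-linear : ∀ pre a r s post cs →
                 det (pre ++ (λ c → a * r c + s c) ∷ post) cs ≈
                 a * det (pre ++ r ∷ post) cs + det (pre ++ s ∷ post) cs
    det-linear []        a r s post cs = begin
      alt (λ c ds → (a * r c + s c) * det post ds) cs
        ≈⟨ alt-cong′ cs (λ c ds → trans (distribʳ _ _ _) (+-congʳ (*-assoc _ _ _))) ⟩
      alt (λ c ds → a * (r c * det post ds) + s c * det post ds) cs
        ≈⟨ trans (alt-+ _ _ cs) (+-congʳ (alt-scale a _ cs)) ⟩
      a * det (r ∷ post) cs + det (s ∷ post) cs ∎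
    det-linear (p ∷ pre) a r s post cs = begin
      alt (λ c ds → p c * det (pre ++ (λ d → a * r d + s d) ∷ post) ds) cs
        ≈⟨ alt-cong′ cs (λ c ds → trans (*-congˡ (det-linear pre a r s post ds))
             (trans (distribˡ _ _ _) (+-congʳ (mulSwap _ _ _)))) ⟩
      alt (λ c ds → a * (p c * det (pre ++ r ∷ post) ds) + p c * det (pre ++ s ∷ post) ds) cs
        ≈⟨ trans (alt-+ _ _ cs) (+-congʳ (alt-scale a _ cs)) ⟩
      a * det (p ∷ pre ++ r ∷ post) cs + det (p ∷ pre ++ s ∷ post) cs ∎

    det-∑ : ∀ {i : Level} {I : Set i} pre (w : I → Carrier) (r : I → Row) js post cs →
            det (pre ++ (λ c → ∑ (λ j → w j * r j c) js) ∷ post) cs ≈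
            ∑ (λ j → w j * det (pre ++ r j ∷ post) cs) js
    det-∑ pre w r []       post cs = det-zero pre post cs
    det-∑ pre w r (j ∷ js) post cs =
      trans (det-linear pre (w j) (r j) _ post cs) (+-congˡ (det-∑ pre w r js post cs))

    -- If the second row is the repeated one, the double expansion is symmetric. Otherwise the first
    -- two rows are interchanged, after which the repetition lies within the minors and the
    -- induction hypothesis applies.
    det-repeated-head : ∀ r rs cs → r ∈ rs → det (r ∷ rs) cs ≈ 0#
    det-repeated-head r (_ ∷ rs) cs (here ≡.refl) = begin
      alt (λ c ds → r c * alt (λ d es → r d * det rs es) ds) cs
        ≈⟨ alt-cong′ cs (λ c ds → alt-scale _ _ ds) ⟨
      alt² (λ c d es → r c * (r d * det rs es)) cs
        ≈⟨ alt²-symmetric _ cs (λ c d es → mulSwap _ _ _) ⟩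
      0# ∎
    det-repeated-head r (s ∷ rs) cs (there r∈) = begin
      alt (λ c ds → r c * alt (λ d es → s d * det rs es) ds) cs
        ≈⟨ alt-cong′ cs (λ c ds → alt-scale _ _ ds) ⟨
      alt² (λ c d es → r c * (s d * det rs es)) cs
        ≈⟨ +-identityʳ _ ⟨
      alt² (λ c d es → r c * (s d * det rs es)) cs + 0#
        ≈⟨ +-congˡ (alt-zero cs λ d ds → trans (alt-cong′ ds λ c es → mulSwap _ _ _)
             (trans (alt-scale _ _ ds) (trans (*-congˡ (det-repeated-head r rs ds r∈)) (zeroʳ _)))) ⟨
      alt² (λ c d es → r c * (s d * det rs es)) cs + alt² (λ d c es → r c * (s d * det rs es)) cs
        ≈⟨ alt²-antisymmetric _ cs ⟩
      0# ∎

    det-repeated : ∀ pre r post cs → r ∈ pre ++ post → det (pre ++ r ∷ post) cs ≈ 0#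
    det-repeated []        r post cs r∈          = det-repeated-head r post cs r∈
    det-repeated (p ∷ pre) r post cs (here ≡.refl) = det-repeated-head p _ cs (mid pre)
      where
      mid : ∀ qs → p ∈ qs ++ p ∷ post
      mid []       = here ≡.refl
      mid (q ∷ qs) = there (mid qs)
    det-repeated (p ∷ pre) r post cs (there r∈) =
      alt-zero cs λ c ds → trans (*-congˡ (det-repeated pre r post ds r∈)) (zeroʳ _)

    module _ (∂ : Derivation) where
      open Derivation ∂

      D-alt : ∀ F (cs : List C) → D (alt F cs) ≈ alt (λ c ds → D (F c ds)) cs
      D-alt F []       = D-0
      D-alt F (c ∷ cs) = trans (D-+ _ _) (+-congˡ (trans (D-neg _) (-‿cong (D-alt _ cs))))

      -- The Leibniz rule in multilinear form: the derivative acts on one row at a time.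
      D-det : ∀ {i : Level} {I : Set i} (r : I → Row) js cs →
              D (det (map r js) cs) ≈
              ∑split (λ pre j post → det (map r pre ++ (λ c → D (r j c)) ∷ map r post) cs) js
      D-det r []       cs = D-1
      D-det {I = I} r (j ∷ js) cs = begin
        D (alt (λ c ds → r j c * det (map r js) ds) cs)
          ≈⟨ trans (D-alt _ cs) (alt-cong′ cs λ c ds → D-* _ _) ⟩
        alt (λ c ds → D (r j c) * det (map r js) ds + r j c * D (det (map r js) ds)) cs
          ≈⟨ alt-+ _ _ cs ⟩
        det ((λ c → D (r j c)) ∷ map r js) cs + alt (λ c ds → r j c * D (det (map r js) ds)) cs
          ≈⟨ +-congˡ (alt-cong′ cs λ c ds → *-congˡ (D-det r js ds)) ⟩
        det ((λ c → D (r j c)) ∷ map r js) cs + alt (λ c ds → r j c * ∑split (λ pre i post → minor pre i post ds) js) cs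
          ≈⟨ +-congˡ (push minor js) ⟩
        _ ∎
        where
        minor : List I → I → List I → List C → Carrier
        minor pre i post = det (map r pre ++ (λ c → D (r i c)) ∷ map r post)
        push : (G : List I → I → List I → List C → Carrier) (is : List I) →
               alt (λ c ds → r j c * ∑split (λ pre i post → G pre i post ds) is) cs ≈
               ∑split (λ pre i post → alt (λ c ds → r j c * G pre i post ds) cs) is
        push G []       = alt-zero cs λ c ds → zeroʳ _
        push G (i ∷ is) = begin
          _ ≈⟨ alt-cong′ cs (λ c ds → distribˡ _ _ _) ⟩
          _ ≈⟨ alt-+ _ _ cs ⟩
          _ ≈⟨ +-congˡ (push (λ pre → G (i ∷ pre)) is) ⟩
          _ ∎

      -- Jacobi's formula D (det A) = tr (adj A · D A) when D A = W A, so that tr (adj A · W A) = tr W · det A.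
      jacobi : ∀ {i : Level} {I : Set i} (r : I → Row) (w : I → I → Carrier) js cs →
               (∀ j → j ∈ js → ∀ c → c ∈ cs → D (r j c) ≈ ∑ (λ k → w j k * r k c) js) →
               D (det (map r js) cs) ≈ ∑ (λ j → w j j) js * det (map r js) cs
      jacobi {I = I} r w js cs h = begin
        D (det (map r js) cs)                          ≈⟨ D-det r js cs ⟩
        ∑split (λ pre j post → det (map r pre ++ (λ c → D (r j c)) ∷ map r post) cs) js
                                                       ≈⟨ ∑split-cong js term ⟩
        ∑split (λ _ j _ → w j j * det (map r js) cs) js ≈⟨ ∑split-∑ _ js ⟩
        ∑ (λ j → w j j * det (map r js) cs) js         ≈⟨ ∑-distribʳ _ _ js ⟩
        ∑ (λ j → w j j) js * det (map r js) cs         ∎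
        where
        term : ∀ pre j post → pre ++ j ∷ post ≡ js →
               det (map r pre ++ (λ c → D (r j c)) ∷ map r post) cs ≈ w j j * det (map r js) cs
        term pre j post ≡.refl = begin
          det (map r pre ++ (λ c → D (r j c)) ∷ map r post) cs
            ≈⟨ det-congʳ (map r pre) _ cs (h j (∈-++⁺ʳ pre (here ≡.refl))) ⟩
          det (map r pre ++ (λ c → ∑ (λ k → w j k * r k c) (pre ++ j ∷ post)) ∷ map r post) cs
            ≈⟨ det-∑ (map r pre) (w j) r (pre ++ j ∷ post) (map r post) cs ⟩
          ∑ T (pre ++ j ∷ post)
            ≈⟨ ∑-++ T pre (j ∷ post) ⟩
          ∑ T pre + (T j + ∑ T post)
            -- Any other row `r k` put in place of row `j` is already present in the prefix or the
            -- suffix, so only the diagonal term `T j` survives.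
            ≈⟨ +-cong (∑-zero pre λ k k∈ → trans (*-congˡ (det-repeated (map r pre) (r k) _ cs (∈-++⁺ˡ (∈-map⁺ r k∈)))) (zeroʳ _))
                 (+-congˡ (∑-zero post λ k k∈ → trans (*-congˡ (det-repeated (map r pre) (r k) _ cs (∈-++⁺ʳ (map r pre) (∈-map⁺ r k∈)))) (zeroʳ _))) ⟩
          0# + (T j + 0#)
            ≈⟨ trans (+-identityˡ _) (+-identityʳ _) ⟩
          w j j * det (map r pre ++ map r (j ∷ post)) cs
            ≡⟨ ≡.cong (λ rs → w j j * det rs cs) (map-++ r pre (j ∷ post)) ⟨
          w j j * det (map r (pre ++ j ∷ post)) cs ∎
          where
          T : I → Carrier
          T k = w j k * det (map r pre ++ r k ∷ map r post) cs

-- Formal power series and the Euler operator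

module PowerSeries {c ℓ : Level} (K : CommutativeRing c ℓ) where
  open CommutativeRing K
  open Determinant K using (interchange; mulSwap)
  open import Relation.Binary.Reasoning.Setoid setoid

  Series : Set c
  Series = ℕ → Carrier

  infix  4 _≋_
  infixl 7 _⊛_

  _≋_ : Series → Series → Set ℓ
  f ≋ g = ∀ n → f n ≈ g n

  tail : Series → Series
  tail f n = f (suc n)

  0S 1S : Series
  0S _ = 0#
  1S zero    = 1#
  1S (suc _) = 0#

  -- The Cauchy product through f = f 0 + t · `tail f`, recursive in the degree, so that the ring
  -- laws follow by induction.
  _⊛_ : Series → Series → Series
  (f ⊛ g) zero    = f 0 * g 0
  (f ⊛ g) (suc n) = f 0 * g (suc n) + (tail f ⊛ g) n

  ⊛-cong : ∀ {f f′ g g′} → f ≋ f′ → g ≋ g′ → f ⊛ g ≋ f′ ⊛ g′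
  ⊛-cong p q zero    = *-cong (p 0) (q 0)
  ⊛-cong p q (suc n) = +-cong (*-cong (p 0) (q (suc n))) (⊛-cong (λ m → p (suc m)) q n)

  -- The mirror image of the defining recursion, with the constant term of the right factor split
  -- off; comparing the two recursions gives commutativity.
  ⊛-suc : ∀ f g n → (f ⊛ g) (suc n) ≈ (f ⊛ tail g) n + f (suc n) * g 0
  ⊛-suc f g zero    = refl
  ⊛-suc f g (suc n) = trans (+-congˡ (⊛-suc (tail f) g n)) (sym (+-assoc _ _ _))

  ⊛-comm : ∀ f g → f ⊛ g ≋ g ⊛ f
  ⊛-comm f g zero    = *-comm (f 0) (g 0)
  ⊛-comm f g (suc n) = begin
    f 0 * g (suc n) + (tail f ⊛ g) n ≈⟨ +-cong (*-comm _ _) (⊛-comm (tail f) g n) ⟩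
    g (suc n) * f 0 + (g ⊛ tail f) n ≈⟨ +-comm _ _ ⟩
    (g ⊛ tail f) n + g (suc n) * f 0 ≈⟨ ⊛-suc g f n ⟨
    (g ⊛ f) (suc n)                  ∎

  ⊛-distribʳ : ∀ h f g → (λ n → f n + g n) ⊛ h ≋ λ n → (f ⊛ h) n + (g ⊛ h) n
  ⊛-distribʳ h f g zero    = distribʳ (h 0) (f 0) (g 0)
  ⊛-distribʳ h f g (suc n) =
    trans (+-cong (distribʳ _ _ _) (⊛-distribʳ h (tail f) (tail g) n)) (interchange _ _ _ _)

  ⊛-distribˡ : ∀ h f g → h ⊛ (λ n → f n + g n) ≋ λ n → (h ⊛ f) n + (h ⊛ g) n
  ⊛-distribˡ h f g n = trans (⊛-comm h _ n)
    (trans (⊛-distribʳ h f g n) (+-cong (⊛-comm f h n) (⊛-comm g h n)))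

  ⊛-scale : ∀ a f g → (λ n → a * f n) ⊛ g ≋ λ n → a * (f ⊛ g) n
  ⊛-scale a f g zero    = *-assoc _ _ _
  ⊛-scale a f g (suc n) = trans (+-cong (*-assoc _ _ _) (⊛-scale a (tail f) g n)) (sym (distribˡ _ _ _))

  ⊛-assoc : ∀ f g h → (f ⊛ g) ⊛ h ≋ f ⊛ (g ⊛ h)
  ⊛-assoc f g h zero    = *-assoc _ _ _
  ⊛-assoc f g h (suc n) = begin
    (f 0 * g 0) * h (suc n) + ((λ m → f 0 * tail g m + (tail f ⊛ g) m) ⊛ h) n
      ≈⟨ +-cong (*-assoc _ _ _) (trans (⊛-distribʳ h _ _ n)
           (+-cong (⊛-scale (f 0) (tail g) h n) (⊛-assoc (tail f) g h n))) ⟩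
    f 0 * (g 0 * h (suc n)) + (f 0 * (tail g ⊛ h) n + (tail f ⊛ (g ⊛ h)) n)
      ≈⟨ +-assoc _ _ _ ⟨
    (f 0 * (g 0 * h (suc n)) + f 0 * (tail g ⊛ h) n) + (tail f ⊛ (g ⊛ h)) n
      ≈⟨ +-congʳ (distribˡ _ _ _) ⟨
    f 0 * (g ⊛ h) (suc n) + (tail f ⊛ (g ⊛ h)) n ∎

  ⊛-zeroˡ : ∀ f → 0S ⊛ f ≋ 0S
  ⊛-zeroˡ f zero    = zeroˡ _
  ⊛-zeroˡ f (suc n) = trans (+-cong (zeroˡ _) (⊛-zeroˡ f n)) (+-identityˡ 0#)

  ⊛-identityˡ : ∀ f → 1S ⊛ f ≋ f
  ⊛-identityˡ f zero    = *-identityˡ _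
  ⊛-identityˡ f (suc n) = trans (+-cong (*-identityˡ _) (⊛-zeroˡ f n)) (+-identityʳ _)

  seriesRing : CommutativeRing c ℓ
  seriesRing = record
    { Carrier = Series
    ; _≈_ = _≋_
    ; _+_ = λ f g n → f n + g n
    ; _*_ = _⊛_
    ; -_  = λ f n → - f n
    ; 0#  = 0S
    ; 1#  = 1S
    ; isCommutativeRing = record
      { isRing = record
        { +-isAbelianGroup = record
          { isGroup = record
            { isMonoid = record
              { isSemigroup = record
                { isMagma = record
                  { isEquivalence = record
                    { refl = λ _ → refl ; sym = λ p n → sym (p n) ; trans = λ p q n → trans (p n) (q n) }
                  ; ∙-cong = λ p q n → +-cong (p n) (q n) }
                ; assoc = λ f g h n → +-assoc _ _ _ }
              ; identity = (λ f n → +-identityˡ _) , (λ f n → +-identityʳ _) }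
            ; inverse = (λ f n → -‿inverseˡ _) , (λ f n → -‿inverseʳ _)
            ; ⁻¹-cong = λ p n → -‿cong (p n) }
          ; comm = λ f g n → +-comm _ _ }
        ; *-cong = ⊛-cong
        ; *-assoc = ⊛-assoc
        ; *-identity = ⊛-identityˡ , (λ f n → trans (⊛-comm f 1S n) (⊛-identityˡ f n))
        ; distrib = ⊛-distribˡ , ⊛-distribʳ }
      ; *-comm = ⊛-comm }
    }

  fromℕ : ℕ → Carrier
  fromℕ zero    = 0#
  fromℕ (suc n) = 1# + fromℕ n

  -- t d/dt, used instead of d/dt because its Leibniz rule has a simple induction.
  euler : Series → Series
  euler f n = fromℕ n * f n

  euler-⊛ : ∀ f g → euler (f ⊛ g) ≋ λ n → (euler f ⊛ g) n + (f ⊛ euler g) n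
  euler-⊛ f g zero = begin
    0# * (f 0 * g 0)                      ≈⟨ zeroˡ _ ⟩
    0#                                    ≈⟨ +-identityˡ 0# ⟨
    0# + 0#                               ≈⟨ +-cong (trans (*-congʳ (zeroˡ _)) (zeroˡ _)) (trans (*-congˡ (zeroˡ _)) (zeroʳ _)) ⟨
    (0# * f 0) * g 0 + f 0 * (0# * g 0)   ∎
  euler-⊛ f g (suc n) = begin
    ν * (f 0 * g (suc n) + (tail f ⊛ g) n)
      ≈⟨ distribˡ _ _ _ ⟩
    ν * (f 0 * g (suc n)) + ν * (tail f ⊛ g) n
      ≈⟨ +-cong (mulSwap _ _ _) (trans (suc-* n _) (+-congˡ (euler-⊛ (tail f) g n))) ⟩
    f 0 * euler g (suc n) + ((tail f ⊛ g) n + ((euler (tail f) ⊛ g) n + (tail f ⊛ euler g) n))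
      ≈⟨ +-congˡ (+-assoc _ _ _) ⟨
    f 0 * euler g (suc n) + (((tail f ⊛ g) n + (euler (tail f) ⊛ g) n) + (tail f ⊛ euler g) n)
      -- Shifting raises the Euler weight by one: `tail (euler f)` is the sum of `tail f` and
      -- `euler (tail f)`. This absorbs the extra summand that comes from ν = 1 + n.
      ≈⟨ +-congˡ (+-congʳ (trans (sym (⊛-distribʳ g (tail f) (euler (tail f)) n)) (⊛-cong (λ m → sym (suc-* m _)) (λ _ → refl) n))) ⟩
    f 0 * euler g (suc n) + ((tail (euler f) ⊛ g) n + (tail f ⊛ euler g) n)
      ≈⟨ +-assoc _ _ _ ⟨
    (f 0 * euler g (suc n) + (tail (euler f) ⊛ g) n) + (tail f ⊛ euler g) n
      ≈⟨ +-congʳ (+-comm _ _) ⟩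
    ((tail (euler f) ⊛ g) n + f 0 * euler g (suc n)) + (tail f ⊛ euler g) n
      ≈⟨ +-assoc _ _ _ ⟩
    (tail (euler f) ⊛ g) n + (f ⊛ euler g) (suc n)
      ≈⟨ +-congʳ (trans (+-congʳ (trans (*-congʳ (zeroˡ _)) (zeroˡ _))) (+-identityˡ _)) ⟨
    (euler f ⊛ g) (suc n) + (f ⊛ euler g) (suc n) ∎
    where
    ν = fromℕ (suc n)
    suc-* : ∀ m x → fromℕ (suc m) * x ≈ x + fromℕ m * x
    suc-* m x = trans (distribʳ _ _ _) (+-congʳ (*-identityˡ x))

  open Algebra.Properties.Ring ring using (-‿distribʳ-*)

  eulerDerivation : Determinant.Derivation seriesRing
  eulerDerivation = record
    { D     = euler
    ; D-0   = λ n → zeroʳ _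
    ; D-1   = λ { zero → zeroˡ _ ; (suc n) → zeroʳ _ }
    ; D-neg = λ f n → sym (-‿distribʳ-* _ _)
    ; D-+   = λ f g n → distribˡ _ _ _
    ; D-*   = euler-⊛
    }

open import Defs

-- The characteristic polynomial from the traces of powers

module CharacteristicPolynomial where

  open import Data.Bool using (if_then_else_)
  open import Data.Fin using (Fin; toℕ) renaming (suc to fsuc)
  open import Data.List using (List; []; _∷_; map; length; tabulate; allFin; lookup; removeAt)
  open import Data.List.Membership.Propositional using (_∈_)
  open import Data.List.Properties using (map-tabulate)
  open import Data.List.Relation.Unary.Any using (here; there)
  open import Data.List.Relation.Unary.All as All using (All)
  open import Data.List.Relation.Unary.AllPairs using ([]; _∷_)
  open import Data.List.Relation.Unary.Unique.Propositional using (Unique)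
  open import Data.Nat.Base as ℕ using (ℕ; zero; suc; z≤n; s≤s)
  import Data.Nat.Properties as ℕ
  open import Data.Rational as ℚ using (ℚ; _+_; _*_; _-_; -_; 0ℚ; 1ℚ)
  open import Data.Rational.Properties as ℚ hiding (_≟_)
  open import Data.Rational.Solver using (module +-*-Solver)
  open import Relation.Binary.PropositionalEquality
  open import Relation.Nullary.Decidable using (dec-true; dec-false)
  open ≡-Reasoning

  module Q = Determinant +-*-commutativeRing
  module PS = PowerSeries +-*-commutativeRing
  module S = Determinant PS.seriesRing
  open PS using (Series; _≋_; _⊛_; 0S; 1S; euler; fromℕ)
  open Q using (∑)

  module _ {C : Set} where
    -- The sign at index j + 1 is minus the sign at j, so the tail of the indexed sum is minus the
    -- indexed sum of the tail, as in `alt`.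
    det-alt : ∀ (f : C → List C → ℚ) cs →
              sumℚ (map (λ j → sgn (toℕ j) * f (lookup cs j) (removeAt cs j)) (allFin (length cs)))
                ≡ Q.alt f cs
    det-alt f []       = refl
    det-alt f (c ∷ cs) = cong₂ _+_ (*-identityˡ (f c cs)) (begin
      sumℚ (map g (tabulate fsuc))
        ≡⟨ cong sumℚ (map-tabulate fsuc g) ⟩
      sumℚ (tabulate (λ j → (- sgn (toℕ j)) * h j))
        ≡⟨ neg (λ j → sgn (toℕ j)) h ⟩
      - sumℚ (tabulate (λ j → sgn (toℕ j) * h j))
        ≡⟨ cong (λ z → - sumℚ z) (map-tabulate (λ j → j) (λ j → sgn (toℕ j) * h j)) ⟨
      - sumℚ (map (λ j → sgn (toℕ j) * h j) (allFin (length cs)))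
        ≡⟨ cong -_ (det-alt (λ d ds → f d (c ∷ ds)) cs) ⟩
      - Q.alt (λ d ds → f d (c ∷ ds)) cs ∎)
      where
      g : Fin (suc (length cs)) → ℚ
      g j = sgn (toℕ j) * f (lookup (c ∷ cs) j) (removeAt (c ∷ cs) j)
      h : Fin (length cs) → ℚ
      h j = f (lookup cs j) (c ∷ removeAt cs j)
      neg : ∀ {m} (s k : Fin m → ℚ) →
            sumℚ (tabulate (λ j → (- s j) * k j)) ≡ - sumℚ (tabulate (λ j → s j * k j))
      neg {zero}  s k = refl
      neg {suc m} s k = trans
        (cong₂ _+_ (sym (neg-distribˡ-* (s Fin.zero) (k Fin.zero))) (neg (λ j → s (fsuc j)) (λ j → k (fsuc j))))
        (sym (neg-distrib-+ (s Fin.zero * k Fin.zero) (sumℚ (tabulate λ j → s (fsuc j) * k (fsuc j)))))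


  det≡Qdet : ∀ {I : Set} (M : I → I → ℚ) rs cs → det M rs cs ≡ Q.det (map M rs) cs
  det≡Qdet M []       cs = refl
  det≡Qdet M (r ∷ rs) cs = trans (det-alt (λ c ds → M r c * det M rs ds) cs)
    (Q.alt-cong′ cs λ c ds → cong (M r c *_) (det≡Qdet M rs ds))

  +-zero : ∀ p {q} → q ≡ 0ℚ → p + q ≡ p
  +-zero p refl = +-identityʳ p

  alt-at : ∀ {C : Set} (F : C → List C → Series) cs n → S.alt F cs n ≡ Q.alt (λ c ds → F c ds n) cs
  alt-at F []       n = refl
  alt-at F (c ∷ cs) n = cong (λ z → F c cs n - z) (alt-at _ cs n)

  ∑-at : ∀ {I : Set} (f : I → Series) js n → S.∑ f js n ≡ ∑ (λ j → f j n) js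
  ∑-at f []       n = refl
  ∑-at f (j ∷ js) n = cong (f j n +_) (∑-at f js n)

  lin : ℚ → ℚ → Series
  lin a b zero          = a
  lin a b (suc zero)    = b
  lin a b (suc (suc _)) = 0ℚ

  lin-⊛ : ∀ a b F n → (lin a b ⊛ F) (suc n) ≡ a * F (suc n) + b * F n
  lin-⊛ a b F zero    = refl
  lin-⊛ a b F (suc n) = cong (a * F (suc (suc n)) +_)
    (trans (cong (b * F (suc n) +_) (PS.⊛-zeroˡ F n)) (+-identityʳ _))

  -- Evaluation of the reversed polynomial: ∑ₖ Fₖ x^(d-k).
  revEval : ℚ → ℕ → Series → ℚ
  revEval x zero    F = F 0
  revEval x (suc d) F = x * revEval x d F + F (suc d)

  -- Reversal turns the factor a + b t into x a + b. The extra term is the coefficient of F just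
  -- beyond degree d, which vanishes wherever the degree bounds apply.
  revEval-lin : ∀ x a b F d →
                revEval x (suc d) (lin a b ⊛ F) ≡ (x * a + b) * revEval x d F + a * F (suc d)
  revEval-lin x a b F zero = trans (cong (x * (a * F 0) +_) (lin-⊛ a b F 0))
    (solve 5 (λ x a b f g → x :* (a :* f) :+ (a :* g :+ b :* f) := (x :* a :+ b) :* f :+ a :* g)
       refl x a b (F 0) (F 1))
    where open +-*-Solver
  revEval-lin x a b F (suc d) = trans
    (cong₂ (λ y z → x * y + z) (revEval-lin x a b F d) (lin-⊛ a b F (suc d)))
    (solve 6 (λ x a b e f g → x :* ((x :* a :+ b) :* e :+ a :* f) :+ (a :* g :+ b :* f)
                            := (x :* a :+ b) :* (x :* e :+ f) :+ a :* g)
       refl x a b (revEval x d F) (F (suc d)) (F (suc (suc d))))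
    where open +-*-Solver

  revEval-alt : ∀ {C : Set} x d (F : C → List C → Series) cs →
                revEval x d (S.alt F cs) ≡ Q.alt (λ c ds → revEval x d (F c ds)) cs
  revEval-alt x zero    F cs = alt-at F cs 0
  revEval-alt x (suc d) F cs = begin
    x * revEval x d (S.alt F cs) + S.alt F cs (suc d)
      ≡⟨ cong₂ (λ y z → x * y + z) (revEval-alt x d F cs) (alt-at F cs (suc d)) ⟩
    x * Q.alt (λ c ds → revEval x d (F c ds)) cs + Q.alt (λ c ds → F c ds (suc d)) cs
      ≡⟨ cong (_+ _) (Q.alt-scale x _ cs) ⟨
    Q.alt (λ c ds → x * revEval x d (F c ds)) cs + Q.alt (λ c ds → F c ds (suc d)) cs
      ≡⟨ Q.alt-+ _ _ cs ⟨
    Q.alt (λ c ds → x * revEval x d (F c ds) + F c ds (suc d)) cs ∎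

  module _ {I C : Set} (a b : I → C → ℚ) where

    private
      L : I → C → Series
      L i c = lin (a i c) (b i c)

    det-lin-degree : ∀ rs cs n → length rs ℕ.< n → S.det (map L rs) cs n ≡ 0ℚ
    det-lin-degree []       cs (suc n) _       = refl
    det-lin-degree (r ∷ rs) cs (suc n) (s≤s p) = trans (alt-at _ cs (suc n))
      (Q.alt-zero cs λ c ds → begin
        (L r c ⊛ S.det (map L rs) ds) (suc n)
          ≡⟨ lin-⊛ (a r c) (b r c) (S.det (map L rs) ds) n ⟩
        a r c * S.det (map L rs) ds (suc n) + b r c * S.det (map L rs) ds n
          ≡⟨ cong₂ (λ y z → a r c * y + b r c * z)
               (det-lin-degree rs ds (suc n) (ℕ.m≤n⇒m≤1+n p)) (det-lin-degree rs ds n p) ⟩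
        a r c * 0ℚ + b r c * 0ℚ
          ≡⟨ cong₂ _+_ (*-zeroʳ (a r c)) (*-zeroʳ (b r c)) ⟩
        0ℚ ∎)

    -- With a = δ and b = -M this takes det (1 - t M) to det (x - M), so statements about power
    -- series yield the value of the characteristic polynomial at any rational x.
    revEval-det : ∀ x rs cs →
                  revEval x (length rs) (S.det (map L rs) cs) ≡ Q.det (map (λ i c → x * a i c + b i c) rs) cs
    revEval-det x []       cs = refl
    revEval-det x (r ∷ rs) cs = trans (revEval-alt x (suc (length rs)) (λ c ds → L r c ⊛ S.det (map L rs) ds) cs) (Q.alt-cong′ cs λ c ds → begin
      revEval x (suc (length rs)) (L r c ⊛ S.det (map L rs) ds)
        ≡⟨ revEval-lin x (a r c) (b r c) _ (length rs) ⟩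
      (x * a r c + b r c) * revEval x (length rs) (S.det (map L rs) ds) + a r c * S.det (map L rs) ds (suc (length rs))
        ≡⟨ cong₂ (λ y z → (x * a r c + b r c) * y + a r c * z)
             (revEval-det x rs ds) (det-lin-degree rs ds _ ℕ.≤-refl) ⟩
      (x * a r c + b r c) * Q.det (map (λ i c → x * a i c + b i c) rs) ds + a r c * 0ℚ
        ≡⟨ +-zero ((x * a r c + b r c) * Q.det (map (λ i c → x * a i c + b i c) rs) ds) (*-zeroʳ (a r c)) ⟩
      (x * a r c + b r c) * Q.det (map (λ i c → x * a i c + b i c) rs) ds ∎)

  eigenSeries : List ℚ → Series
  eigenSeries []       = 1S
  eigenSeries (μ ∷ μs) = lin 1ℚ (- μ) ⊛ eigenSeries μs

  eigenSeries-degree : ∀ μs n → length μs ℕ.< n → eigenSeries μs n ≡ 0ℚ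
  eigenSeries-degree []       (suc n) _       = refl
  eigenSeries-degree (μ ∷ μs) (suc n) (s≤s p) = begin
    (lin 1ℚ (- μ) ⊛ eigenSeries μs) (suc n)
      ≡⟨ lin-⊛ 1ℚ (- μ) (eigenSeries μs) n ⟩
    1ℚ * eigenSeries μs (suc n) + - μ * eigenSeries μs n
      ≡⟨ cong₂ (λ y z → 1ℚ * y + - μ * z)
           (eigenSeries-degree μs (suc n) (ℕ.m≤n⇒m≤1+n p)) (eigenSeries-degree μs n p) ⟩
    1ℚ * 0ℚ + - μ * 0ℚ
      ≡⟨ cong₂ _+_ (*-zeroʳ 1ℚ) (*-zeroʳ (- μ)) ⟩
    0ℚ ∎

  revEval-eigenSeries : ∀ x μs → revEval x (length μs) (eigenSeries μs) ≡ prodℚ (map (λ μ → x - μ) μs)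
  revEval-eigenSeries x []       = refl
  revEval-eigenSeries x (μ ∷ μs) = begin
    revEval x (suc (length μs)) (lin 1ℚ (- μ) ⊛ eigenSeries μs)
      ≡⟨ revEval-lin x 1ℚ (- μ) _ (length μs) ⟩
    (x * 1ℚ + - μ) * revEval x (length μs) (eigenSeries μs) + 1ℚ * eigenSeries μs (suc (length μs))
      ≡⟨ cong₂ (λ y z → (y + - μ) * revEval x (length μs) (eigenSeries μs) + 1ℚ * z)
           (*-identityʳ x) (eigenSeries-degree μs _ ℕ.≤-refl) ⟩
    (x - μ) * revEval x (length μs) (eigenSeries μs) + 1ℚ * 0ℚ
      ≡⟨ +-zero ((x - μ) * revEval x (length μs) (eigenSeries μs)) (*-zeroʳ 1ℚ) ⟩
    (x - μ) * revEval x (length μs) (eigenSeries μs)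
      ≡⟨ cong ((x - μ) *_) (revEval-eigenSeries x μs) ⟩
    (x - μ) * prodℚ (map (λ μ → x - μ) μs) ∎

  -- Logarithmic derivatives: t d/dt log (1 - μ t) = - ∑ₖ μ^(k+1) t^(k+1).
  logTerm : (ℕ → ℚ) → Series
  logTerm p zero    = 0ℚ
  logTerm p (suc k) = - p k

  powerSum : List ℚ → ℕ → ℚ
  powerSum μs k = ∑ (λ μ → μ ^ℚ suc k) μs

  -- The geometric series telescopes: multiplying - ∑ μ^(k+1) t^(k+1) by 1 - μ t leaves - μ t.
  euler-lin : ∀ μ → euler (lin 1ℚ (- μ)) ≋ logTerm (λ k → μ ^ℚ suc k) ⊛ lin 1ℚ (- μ)
  euler-lin μ n = trans (go n) (PS.⊛-comm (lin 1ℚ (- μ)) G n)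
    where
    G : Series
    G = logTerm (λ k → μ ^ℚ suc k)
    go : euler (lin 1ℚ (- μ)) ≋ lin 1ℚ (- μ) ⊛ G
    go zero          = refl
    go (suc zero)    = trans
      (solve 1 (λ m → (con 1ℚ :+ con 0ℚ) :* (:- m) := con 1ℚ :* (:- (m :* con 1ℚ)) :+ (:- m) :* con 0ℚ) refl μ)
      (sym (lin-⊛ 1ℚ (- μ) G 0))
      where open +-*-Solver
    go (suc (suc n)) = trans (*-zeroʳ (fromℕ (suc (suc n)))) (trans
      (solve 2 (λ m p → con 0ℚ := con 1ℚ :* (:- (m :* (m :* p))) :+ (:- m) :* (:- (m :* p))) refl μ (μ ^ℚ n))
      (sym (lin-⊛ 1ℚ (- μ) G (suc n))))
      where open +-*-Solver

  -- Logarithmic derivatives turn products into sums: by the Leibniz rule the series of the new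
  -- factor is added to that of the remaining product.
  euler-eigenSeries : ∀ μs → euler (eigenSeries μs) ≋ logTerm (powerSum μs) ⊛ eigenSeries μs
  euler-eigenSeries [] zero    = refl
  euler-eigenSeries [] (suc n) = trans (*-zeroʳ (fromℕ (suc n))) (sym
    (trans (PS.⊛-cong {f = logTerm (powerSum [])} {f′ = 0S} {g = 1S} (λ { zero → refl ; (suc k) → refl }) (λ _ → refl) (suc n)) (PS.⊛-zeroˡ 1S (suc n))))
  euler-eigenSeries (μ ∷ μs) n = begin
    euler (l ⊛ E) n
      ≡⟨ PS.euler-⊛ l E n ⟩
    (euler l ⊛ E) n + (l ⊛ euler E) n
      ≡⟨ cong₂ _+_ (PS.⊛-cong {g = E} (euler-lin μ) (λ _ → refl) n)
                   (PS.⊛-cong {f = l} (λ _ → refl) (euler-eigenSeries μs) n) ⟩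
    ((G ⊛ l) ⊛ E) n + (l ⊛ (H ⊛ E)) n
      ≡⟨ cong₂ _+_ (PS.⊛-assoc G l E n) (S.mulSwap l H E n) ⟩
    (G ⊛ (l ⊛ E)) n + (H ⊛ (l ⊛ E)) n
      ≡⟨ PS.⊛-distribʳ (l ⊛ E) G H n ⟨
    ((λ k → G k + H k) ⊛ (l ⊛ E)) n
      ≡⟨ PS.⊛-cong {g = l ⊛ E} (λ { zero → refl ; (suc k) → sym (neg-distrib-+ (μ ^ℚ suc k) _) }) (λ _ → refl) n ⟩
    (logTerm (powerSum (μ ∷ μs)) ⊛ (l ⊛ E)) n ∎
    where
    l E G H : Series
    l = lin 1ℚ (- μ)
    E = eigenSeries μs
    G = logTerm (λ k → μ ^ℚ suc k)
    H = logTerm (powerSum μs)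

  fromℕ-nonNegative : ∀ n → ℚ.NonNegative (fromℕ n)
  fromℕ-nonNegative zero    = _
  fromℕ-nonNegative (suc n) = nonNeg+nonNeg⇒nonNeg 1ℚ (fromℕ n) {{fromℕ-nonNegative n}}

  -- Characteristic zero enters here: Newton's recursion for the coefficients divides by the degree.
  fromℕ-suc-cancel : ∀ n {x y} → fromℕ (suc n) * x ≡ fromℕ (suc n) * y → x ≡ y
  fromℕ-suc-cancel n {x} {y} e = begin
    x                     ≡⟨ *-identityˡ x ⟨
    1ℚ * x                ≡⟨ cong (_* x) (*-inverseˡ ν) ⟨
    (ℚ.1/ ν * ν) * x      ≡⟨ *-assoc (ℚ.1/ ν) ν x ⟩
    ℚ.1/ ν * (ν * x)      ≡⟨ cong (ℚ.1/ ν *_) e ⟩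
    ℚ.1/ ν * (ν * y)      ≡⟨ *-assoc (ℚ.1/ ν) ν y ⟨
    (ℚ.1/ ν * ν) * y      ≡⟨ cong (_* y) (*-inverseˡ ν) ⟩
    1ℚ * y                ≡⟨ *-identityˡ y ⟩
    y                     ∎
    where
    ν : ℚ
    ν = fromℕ (suc n)
    instance
      ν≢0 : ℚ.NonZero ν
      ν≢0 = pos⇒nonZero ν {{pos+nonNeg⇒pos 1ℚ (fromℕ n) {{fromℕ-nonNegative n}}}}

  ⊛-cong-≤ : ∀ f {g h} n → (∀ m → m ℕ.≤ n → g m ≡ h m) → (f ⊛ g) n ≡ (f ⊛ h) n
  ⊛-cong-≤ f zero    e = cong (f 0 *_) (e 0 z≤n)
  ⊛-cong-≤ f (suc n) e = cong₂ _+_ (cong (f 0 *_) (e (suc n) ℕ.≤-refl))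
    (⊛-cong-≤ (PS.tail f) n λ m m≤n → e m (ℕ.m≤n⇒m≤1+n m≤n))

  -- `logTerm p` has no constant term, so coefficient m + 1 of its product with F involves only F 0,
  -- ..., F m. The equation therefore determines (m + 1) F (m + 1) from the earlier coefficients.
  logDerivative-unique : ∀ p {F G} → F 0 ≡ G 0 →
    euler F ≋ logTerm p ⊛ F → euler G ≋ logTerm p ⊛ G → F ≋ G
  logDerivative-unique p {F} {G} e₀ dF dG n = upTo n n ℕ.≤-refl
    where
    -- Strong induction on `m`, made structural by the bound `n`.
    upTo : ∀ n m → m ℕ.≤ n → F m ≡ G m
    upTo n       zero    _         = e₀
    upTo (suc n) (suc m) (s≤s m≤n) = fromℕ-suc-cancel m (begin
      fromℕ (suc m) * F (suc m)                           ≡⟨ dF (suc m) ⟩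
      0ℚ * F (suc m) + (PS.tail (logTerm p) ⊛ F) m        ≡⟨ cong₂ _+_ (*-zeroˡ (F (suc m))) (⊛-cong-≤ (PS.tail (logTerm p)) m λ k k≤m → upTo n k (ℕ.≤-trans k≤m m≤n)) ⟩
      0ℚ + (PS.tail (logTerm p) ⊛ G) m                    ≡⟨ cong (_+ (PS.tail (logTerm p) ⊛ G) m) (*-zeroˡ (G (suc m))) ⟨
      0ℚ * G (suc m) + (PS.tail (logTerm p) ⊛ G) m        ≡⟨ dG (suc m) ⟨
      fromℕ (suc m) * G (suc m)                           ∎)

  δ-refl : ∀ w → δ w w ≡ 1ℚ
  δ-refl w = cong (if_then 1ℚ else 0ℚ) (dec-true (w ≟W w) refl)

  δ-≢ : ∀ {u w} → u ≢ w → δ u w ≡ 0ℚ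
  δ-≢ {u} {w} u≢w = cong (if_then 1ℚ else 0ℚ) (dec-false (u ≟W w) u≢w)

  ∑-δ : ∀ (f : Word → ℚ) {bs} w → Unique bs → w ∈ bs → ∑ (λ v → δ v w * f v) bs ≡ f w
  ∑-δ f {_ ∷ bs} w (w∉ ∷ _) (here refl) = begin
    δ w w * f w + ∑ (λ v → δ v w * f v) bs
      ≡⟨ cong₂ (λ y z → y * f w + z) (δ-refl w) (Q.∑-zero bs λ v v∈ → trans (cong (_* f v) (δ-≢ λ v≡w → All.lookup w∉ v∈ (sym v≡w))) (*-zeroˡ (f v))) ⟩
    1ℚ * f w + 0ℚ
      ≡⟨ trans (+-identityʳ _) (*-identityˡ _) ⟩
    f w ∎
  ∑-δ f {b ∷ bs} w (b∉ ∷ ub) (there w∈) = begin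
    δ b w * f b + ∑ (λ v → δ v w * f v) bs
      ≡⟨ cong₂ (λ y z → y * f b + z) (δ-≢ (All.lookup b∉ w∈)) (∑-δ f w ub w∈) ⟩
    0ℚ * f b + f w
      ≡⟨ trans (cong (_+ f w) (*-zeroˡ (f b))) (+-identityˡ _) ⟩
    f w ∎

  det-δ : ∀ {bs} → Unique bs → Q.det (map δ bs) bs ≡ 1ℚ
  det-δ [] = refl
  det-δ {b ∷ bs} (b∉ ∷ ub) = begin
    δ b b * Q.det (map δ bs) bs - Q.alt (λ d ds → δ b d * Q.det (map δ bs) (b ∷ ds)) bs
      ≡⟨ cong₂ (λ y z → y * Q.det (map δ bs) bs - z) (δ-refl b)
           (trans (Q.alt-cong bs λ d ds d∈ _ → trans (cong (_* Q.det (map δ bs) (b ∷ ds)) (δ-≢ (All.lookup b∉ d∈))) (*-zeroˡ (Q.det (map δ bs) (b ∷ ds))))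
                  (Q.alt-zero {F = λ _ _ → 0ℚ} bs λ _ _ → refl)) ⟩
    1ℚ * Q.det (map δ bs) bs - 0ℚ
      ≡⟨ trans (+-identityʳ _) (*-identityˡ _) ⟩
    Q.det (map δ bs) bs
      ≡⟨ det-δ ub ⟩
    1ℚ ∎

  module _ (M : Word → Word → ℚ) (bs : List Word) where

    -- Indexed from the first power: matPow k is M^(k+1).
    matPow : ℕ → Word → Word → ℚ
    matPow zero    u w = M u w
    matPow (suc k) u w = ∑ (λ v → matPow k u v * M v w) bs

    trace : ℕ → ℚ
    trace k = ∑ (λ u → matPow k u u) bs

    private
      A : Word → Word → Series
      A u w = lin (δ u w) (- M u w)

      W : Word → Word → Series
      W u v = logTerm (λ k → matPow k u v)

      P : Series
      P = S.det (map A bs) bs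

    module _ (ub : Unique bs) where

      -- The hypothesis D A = W A of `jacobi` for A = 1 - t M and W = - ∑ Mᵏ tᵏ, k ≥ 1: the
      -- coefficients of W A telescope to - t M, which is t times the derivative of A. Distinctness
      -- of `bs` lets the sum against δ select a single entry.
      euler-A : ∀ u w → w ∈ bs → euler (A u w) ≋ S.∑ (λ v → W u v ⊛ A v w) bs
      euler-A u w w∈ n = trans (go n) (sym (∑-at (λ v → W u v ⊛ A v w) bs n))
        where
        step : ∀ k → ∑ (λ v → (W u v ⊛ A v w) (suc k)) bs ≡
                     W u w (suc k) + ∑ (λ v → - (W u v k * M v w)) bs
        step k = begin
          ∑ (λ v → (W u v ⊛ A v w) (suc k)) bs
            ≡⟨ Q.∑-cong bs (λ v _ → trans (PS.⊛-comm (W u v) (A v w) (suc k)) (trans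
                 (lin-⊛ (δ v w) (- M v w) (W u v) k)
                 (cong (δ v w * W u v (suc k) +_) (trans (sym (neg-distribˡ-* (M v w) (W u v k))) (cong -_ (*-comm (M v w) _)))))) ⟩
          ∑ (λ v → δ v w * W u v (suc k) + - (W u v k * M v w)) bs
            ≡⟨ add _ _ bs ⟩
          ∑ (λ v → δ v w * W u v (suc k)) bs + ∑ (λ v → - (W u v k * M v w)) bs
            ≡⟨ cong (_+ ∑ (λ v → - (W u v k * M v w)) bs) (∑-δ (λ v → W u v (suc k)) w ub w∈) ⟩
          W u w (suc k) + ∑ (λ v → - (W u v k * M v w)) bs ∎
          where
          add : ∀ (f g : Word → ℚ) vs → ∑ (λ v → f v + g v) vs ≡ ∑ f vs + ∑ g vs
          add f g []       = refl
          add f g (v ∷ vs) = trans (cong (f v + g v +_) (add f g vs)) (Q.interchange (f v) (g v) _ _)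

        go : ∀ n → euler (A u w) n ≡ ∑ (λ v → (W u v ⊛ A v w) n) bs
        go zero = trans (*-zeroˡ (δ u w)) (sym (Q.∑-zero bs λ v _ → *-zeroˡ (δ v w)))
        go (suc zero) = begin
          (1ℚ + 0ℚ) * - M u w ≡⟨ *-identityˡ _ ⟩
          - M u w             ≡⟨ +-identityʳ _ ⟨
          - M u w + 0ℚ        ≡⟨ cong (- M u w +_) (Q.∑-zero bs λ v _ → cong -_ (*-zeroˡ (M v w))) ⟨
          - M u w + ∑ (λ v → - (0ℚ * M v w)) bs ≡⟨ step 0 ⟨
          ∑ (λ v → (W u v ⊛ A v w) 1) bs ∎
        go (suc (suc k)) = begin
          fromℕ (suc (suc k)) * 0ℚ
            ≡⟨ *-zeroʳ (fromℕ (suc (suc k))) ⟩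
          0ℚ
            ≡⟨ +-inverseˡ (matPow (suc k) u w) ⟨
          - matPow (suc k) u w + matPow (suc k) u w
            ≡⟨ cong (- matPow (suc k) u w +_) (Q.∑-cong bs λ v _ →
                 solve 2 (λ p m → p :* m := :- ((:- p) :* m)) refl (matPow k u v) (M v w)) ⟩
          - matPow (suc k) u w + ∑ (λ v → - (- matPow k u v * M v w)) bs
            ≡⟨ step (suc k) ⟨
          ∑ (λ v → (W u v ⊛ A v w) (suc (suc k))) bs ∎
          where open +-*-Solver

      euler-P : euler P ≋ logTerm trace ⊛ P
      euler-P n = trans
        (S.jacobi PS.eulerDerivation A W bs bs (λ u _ w w∈ → euler-A u w w∈) n)
        (PS.⊛-cong {g = P} diag (λ _ → refl) n)
        where
        neg : ∀ (f : Word → ℚ) vs → ∑ (λ v → - f v) vs ≡ - ∑ f vs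
        neg f []       = refl
        neg f (v ∷ vs) = trans (cong (- f v +_) (neg f vs)) (sym (neg-distrib-+ (f v) _))
        diag : S.∑ (λ u → W u u) bs ≋ logTerm trace
        diag zero    = trans (∑-at (λ u → W u u) bs 0) (Q.∑-zero bs λ _ _ → refl)
        diag (suc k) = trans (∑-at (λ u → W u u) bs (suc k)) (neg (λ u → matPow k u u) bs)

      P-0 : P 0 ≡ 1ℚ
      P-0 = trans (go bs bs) (det-δ ub)
        where
        go : ∀ rs cs → S.det (map A rs) cs 0 ≡ Q.det (map δ rs) cs
        go []       cs = refl
        go (r ∷ rs) cs = trans (alt-at _ cs 0) (Q.alt-cong′ cs λ c ds → cong (δ r c *_) (go rs ds))

      eigenSeries-0 : ∀ μs → eigenSeries μs 0 ≡ 1ℚ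
      eigenSeries-0 []       = refl
      eigenSeries-0 (μ ∷ μs) = trans (*-identityˡ _) (eigenSeries-0 μs)

      -- The traces fix det (1 - t M), in which an eigenvalue 0 leaves no mark. The hypothesis on
      -- the lengths makes both reversals use the same degree and so accounts for the zeros.
      charPoly-from-traces : ∀ μs → length μs ≡ length bs → (∀ k → trace k ≡ powerSum μs k) →
                             ∀ x → charPoly M bs x ≡ prodℚ (map (λ μ → x - μ) μs)
      charPoly-from-traces μs len tr x = begin
        charPoly M bs x
          ≡⟨ det≡Qdet (λ u w → x * δ u w - M u w) bs bs ⟩
        Q.det (map (λ u w → x * δ u w - M u w) bs) bs
          ≡⟨ revEval-det δ (λ u w → - M u w) x bs bs ⟨
        revEval x (length bs) P
          ≡⟨ revEval-cong (length bs) P≋E ⟩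
        revEval x (length bs) (eigenSeries μs)
          ≡⟨ cong (λ d → revEval x d (eigenSeries μs)) len ⟨
        revEval x (length μs) (eigenSeries μs)
          ≡⟨ revEval-eigenSeries x μs ⟩
        prodℚ (map (λ μ → x - μ) μs) ∎
        where
        revEval-cong : ∀ d {F G} → F ≋ G → revEval x d F ≡ revEval x d G
        revEval-cong zero    e = e 0
        revEval-cong (suc d) e = cong₂ (λ y z → x * y + z) (revEval-cong d e) (e (suc d))
        P≋E : P ≋ eigenSeries μs
        P≋E = logDerivative-unique trace (trans P-0 (sym (eigenSeries-0 μs))) euler-P
          λ n → trans (euler-eigenSeries μs n)
            (PS.⊛-cong {g = eigenSeries μs} (λ { zero → refl ; (suc k) → cong -_ (sym (tr k)) }) (λ _ → refl) n)

-- Splittings of words, deals, and their duality with the shuffle operators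

module Dealing where

  open import Data.Bool using (Bool; true; false; not)
  open import Data.Bool.Properties using (not-involutive)
  open import Data.Empty using (⊥-elim)
  open import Data.List using (List; []; _∷_; _++_; _∷ʳ_; map; length; reverse; concatMap; foldr)
  open import Data.List.Properties using (++-assoc; ++-identityʳ; unfold-reverse; reverse-involutive; reverse-++; map-++; reverse-map; map-∘; map-id; map-cong; ∷-injective)
  open import Data.List.Membership.Propositional using (_∈_; _∉_)
  open import Data.List.Membership.Propositional.Properties using (∈-++⁺ˡ; ∈-++⁺ʳ)
  open import Data.List.Relation.Unary.Any using (here; there)
  open import Data.List.Relation.Unary.All as All using (All; []; _∷_)
  open import Data.List.Relation.Unary.AllPairs using (AllPairs; []; _∷_)
  open import Data.Nat using (ℕ; zero; suc; _+_; _*_)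
  open import Data.Nat.Properties hiding (_≟_)
  open import Data.Nat.Tactic.RingSolver using (solve-∀)
  open import Data.Product using (_,_; proj₁; proj₂)
  open import Function using (_∘_)
  open import Relation.Binary.PropositionalEquality
  open import Relation.Nullary using (yes; no)
  open ≡-Reasoning

  private
    swapMiddle : ∀ a b c d → (a + b) + (c + d) ≡ (a + c) + (b + d)
    swapMiddle = solve-∀

  Σ[_] : {A : Set} → (A → ℕ) → List A → ℕ
  Σ[ f ] []       = 0
  Σ[ f ] (x ∷ xs) = f x + Σ[ f ] xs

  module _ {A : Set} where

    Σ-cong : ∀ {f g : A → ℕ} xs → (∀ x → x ∈ xs → f x ≡ g x) → Σ[ f ] xs ≡ Σ[ g ] xs
    Σ-cong []       h = refl
    Σ-cong (x ∷ xs) h = cong₂ _+_ (h x (here refl)) (Σ-cong xs λ y y∈ → h y (there y∈))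

    Σ-++ : ∀ (f : A → ℕ) xs ys → Σ[ f ] (xs ++ ys) ≡ Σ[ f ] xs + Σ[ f ] ys
    Σ-++ f []       ys = refl
    Σ-++ f (x ∷ xs) ys = trans (cong (f x +_) (Σ-++ f xs ys)) (sym (+-assoc (f x) _ _))

    Σ-* : ∀ k (f : A → ℕ) xs → Σ[ (λ x → k * f x) ] xs ≡ k * Σ[ f ] xs
    Σ-* k f []       = sym (*-zeroʳ k)
    Σ-* k f (x ∷ xs) = trans (cong (k * f x +_) (Σ-* k f xs)) (sym (*-distribˡ-+ k (f x) _))

    Σ-map : ∀ {B : Set} (f : B → ℕ) (g : A → B) xs → Σ[ f ] (map g xs) ≡ Σ[ f ∘ g ] xs
    Σ-map f g []       = refl
    Σ-map f g (x ∷ xs) = cong (f (g x) +_) (Σ-map f g xs)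

  Σ-concatMap : ∀ {A B : Set} (f : B → ℕ) (g : A → List B) xs →
                Σ[ f ] (concatMap g xs) ≡ Σ[ (λ x → Σ[ f ] (g x)) ] xs
  Σ-concatMap f g []       = refl
  Σ-concatMap f g (x ∷ xs) = trans (Σ-++ f (g x) _) (cong (Σ[ f ] (g x) +_) (Σ-concatMap f g xs))

  -- Equality of `wt φ` for all φ expresses that two words have the same multiset of values. Since φ
  -- ignores bars, this is invariant under both involutions and under shuffling.
  wt : (ℕ → ℕ) → Word → ℕ
  wt φ = Σ[ φ ∘ proj₁ ]

  -- The sum of F p q over all splittings of a word into complementary subwords p and q:
  -- the coproduct dual to the shuffle product.
  ∑ш : (Word → Word → ℕ) → Word → ℕ
  ∑ш F []      = F [] []
  ∑ш F (x ∷ u) = ∑ш (λ p q → F (x ∷ p) q) u + ∑ш (λ p q → F p (x ∷ q)) u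

  -- Agreement is required only for pairs that share out the values of `u`; later this restricts
  -- attention to words that are again signed permutations.
  ∑ш-cong-wt : ∀ {F G} u → (∀ p q → (∀ φ → wt φ p + wt φ q ≡ wt φ u) → F p q ≡ G p q) →
               ∑ш F u ≡ ∑ш G u
  ∑ш-cong-wt []      h = h [] [] λ φ → refl
  ∑ш-cong-wt (x ∷ u) h = cong₂ _+_
    (∑ш-cong-wt u λ p q e → h (x ∷ p) q λ φ →
      trans (+-assoc (φ (proj₁ x)) _ _) (cong (φ (proj₁ x) +_) (e φ)))
    (∑ш-cong-wt u λ p q e → h p (x ∷ q) λ φ →
      trans (shift (wt φ p) (φ (proj₁ x)) (wt φ q)) (cong (φ (proj₁ x) +_) (e φ)))
    where
    shift : ∀ a b c → a + (b + c) ≡ b + (a + c)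
    shift = solve-∀

  ∑ш-cong : ∀ {F G} u → (∀ p q → F p q ≡ G p q) → ∑ш F u ≡ ∑ш G u
  ∑ш-cong u h = ∑ш-cong-wt u λ p q _ → h p q

  ∑ш-+ : ∀ F G u → ∑ш (λ p q → F p q + G p q) u ≡ ∑ш F u + ∑ш G u
  ∑ш-+ F G []      = refl
  ∑ш-+ F G (x ∷ u) = trans (cong₂ _+_ (∑ш-+ _ _ u) (∑ш-+ _ _ u))
    (swapMiddle (∑ш (λ p q → F (x ∷ p) q) u) _ _ _)

  ∑ш-* : ∀ k F u → ∑ш (λ p q → k * F p q) u ≡ k * ∑ш F u
  ∑ш-* k F []      = refl
  ∑ш-* k F (x ∷ u) = trans (cong₂ _+_ (∑ш-* k _ u) (∑ш-* k _ u)) (sym (*-distribˡ-+ k _ _))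

  ∑ш-0 : ∀ u → ∑ш (λ _ _ → 0) u ≡ 0
  ∑ш-0 []      = refl
  ∑ш-0 (x ∷ u) = cong₂ _+_ (∑ш-0 u) (∑ш-0 u)

  ∑ш-zero : ∀ {P : Letter → Set} F {u} → All P u → (∀ p q → All P p → F p q ≡ 0) → ∑ш F u ≡ 0
  ∑ш-zero F []                  h = h [] [] []
  ∑ш-zero F {x ∷ u} (px ∷ pu) h = cong₂ _+_
    (∑ш-zero (λ p q → F (x ∷ p) q) pu λ p q pp → h (x ∷ p) q (px ∷ pp))
    (∑ш-zero (λ p q → F p (x ∷ q)) pu λ p q → h p (x ∷ q))

  -- Collapses the sum when a nonempty first part is impossible. The predicate `P` passes to `p`
  -- what is known about the letters of the whole word.
  ∑ш-head : ∀ {P : Letter → Set} F {u} → All P u →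
            (∀ x p q → All P (x ∷ p) → F (x ∷ p) q ≡ 0) → ∑ш F u ≡ F [] u
  ∑ш-head F []                  h = refl
  ∑ш-head F {x ∷ u} (px ∷ pu) h = cong₂ _+_
    (∑ш-zero (λ p q → F (x ∷ p) q) pu λ p q pp → h x p q (px ∷ pp))
    (∑ш-head (λ p q → F p (x ∷ q)) pu λ y p q → h y p (x ∷ q))

  ∑ш-nil : ∀ F u → (∀ x p q → F (x ∷ p) q ≡ 0) → ∑ш F u ≡ F [] u
  ∑ш-nil F u h = ∑ш-head {P = λ _ → Letter} F (All.tabulate λ {x} _ → x) λ x p q _ → h x p q

  ∑ш-comm : ∀ F u → ∑ш F u ≡ ∑ш (λ p q → F q p) u
  ∑ш-comm F []      = refl
  ∑ш-comm F (x ∷ u) = trans (+-comm (∑ш (λ p q → F (x ∷ p) q) u) _)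
    (cong₂ _+_ (∑ш-comm (λ p q → F p (x ∷ q)) u) (∑ш-comm (λ p q → F (x ∷ p) q) u))

  ∑ш-assoc : ∀ (F : Word → Word → Word → ℕ) u →
             ∑ш (λ s r → ∑ш (λ p q → F p q r) s) u ≡ ∑ш (λ p s → ∑ш (λ q r → F p q r) s) u
  ∑ш-assoc F []      = refl
  ∑ш-assoc F (x ∷ u) = begin
    ∑ш (λ s r → ∑ш (λ p q → F (x ∷ p) q r) s + ∑ш (λ p q → F p (x ∷ q) r) s) u
      + ∑ш (λ s r → ∑ш (λ p q → F p q (x ∷ r)) s) u
      ≡⟨ cong (_+ ∑ш (λ s r → ∑ш (λ p q → F p q (x ∷ r)) s) u) (∑ш-+ _ _ u) ⟩
    ∑ш (λ s r → ∑ш (λ p q → F (x ∷ p) q r) s) u + ∑ш (λ s r → ∑ш (λ p q → F p (x ∷ q) r) s) u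
      + ∑ш (λ s r → ∑ш (λ p q → F p q (x ∷ r)) s) u
      ≡⟨ cong₂ _+_ (cong₂ _+_ (∑ш-assoc (λ p q r → F (x ∷ p) q r) u) (∑ш-assoc (λ p q r → F p (x ∷ q) r) u))
                   (∑ш-assoc (λ p q r → F p q (x ∷ r)) u) ⟩
    ∑ш (λ p s → ∑ш (λ q r → F (x ∷ p) q r) s) u + ∑ш (λ p s → ∑ш (λ q r → F p (x ∷ q) r) s) u
      + ∑ш (λ p s → ∑ш (λ q r → F p q (x ∷ r)) s) u
      ≡⟨ +-assoc (∑ш (λ p s → ∑ш (λ q r → F (x ∷ p) q r) s) u) _ _ ⟩
    ∑ш (λ p s → ∑ш (λ q r → F (x ∷ p) q r) s) u + (∑ш (λ p s → ∑ш (λ q r → F p (x ∷ q) r) s) u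
      + ∑ш (λ p s → ∑ш (λ q r → F p q (x ∷ r)) s) u)
      ≡⟨ cong (∑ш (λ p s → ∑ш (λ q r → F (x ∷ p) q r) s) u +_) (∑ш-+ _ _ u) ⟨
    _ ∎

  -- Both sides deal the letters of `u` independently to the four words; only the grouping differs.
  -- This is where cocommutativity and coassociativity combine.
  ∑ш-middleFour : ∀ (F : Word → Word → Word → Word → ℕ) u →
    ∑ш (λ p q → ∑ш (λ a b → ∑ш (λ c d → F a b c d) q) p) u ≡
    ∑ш (λ p q → ∑ш (λ a c → ∑ш (λ b d → F a b c d) q) p) u
  ∑ш-middleFour F []      = refl
  ∑ш-middleFour F (x ∷ u) = begin
    ∑ш (λ p q → ∑ш (λ a b → ∑ш (λ c d → F (x ∷ a) b c d) q) p + ∑ш (λ a b → ∑ш (λ c d → F a (x ∷ b) c d) q) p) u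
    + ∑ш (λ p q → ∑ш (λ a b → ∑ш (λ c d → F a b (x ∷ c) d) q + ∑ш (λ c d → F a b c (x ∷ d)) q) p) u
      ≡⟨ cong₂ _+_ (∑ш-+ _ _ u) (trans (∑ш-cong u λ p q → ∑ш-+ _ _ p) (∑ш-+ _ _ u)) ⟩
    (∑ш (λ p q → ∑ш (λ a b → ∑ш (λ c d → F (x ∷ a) b c d) q) p) u + ∑ш (λ p q → ∑ш (λ a b → ∑ш (λ c d → F a (x ∷ b) c d) q) p) u)
    + (∑ш (λ p q → ∑ш (λ a b → ∑ш (λ c d → F a b (x ∷ c) d) q) p) u + ∑ш (λ p q → ∑ш (λ a b → ∑ш (λ c d → F a b c (x ∷ d)) q) p) u)
      ≡⟨ cong₂ _+_
           (cong₂ _+_ (∑ш-middleFour (λ a b c d → F (x ∷ a) b c d) u) (∑ш-middleFour (λ a b c d → F a (x ∷ b) c d) u))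
           (cong₂ _+_ (∑ш-middleFour (λ a b c d → F a b (x ∷ c) d) u) (∑ш-middleFour (λ a b c d → F a b c (x ∷ d)) u)) ⟩
    (∑ш (λ p q → ∑ш (λ a c → ∑ш (λ b d → F (x ∷ a) b c d) q) p) u + ∑ш (λ p q → ∑ш (λ a c → ∑ш (λ b d → F a (x ∷ b) c d) q) p) u)
    + (∑ш (λ p q → ∑ш (λ a c → ∑ш (λ b d → F a b (x ∷ c) d) q) p) u + ∑ш (λ p q → ∑ш (λ a c → ∑ш (λ b d → F a b c (x ∷ d)) q) p) u)
      ≡⟨ swapMiddle (∑ш (λ p q → ∑ш (λ a c → ∑ш (λ b d → F (x ∷ a) b c d) q) p) u) _ _ _ ⟩
    _
      ≡⟨ cong₂ _+_ (∑ш-+ _ _ u) (trans (∑ш-cong u λ p q → ∑ш-+ _ _ p) (∑ш-+ _ _ u)) ⟨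
    _ ∎

  ∑ш-++ : ∀ F u v → ∑ш F (u ++ v) ≡ ∑ш (λ p q → ∑ш (λ p′ q′ → F (p ++ p′) (q ++ q′)) v) u
  ∑ш-++ F []      v = refl
  ∑ш-++ F (x ∷ u) v = cong₂ _+_ (∑ш-++ _ u v) (∑ш-++ _ u v)

  Σ-∑ш : ∀ {A : Set} (F : A → Word → Word → ℕ) xs u →
         Σ[ (λ x → ∑ш (F x) u) ] xs ≡ ∑ш (λ p q → Σ[ (λ x → F x p q) ] xs) u
  Σ-∑ш F []       u = sym (∑ш-0 u)
  Σ-∑ш F (x ∷ xs) u = trans (cong (∑ш (F x) u +_) (Σ-∑ш F xs u)) (sym (∑ш-+ _ _ u))

  -- The involutions on words and on splittings

  act : Inv → Bool → Word → Word
  act θ false w = w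
  act θ true  w = invFun θ w

  barL-involutive : ∀ x → barL (barL x) ≡ x
  barL-involutive (i , b) = cong (i ,_) (not-involutive b)

  τ-involutive : ∀ w → τ (τ w) ≡ w
  τ-involutive w = trans (sym (map-∘ w)) (trans (map-cong barL-involutive w) (map-id w))

  invFun-involutive : ∀ θ w → invFun θ (invFun θ w) ≡ w
  invFun-involutive rot  w = τ-involutive w
  invFun-involutive flip w = begin
    reverse (τ (reverse (τ w))) ≡⟨ cong reverse (reverse-map barL (τ w)) ⟩
    reverse (reverse (τ (τ w))) ≡⟨ reverse-involutive _ ⟩
    τ (τ w)                     ≡⟨ τ-involutive w ⟩
    w                           ∎

  act-involutive : ∀ θ e w → act θ e (act θ e w) ≡ w
  act-involutive θ false w = refl
  act-involutive θ true  w = invFun-involutive θ w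

  invFun-act : ∀ θ e w → invFun θ (act θ e w) ≡ act θ (not e) w
  invFun-act θ false w = refl
  invFun-act θ true  w = invFun-involutive θ w

  τ~-++ : ∀ u v → τ~ (u ++ v) ≡ τ~ v ++ τ~ u
  τ~-++ u v = trans (cong reverse (map-++ barL u v)) (reverse-++ (τ u) (τ v))

  act-[] : ∀ θ e → act θ e [] ≡ []
  act-[] θ    false = refl
  act-[] rot  true  = refl
  act-[] flip true  = refl

  wt-τ : ∀ φ w → wt φ (τ w) ≡ wt φ w
  wt-τ φ []      = refl
  wt-τ φ (x ∷ w) = cong (φ (proj₁ x) +_) (wt-τ φ w)

  wt-reverse : ∀ φ w → wt φ (reverse w) ≡ wt φ w
  wt-reverse φ []      = refl
  wt-reverse φ (x ∷ w) = begin
    wt φ (reverse (x ∷ w))                 ≡⟨ cong (wt φ) (unfold-reverse x w) ⟩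
    wt φ (reverse w ∷ʳ x)                  ≡⟨ Σ-++ _ (reverse w) (x ∷ []) ⟩
    wt φ (reverse w) + (φ (proj₁ x) + 0)   ≡⟨ cong₂ _+_ (wt-reverse φ w) (+-identityʳ _) ⟩
    wt φ w + φ (proj₁ x)                   ≡⟨ +-comm (wt φ w) _ ⟩
    φ (proj₁ x) + wt φ w                   ∎

  wt-act : ∀ θ e φ w → wt φ (act θ e w) ≡ wt φ w
  wt-act θ    false φ w = refl
  wt-act rot  true  φ w = wt-τ φ w
  wt-act flip true  φ w = trans (wt-reverse φ (τ w)) (wt-τ φ w)

  ∑ш-τ : ∀ F u → ∑ш F (τ u) ≡ ∑ш (λ p q → F (τ p) (τ q)) u
  ∑ш-τ F []      = refl
  ∑ш-τ F (x ∷ u) = cong₂ _+_ (∑ш-τ _ u) (∑ш-τ _ u)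

  ∑ш-reverse : ∀ F u → ∑ш F (reverse u) ≡ ∑ш (λ p q → F (reverse p) (reverse q)) u
  ∑ш-reverse F []      = refl
  ∑ш-reverse F (x ∷ u) = begin
    ∑ш F (reverse (x ∷ u))
      ≡⟨ cong (∑ш F) (unfold-reverse x u) ⟩
    ∑ш F (reverse u ∷ʳ x)
      ≡⟨ ∑ш-++ F (reverse u) (x ∷ []) ⟩
    ∑ш (λ p q → F (p ∷ʳ x) (q ++ []) + F (p ++ []) (q ∷ʳ x)) (reverse u)
      ≡⟨ ∑ш-cong (reverse u) (λ p q → cong₂ (λ a b → F (p ∷ʳ x) b + F a (q ∷ʳ x)) (++-identityʳ p) (++-identityʳ q)) ⟩
    ∑ш (λ p q → F (p ∷ʳ x) q + F p (q ∷ʳ x)) (reverse u)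
      ≡⟨ ∑ш-reverse (λ p q → F (p ∷ʳ x) q + F p (q ∷ʳ x)) u ⟩
    ∑ш (λ p q → F (reverse p ∷ʳ x) (reverse q) + F (reverse p) (reverse q ∷ʳ x)) u
      ≡⟨ ∑ш-+ _ _ u ⟩
    ∑ш (λ p q → F (reverse p ∷ʳ x) (reverse q)) u + ∑ш (λ p q → F (reverse p) (reverse q ∷ʳ x)) u
      ≡⟨ cong₂ _+_ (∑ш-cong u λ p q → cong (λ a → F a (reverse q)) (unfold-reverse x p))
                   (∑ш-cong u λ p q → cong (F (reverse p)) (unfold-reverse x q)) ⟨
    _ ∎

  ∑ш-act : ∀ θ e F u → ∑ш F (act θ e u) ≡ ∑ш (λ p q → F (act θ e p) (act θ e q)) u
  ∑ш-act θ    false F u = refl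
  ∑ш-act rot  true  F u = ∑ш-τ F u
  ∑ш-act flip true  F u = trans (∑ш-reverse F (τ u)) (∑ш-τ _ u)

  -- Deals and their composition

  module _ (θ : Inv) where

    -- deal es u F sums F over the outcomes of the inverse shuffle: each letter of u is dealt
    -- to one of the piles, pile i is acted on by θ when es marks it, and the piles are concatenated.
    deal : List Bool → Word → (Word → ℕ) → ℕ
    deal []       []      F = F []
    -- No letter may remain when the piles are exhausted, so such a branch has no outcome.
    deal []       (x ∷ u) F = 0
    deal (e ∷ es) u       F = ∑ш (λ p q → deal es q (λ r → F (act θ e p ++ r))) u

    deal-cong-wt : ∀ es {F G} u → (∀ r → (∀ φ → wt φ r ≡ wt φ u) → F r ≡ G r) → deal es u F ≡ deal es u G
    deal-cong-wt []       []      h = h [] λ φ → refl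
    deal-cong-wt []       (x ∷ u) h = refl
    deal-cong-wt (e ∷ es) u       h = ∑ш-cong-wt u λ p q pq → deal-cong-wt es q λ r rq →
      h (act θ e p ++ r) λ φ → trans (Σ-++ _ (act θ e p) r) (trans (cong₂ _+_ (wt-act θ e φ p) (rq φ)) (pq φ))

    deal-cong : ∀ es {F G} u → (∀ r → F r ≡ G r) → deal es u F ≡ deal es u G
    deal-cong es u h = deal-cong-wt es u λ r _ → h r

    deal-+ : ∀ es F G u → deal es u (λ r → F r + G r) ≡ deal es u F + deal es u G
    deal-+ []       F G []      = refl
    deal-+ []       F G (x ∷ u) = refl
    deal-+ (e ∷ es) F G u       = trans (∑ш-cong u λ p q → deal-+ es _ _ q) (∑ш-+ _ _ u)

    deal-* : ∀ es k F u → deal es u (λ r → k * F r) ≡ k * deal es u F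
    deal-* []       k F []      = refl
    deal-* []       k F (x ∷ u) = sym (*-zeroʳ k)
    deal-* (e ∷ es) k F u       = trans (∑ш-cong u λ p q → deal-* es k _ q) (∑ш-* k _ u)

    deal-0 : ∀ es u → deal es u (λ _ → 0) ≡ 0
    deal-0 es u = deal-* es 0 (λ _ → 0) u

    deal-Σ : ∀ {A : Set} es (F : A → Word → ℕ) xs u →
             Σ[ (λ x → deal es u (F x)) ] xs ≡ deal es u (λ r → Σ[ (λ x → F x r) ] xs)
    deal-Σ es F []       u = sym (deal-0 es u)
    deal-Σ es F (x ∷ xs) u = trans (cong (deal es u (F x) +_) (deal-Σ es F xs u)) (sym (deal-+ es _ _ u))

    deal-∑ш : ∀ es (F : Word → Word → Word → ℕ) u v →
              deal es u (λ r → ∑ш (F r) v) ≡ ∑ш (λ a b → deal es u (λ r → F r a b)) v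
    deal-∑ш es F u []      = refl
    deal-∑ш es F u (x ∷ v) = trans (deal-+ es _ _ u) (cong₂ _+_ (deal-∑ш es _ u v) (deal-∑ш es _ u v))

    deal-word[] : ∀ es F → deal es [] F ≡ F []
    deal-word[] []       F = refl
    deal-word[] (e ∷ es) F = trans (deal-word[] es _) (cong (λ p → F (p ++ [])) (act-[] θ e))

    deal-single : ∀ e u F → deal (e ∷ []) u F ≡ F (act θ e u)
    deal-single e u F = begin
      ∑ш (λ p q → deal [] q (λ r → F (act θ e p ++ r))) u ≡⟨ ∑ш-comm _ u ⟩
      ∑ш (λ q p → deal [] q (λ r → F (act θ e p ++ r))) u ≡⟨ ∑ш-nil _ u (λ _ _ _ → refl) ⟩
      F (act θ e u ++ [])                                 ≡⟨ cong F (++-identityʳ _) ⟩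
      F (act θ e u)                                       ∎

    -- Splitting the outcome of a deal amounts to splitting the word first and dealing both parts by
    -- the same marks. The involutions and concatenation commute with splitting, and `∑ш-middleFour`
    -- exchanges the order of the two choices at each pile.
    deal-coalgebra : ∀ es (F : Word → Word → ℕ) u →
                     deal es u (∑ш F) ≡ ∑ш (λ p q → deal es p (λ r → deal es q (λ s → F r s))) u
    deal-coalgebra []       F []      = refl
    deal-coalgebra []       F (x ∷ u) = sym (cong₂ _+_ (∑ш-0 u)
      (trans (∑ш-cong u λ p q → deal-0 [] p) (∑ш-0 u)))
    deal-coalgebra (e ∷ es) F u = begin
      ∑ш (λ p q → deal es q (λ r → ∑ш F (θₑ p ++ r))) u
        ≡⟨ ∑ш-cong u (λ p q → deal-cong es q λ r → trans (∑ш-++ F (θₑ p) r) (∑ш-act θ e _ p)) ⟩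
      ∑ш (λ p q → deal es q (λ r → ∑ш (λ a b → ∑ш (λ c d → F (θₑ a ++ c) (θₑ b ++ d)) r) p)) u
        ≡⟨ ∑ш-cong u (λ p q → deal-∑ш es (λ r a b → ∑ш (λ c d → F (θₑ a ++ c) (θₑ b ++ d)) r) q p) ⟩
      ∑ш (λ p q → ∑ш (λ a b → deal es q (∑ш (λ c d → F (θₑ a ++ c) (θₑ b ++ d)))) p) u
        ≡⟨ ∑ш-cong u (λ p q → ∑ш-cong p λ a b → deal-coalgebra es _ q) ⟩
      ∑ш (λ p q → ∑ш (λ a b → ∑ш (λ v w → deal es v (λ c → deal es w (λ d → F (θₑ a ++ c) (θₑ b ++ d)))) q) p) u
        ≡⟨ ∑ш-middleFour (λ a b v w → deal es v (λ c → deal es w (λ d → F (θₑ a ++ c) (θₑ b ++ d)))) u ⟩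
      ∑ш (λ p q → ∑ш (λ a v → ∑ш (λ b w → deal es v (λ c → deal es w (λ d → F (θₑ a ++ c) (θₑ b ++ d)))) q) p) u
        ≡⟨ ∑ш-cong u (λ p q → ∑ш-cong p λ a v → deal-∑ш es _ v q) ⟨
      ∑ш (λ p q → ∑ш (λ a v → deal es v (λ c → ∑ш (λ b w → deal es w (λ d → F (θₑ a ++ c) (θₑ b ++ d))) q)) p) u ∎
      where
      θₑ : Word → Word
      θₑ = act θ e

    deal-++ : ∀ es fs F u →
              deal (es ++ fs) u F ≡ ∑ш (λ p q → deal es p (λ v → deal fs q (λ r → F (v ++ r)))) u
    deal-++ []       fs F u = sym (∑ш-nil _ u λ _ _ _ → refl)
    deal-++ (e ∷ es) fs F u = begin
      ∑ш (λ p t → deal (es ++ fs) t (λ r → F (act θ e p ++ r))) u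
        ≡⟨ ∑ш-cong u (λ p t → deal-++ es fs _ t) ⟩
      ∑ш (λ p t → ∑ш (λ s q → deal es s (λ v → deal fs q (λ r → F (act θ e p ++ (v ++ r))))) t) u
        ≡⟨ ∑ш-assoc (λ p s q → deal es s (λ v → deal fs q (λ r → F (act θ e p ++ (v ++ r))))) u ⟨
      ∑ш (λ t q → ∑ш (λ p s → deal es s (λ v → deal fs q (λ r → F (act θ e p ++ (v ++ r))))) t) u
        ≡⟨ ∑ш-cong u (λ t q → ∑ш-cong t λ p s → deal-cong es s λ v → deal-cong fs q λ r →
             cong F (++-assoc (act θ e p) v r)) ⟨
      ∑ш (λ t q → ∑ш (λ p s → deal es s (λ v → deal fs q (λ r → F ((act θ e p ++ v) ++ r)))) t) u ∎

  -- The marks of a deal whose outcome is then acted on by θ. Every pile is toggled, and `flip` also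
  -- reverses the order of the piles, because `τ~` reverses concatenations.
  twist : Inv → Bool → List Bool → List Bool
  twist θ    false es = es
  twist rot  true  es = map not es
  twist flip true  es = reverse (map not es)

  deal-act : ∀ θ e es F u → deal θ es u (λ v → F (act θ e v)) ≡ deal θ (twist θ e es) u F
  deal-act θ    false es       F u       = refl
  deal-act rot  true  []       F []      = refl
  deal-act rot  true  []       F (x ∷ u) = refl
  deal-act rot  true  (e ∷ es) F u       = ∑ш-cong u λ p q →
    trans (deal-cong rot es q λ r → cong F (trans (map-++ barL (act rot e p) r)
            (cong (_++ τ r) (invFun-act rot e p))))
          (deal-act rot true es (λ v → F (act rot (not e) p ++ v)) q)
  deal-act flip true  []       F []      = refl
  deal-act flip true  []       F (x ∷ u) = refl
  deal-act flip true  (e ∷ es) F u       = begin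
    ∑ш (λ p q → deal flip es q (λ r → F (τ~ (act flip e p ++ r)))) u
      ≡⟨ ∑ш-cong u (λ p q → deal-cong flip es q λ r → cong F (trans (τ~-++ (act flip e p) r)
           (cong (τ~ r ++_) (invFun-act flip e p)))) ⟩
    ∑ш (λ p q → deal flip es q (λ r → F (τ~ r ++ act flip (not e) p))) u
      ≡⟨ ∑ш-cong u (λ p q → deal-act flip true es (λ v → F (v ++ act flip (not e) p)) q) ⟩
    ∑ш (λ p q → deal flip (reverse (map not es)) q (λ v → F (v ++ act flip (not e) p))) u
      ≡⟨ ∑ш-comm _ u ⟩
    ∑ш (λ q p → deal flip (reverse (map not es)) q (λ v → F (v ++ act flip (not e) p))) u
      ≡⟨ ∑ш-cong u (λ q p → deal-cong flip (reverse (map not es)) q λ v → deal-single flip (not e) p (λ r → F (v ++ r))) ⟨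
    ∑ш (λ q p → deal flip (reverse (map not es)) q (λ v → deal flip (not e ∷ []) p (λ r → F (v ++ r)))) u
      ≡⟨ deal-++ flip (reverse (map not es)) (not e ∷ []) F u ⟨
    deal flip (reverse (map not es) ∷ʳ not e) u F
      ≡⟨ cong (λ fs → deal flip fs u F) (unfold-reverse (not e) (map not es)) ⟨
    deal flip (reverse (map not (e ∷ es))) u F ∎

  -- The deal by `es` comes first. A pile of the second deal collects letters from every pile of the
  -- first, so it splits into a full copy of the pattern `es`, twisted when that pile is marked.
  compose : Inv → List Bool → List Bool → List Bool
  compose θ []       es = []
  compose θ (f ∷ fs) es = twist θ f es ++ compose θ fs es

  deal-compose : ∀ θ fs es F u → deal θ es u (λ v → deal θ fs v F) ≡ deal θ (compose θ fs es) u F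
  deal-compose θ []       es F []      = deal-word[] θ es _
  deal-compose θ []       es F (x ∷ u) = trans
    -- The constant weight 1 measures length: a deal of a nonempty word cannot have the empty
    -- outcome, and a second deal without piles gives 0 on every other.
    (deal-cong-wt θ es (x ∷ u) λ { [] e → ⊥-elim (0≢1+n (e (λ _ → 1))) ; (y ∷ r) e → refl })
    (deal-0 θ es (x ∷ u))
  deal-compose θ (f ∷ fs) es F u = begin
    deal θ es u (∑ш (λ p q → deal θ fs q (λ r → F (act θ f p ++ r))))
      ≡⟨ deal-coalgebra θ es _ u ⟩
    ∑ш (λ p q → deal θ es p (λ v → deal θ es q (λ w → deal θ fs w (λ r → F (act θ f v ++ r))))) u
      ≡⟨ ∑ш-cong u (λ p q → deal-cong θ es p λ v → deal-compose θ fs es _ q) ⟩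
    ∑ш (λ p q → deal θ es p (λ v → deal θ (compose θ fs es) q (λ r → F (act θ f v ++ r)))) u
      ≡⟨ ∑ш-cong u (λ p q → deal-act θ f es _ p) ⟩
    ∑ш (λ p q → deal θ (twist θ f es) p (λ v → deal θ (compose θ fs es) q (λ r → F (v ++ r)))) u
      ≡⟨ deal-++ θ (twist θ f es) (compose θ fs es) F u ⟨
    deal θ (twist θ f es ++ compose θ fs es) u F ∎

  -- Duality between the shuffle operators and deals

  χL : Letter → Letter → ℕ
  χL x y with x ≟L y
  ... | yes _ = 1
  ... | no  _ = 0

  -- The pairing for which words are an orthonormal basis. It is defined letter by letter, as a
  -- product, so that adjointness can be proved by recursion on words.
  χ : Word → Word → ℕ
  χ []      []      = 1
  χ []      (y ∷ v) = 0
  χ (x ∷ u) []      = 0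
  χ (x ∷ u) (y ∷ v) = χL x y * χ u v

  χL-refl : ∀ x → χL x x ≡ 1
  χL-refl x with x ≟L x
  ... | yes _  = refl
  ... | no x≢x = ⊥-elim (x≢x refl)

  χL-≢ : ∀ {x y} → x ≢ y → χL x y ≡ 0
  χL-≢ {x} {y} x≢y with x ≟L y
  ... | yes x≡y = ⊥-elim (x≢y x≡y)
  ... | no _    = refl

  χ-refl : ∀ w → χ w w ≡ 1
  χ-refl []      = refl
  χ-refl (x ∷ w) = cong₂ _*_ (χL-refl x) (χ-refl w)

  χ-∷ : ∀ x u v → χ (x ∷ u) (x ∷ v) ≡ χ u v
  χ-∷ x u v = trans (cong (_* χ u v) (χL-refl x)) (*-identityˡ _)

  χ-≢ : ∀ {u v} → u ≢ v → χ u v ≡ 0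
  χ-≢ {[]}    {[]}    u≢v = ⊥-elim (u≢v refl)
  χ-≢ {[]}    {_ ∷ _} u≢v = refl
  χ-≢ {_ ∷ _} {[]}    u≢v = refl
  χ-≢ {x ∷ u} {y ∷ v} u≢v with x ≟L y
  ... | no _     = refl
  ... | yes refl = trans (*-identityˡ _) (χ-≢ λ u≡v → u≢v (cong (x ∷_) u≡v))

  χ-involution : ∀ (f : Word → Word) → (∀ w → f (f w) ≡ w) → ∀ u v → χ (f u) v ≡ χ u (f v)
  χ-involution f ff u v with u ≟W f v
  ... | yes refl = trans (cong (λ w → χ w v) (ff v)) (trans (χ-refl v) (sym (χ-refl (f v))))
  ... | no u≢    = trans (χ-≢ λ e → u≢ (trans (sym (ff u)) (cong f e))) (sym (χ-≢ u≢))

  coeff-Σ : ∀ u ws → coeff u ws ≡ Σ[ (λ v → χ v u) ] ws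
  coeff-Σ u []       = refl
  coeff-Σ u (v ∷ ws) with u ≟W v
  ... | yes refl = cong₂ _+_ (sym (χ-refl u)) (coeff-Σ u ws)
  ... | no u≢v   = cong₂ _+_ (sym (χ-≢ λ e → u≢v (sym e))) (coeff-Σ u ws)

  Σ-χ-map-[] : ∀ x ws → Σ[ (λ v → χ v []) ] (map (x ∷_) ws) ≡ 0
  Σ-χ-map-[] x []       = refl
  Σ-χ-map-[] x (w ∷ ws) = Σ-χ-map-[] x ws

  Σ-χ-map-∷ : ∀ x z u ws → Σ[ (λ v → χ v (z ∷ u)) ] (map (x ∷_) ws) ≡ χL x z * Σ[ (λ v → χ v u) ] ws
  Σ-χ-map-∷ x z u ws = trans (Σ-map (λ v → χ v (z ∷ u)) (x ∷_) ws) (Σ-* (χL x z) (λ v → χ v u) ws)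

  -- Shuffling is adjoint to unshuffling: the first letter of `u` comes from `p` or from `q`, which
  -- matches the two summands of `shuffle` with the two of `∑ш`.
  shuffle-dual : ∀ p q u → Σ[ (λ v → χ v u) ] (shuffle p q) ≡ ∑ш (λ p′ q′ → χ p p′ * χ q q′) u
  shuffle-dual [] q u = begin
    χ q u + 0                              ≡⟨ sym (∑ш-nil _ u λ _ _ _ → refl) ⟩
    ∑ш (λ p′ q′ → χ [] p′ * χ q q′) u     ∎
  shuffle-dual (x ∷ p) [] u = begin
    χ (x ∷ p) u + 0                              ≡⟨ +-identityʳ _ ⟩
    χ (x ∷ p) u                                  ≡⟨ *-identityʳ _ ⟨
    χ (x ∷ p) u * 1                              ≡⟨ ∑ш-nil _ u (λ _ _ q′ → *-zeroʳ (χ (x ∷ p) q′)) ⟨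
    ∑ш (λ q′ p′ → χ (x ∷ p) p′ * χ [] q′) u     ≡⟨ ∑ш-comm _ u ⟩
    ∑ш (λ p′ q′ → χ (x ∷ p) p′ * χ [] q′) u     ∎
  shuffle-dual (x ∷ p) (y ∷ q) [] = begin
    Σ[ (λ v → χ v []) ] (map (x ∷_) (shuffle p (y ∷ q)) ++ map (y ∷_) (shuffle (x ∷ p) q))
      ≡⟨ Σ-++ _ (map (x ∷_) (shuffle p (y ∷ q))) _ ⟩
    _ ≡⟨ cong₂ _+_ (Σ-χ-map-[] x (shuffle p (y ∷ q))) (Σ-χ-map-[] y (shuffle (x ∷ p) q)) ⟩
    0 ∎
  shuffle-dual (x ∷ p) (y ∷ q) (z ∷ u) = begin
    Σ[ (λ v → χ v (z ∷ u)) ] (map (x ∷_) (shuffle p (y ∷ q)) ++ map (y ∷_) (shuffle (x ∷ p) q))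
      ≡⟨ Σ-++ _ (map (x ∷_) (shuffle p (y ∷ q))) _ ⟩
    _ ≡⟨ cong₂ _+_ (Σ-χ-map-∷ x z u (shuffle p (y ∷ q))) (Σ-χ-map-∷ y z u (shuffle (x ∷ p) q)) ⟩
    _ ≡⟨ cong₂ (λ a b → χL x z * a + χL y z * b) (shuffle-dual p (y ∷ q) u) (shuffle-dual (x ∷ p) q u) ⟩
    χL x z * ∑ш (λ p′ q′ → χ p p′ * χ (y ∷ q) q′) u + χL y z * ∑ш (λ p′ q′ → χ (x ∷ p) p′ * χ q q′) u
      ≡⟨ cong₂ _+_ (∑ш-* (χL x z) _ u) (∑ш-* (χL y z) _ u) ⟨
    ∑ш (λ p′ q′ → χL x z * (χ p p′ * χ (y ∷ q) q′)) u + ∑ш (λ p′ q′ → χL y z * (χ (x ∷ p) p′ * χ q q′)) u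
      ≡⟨ cong₂ _+_ (∑ш-cong u λ p′ q′ → sym (*-assoc (χL x z) _ _))
                   (∑ш-cong u λ p′ q′ → shift (χL y z) (χ (x ∷ p) p′) (χ q q′)) ⟩
    ∑ш (λ p′ q′ → χ (x ∷ p) (z ∷ p′) * χ (y ∷ q) q′) u + ∑ш (λ p′ q′ → χ (x ∷ p) p′ * χ (y ∷ q) (z ∷ q′)) u ∎
    where
    shift : ∀ a b c → a * (b * c) ≡ b * (a * c)
    shift = solve-∀

  unmult : List Word → Word → ℕ
  unmult []       u = χ [] u
  unmult (w ∷ ws) u = ∑ш (λ p q → χ w p * unmult ws q) u

  -- `unmult` splits off the first factor while `mult` multiplies the last one on the outside;
  -- coassociativity reconciles the two bracketings.
  unmult-∷ʳ : ∀ ws w u → ∑ш (λ p q → unmult ws p * χ w q) u ≡ unmult (ws ∷ʳ w) u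
  unmult-∷ʳ [] w u = begin
    ∑ш (λ p q → χ [] p * χ w q) u   ≡⟨ ∑ш-comm _ u ⟩
    ∑ш (λ p q → χ [] q * χ w p) u   ≡⟨ ∑ш-cong u (λ p q → *-comm (χ [] q) _) ⟩
    ∑ш (λ p q → χ w p * χ [] q) u   ∎
  unmult-∷ʳ (v ∷ ws) w u = begin
    ∑ш (λ s q → ∑ш (λ p r → χ v p * unmult ws r) s * χ w q) u
      ≡⟨ ∑ш-cong u (λ s q → trans (*-comm _ (χ w q)) (trans (sym (∑ш-* (χ w q) _ s))
           (∑ш-cong s λ p r → rearrange (χ w q) (χ v p) (unmult ws r)))) ⟩
    ∑ш (λ s q → ∑ш (λ p r → χ v p * (unmult ws r * χ w q)) s) u
      ≡⟨ ∑ш-assoc (λ p r q → χ v p * (unmult ws r * χ w q)) u ⟩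
    ∑ш (λ p t → ∑ш (λ r q → χ v p * (unmult ws r * χ w q)) t) u
      ≡⟨ ∑ш-cong u (λ p t → trans (∑ш-* (χ v p) _ t) (cong (χ v p *_) (unmult-∷ʳ ws w t))) ⟩
    ∑ш (λ p t → χ v p * unmult (ws ∷ʳ w) t) u ∎
    where
    rearrange : ∀ a b c → a * (b * c) ≡ b * (c * a)
    rearrange = solve-∀

  mult-dual : ∀ ws u → Σ[ (λ v → χ v u) ] (mult ws) ≡ unmult ws u
  mult-dual ws u = trans (go (reverse ws) u) (cong (λ vs → unmult vs u) (reverse-involutive ws))
    where
    step : Word → List Word → List Word
    step w acc = shuffleL acc w
    go : ∀ rs u → Σ[ (λ v → χ v u) ] (foldr step ([] ∷ []) rs) ≡ unmult (reverse rs) u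
    go []       u = +-identityʳ _
    go (w ∷ rs) u = begin
      Σ[ (λ v → χ v u) ] (concatMap (λ v → shuffle v w) acc)
        ≡⟨ Σ-concatMap (λ v → χ v u) (λ v → shuffle v w) acc ⟩
      Σ[ (λ v → Σ[ (λ v → χ v u) ] (shuffle v w)) ] acc
        ≡⟨ Σ-cong acc (λ v _ → trans (shuffle-dual v w u) (∑ш-cong u λ p q → *-comm (χ v p) _)) ⟩
      Σ[ (λ v → ∑ш (λ p q → χ w q * χ v p) u) ] acc
        ≡⟨ Σ-∑ш (λ v p q → χ w q * χ v p) acc u ⟩
      ∑ш (λ p q → Σ[ (λ v → χ w q * χ v p) ] acc) u
        ≡⟨ ∑ш-cong u (λ p q → trans (Σ-* (χ w q) (λ v → χ v p) acc) (trans (cong (χ w q *_) (go rs p)) (*-comm (χ w q) _))) ⟩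
      ∑ш (λ p q → unmult (reverse rs) p * χ w q) u
        ≡⟨ unmult-∷ʳ (reverse rs) w u ⟩
      unmult (reverse rs ∷ʳ w) u
        ≡⟨ cong (λ vs → unmult vs u) (unfold-reverse w rs) ⟨
      unmult (reverse (w ∷ rs)) u ∎
      where acc = foldr step ([] ∷ []) rs

  splits-dual : ∀ w p r → Σ[ (λ s → χ (proj₁ s) p * χ (proj₂ s) r) ] (splits w) ≡ χ w (p ++ r)
  splits-dual []      []      r = trans (+-identityʳ _) (*-identityˡ _)
  splits-dual []      (z ∷ p) r = refl
  splits-dual (x ∷ w) p       r = trans (cong (χ [] p * χ (x ∷ w) r +_) (Σ-map _ (λ s → (x ∷ proj₁ s , proj₂ s)) (splits w))) (rest p)
    where
    rest : ∀ p → χ [] p * χ (x ∷ w) r + Σ[ (λ s → χ (x ∷ proj₁ s) p * χ (proj₂ s) r) ] (splits w) ≡ χ (x ∷ w) (p ++ r)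
    rest []      = trans (cong₂ _+_ (*-identityˡ (χ (x ∷ w) r)) (Σ-* 0 (λ _ → 0) (splits w))) (+-identityʳ _)
    rest (z ∷ p) = trans (Σ-cong (splits w) λ s _ → *-assoc (χL x z) _ _)
      (trans (Σ-* (χL x z) _ (splits w)) (cong (χL x z *_) (splits-dual w p r)))

  alternation : Bool → ℕ → List Bool
  alternation b zero    = []
  alternation b (suc a) = b ∷ alternation (not b) a

  alternate-∷ : ∀ θ b w ws → alternate (invFun θ) b (w ∷ ws) ≡ act θ b w ∷ alternate (invFun θ) (not b) ws
  alternate-∷ θ false w ws = refl
  alternate-∷ θ true  w ws = refl

  -- Cutting, acting and shuffling have as adjoint dealing, acting and concatenating. The involution
  -- is self-adjoint, so it moves from the piece of `w` to the pile of `u`.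
  deconc-dual : ∀ θ b a w u →
    Σ[ (λ fs → unmult (alternate (invFun θ) b fs) u) ] (deconc (suc a) w) ≡ deal θ (alternation b (suc a)) u (χ w)
  deconc-dual θ b zero w u = begin
    unmult (alternate (invFun θ) b (w ∷ [])) u + 0     ≡⟨ +-identityʳ _ ⟩
    unmult (alternate (invFun θ) b (w ∷ [])) u         ≡⟨ cong (λ ws → unmult ws u) (alternate-∷ θ b w []) ⟩
    ∑ш (λ p q → χ (act θ b w) p * χ [] q) u            ≡⟨ ∑ш-comm _ u ⟩
    ∑ш (λ q p → χ (act θ b w) p * χ [] q) u            ≡⟨ ∑ш-nil _ u (λ _ _ q → *-zeroʳ (χ (act θ b w) q)) ⟩
    χ (act θ b w) u * 1                                ≡⟨ *-identityʳ _ ⟩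
    χ (act θ b w) u                                    ≡⟨ χ-involution (act θ b) (act-involutive θ b) w u ⟩
    χ w (act θ b u)                                    ≡⟨ deal-single θ b u (χ w) ⟨
    deal θ (b ∷ []) u (χ w)                            ∎
  deconc-dual θ b (suc a) w u = begin
    Σ[ g ] (concatMap (λ s → map (proj₁ s ∷_) (deconc (suc a) (proj₂ s))) (splits w))
      ≡⟨ Σ-concatMap g _ (splits w) ⟩
    Σ[ (λ s → Σ[ g ] (map (proj₁ s ∷_) (deconc (suc a) (proj₂ s)))) ] (splits w)
      ≡⟨ Σ-cong (splits w) (λ s _ → term (proj₁ s) (proj₂ s)) ⟩
    Σ[ (λ s → ∑ш (λ p q → deal θ es q (λ r → χ (proj₁ s) (act θ b p) * χ (proj₂ s) r)) u) ] (splits w)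
      ≡⟨ Σ-∑ш (λ s p q → deal θ es q (λ r → χ (proj₁ s) (act θ b p) * χ (proj₂ s) r)) (splits w) u ⟩
    ∑ш (λ p q → Σ[ (λ s → deal θ es q (λ r → χ (proj₁ s) (act θ b p) * χ (proj₂ s) r)) ] (splits w)) u
      ≡⟨ ∑ш-cong u (λ p q → trans (deal-Σ θ es (λ s r → χ (proj₁ s) (act θ b p) * χ (proj₂ s) r) (splits w) q)
           (deal-cong θ es q λ r → splits-dual w (act θ b p) r)) ⟩
    ∑ш (λ p q → deal θ es q (λ r → χ w (act θ b p ++ r))) u ∎
    where
    es = alternation (not b) (suc a)
    g : List Word → ℕ
    g fs = unmult (alternate (invFun θ) b fs) u
    term : ∀ w₁ w₂ → Σ[ g ] (map (w₁ ∷_) (deconc (suc a) w₂)) ≡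
                     ∑ш (λ p q → deal θ es q (λ r → χ w₁ (act θ b p) * χ w₂ r)) u
    term w₁ w₂ = begin
      Σ[ g ] (map (w₁ ∷_) ds)
        ≡⟨ Σ-map g (w₁ ∷_) ds ⟩
      Σ[ (λ fs → g (w₁ ∷ fs)) ] ds
        ≡⟨ Σ-cong ds (λ fs _ → cong (λ ws → unmult ws u) (alternate-∷ θ b w₁ fs)) ⟩
      Σ[ (λ fs → ∑ш (λ p q → χ (act θ b w₁) p * unmult (alternate (invFun θ) (not b) fs) q) u) ] ds
        ≡⟨ Σ-∑ш (λ fs p q → χ (act θ b w₁) p * unmult (alternate (invFun θ) (not b) fs) q) ds u ⟩
      ∑ш (λ p q → Σ[ (λ fs → χ (act θ b w₁) p * unmult (alternate (invFun θ) (not b) fs) q) ] ds) u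
        ≡⟨ ∑ш-cong u (λ p q → trans (Σ-* (χ (act θ b w₁) p) _ ds)
             (trans (cong₂ _*_ (χ-involution (act θ b) (act-involutive θ b) w₁ p) (deconc-dual θ (not b) a w₂ q))
                    (sym (deal-* θ es (χ w₁ (act θ b p)) (χ w₂) q)))) ⟩
      ∑ш (λ p q → deal θ es q (λ r → χ w₁ (act θ b p) * χ w₂ r)) u ∎
      where ds = deconc (suc a) w₂

  coeff-op : ∀ θ s a w u → coeff u (op θ s (suc a) w) ≡ deal θ (alternation (firstApplied s) (suc a)) u (χ w)
  coeff-op θ s a w u = begin
    coeff u (op θ s (suc a) w)
      ≡⟨ coeff-Σ u (op θ s (suc a) w) ⟩
    Σ[ (λ v → χ v u) ] (concatMap (λ fs → mult (alternate (invFun θ) (firstApplied s) fs)) (deconc (suc a) w))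
      ≡⟨ Σ-concatMap _ _ (deconc (suc a) w) ⟩
    Σ[ (λ fs → Σ[ (λ v → χ v u) ] (mult (alternate (invFun θ) (firstApplied s) fs))) ] (deconc (suc a) w)
      ≡⟨ Σ-cong (deconc (suc a) w) (λ fs _ → mult-dual (alternate (invFun θ) (firstApplied s) fs) u) ⟩
    Σ[ (λ fs → unmult (alternate (invFun θ) (firstApplied s) fs) u) ] (deconc (suc a) w)
      ≡⟨ deconc-dual θ (firstApplied s) a w u ⟩
    deal θ (alternation (firstApplied s) (suc a)) u (χ w) ∎

  -- Counting the deals that return a word

  Distinct : Word → Set
  Distinct = AllPairs (λ x y → proj₁ x ≢ proj₁ y)

  falses trues : List Bool → ℕ
  falses []           = 0
  falses (false ∷ es) = suc (falses es)
  falses (true ∷ es)  = falses es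
  trues []           = 0
  trues (false ∷ es) = trues es
  trues (true ∷ es)  = suc (trues es)

  -- The number of multisets of size n from b kinds. The recursion is that of the fixed deals: the
  -- first unmarked pile takes one more letter, or it is closed.
  multichoose : ℕ → ℕ → ℕ
  multichoose zero    zero    = 1
  multichoose zero    (suc n) = 0
  multichoose (suc b) zero    = 1
  multichoose (suc b) (suc n) = multichoose (suc b) n + multichoose b (suc n)

  distinct-value : ∀ {w x y} → Distinct w → x ∈ w → y ∈ w → proj₁ x ≡ proj₁ y → x ≡ y
  distinct-value (_ ∷ _)  (here refl) (here refl) e = refl
  distinct-value (d ∷ _)  (here refl) (there y∈)  e = ⊥-elim (All.lookup d y∈ e)
  distinct-value (d ∷ _)  (there x∈)  (here refl) e = ⊥-elim (All.lookup d x∈ (sym e))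
  distinct-value (_ ∷ dw) (there x∈)  (there y∈)  e = distinct-value dw x∈ y∈ e

  barL∉ : ∀ {w x} → Distinct w → x ∈ w → barL x ∉ w
  barL∉ {w} {x} dw x∈ bx∈ = not≢ (proj₂ x) (cong proj₂ (distinct-value dw x∈ bx∈ refl))
    where
    not≢ : ∀ b → b ≢ not b
    not≢ false ()
    not≢ true ()

  barL∈act : ∀ θ x p → barL x ∈ act θ true (x ∷ p)
  barL∈act rot  x p = here refl
  barL∈act flip x p = subst (barL x ∈_) (sym (unfold-reverse (barL x) (τ p))) (∈-++⁺ʳ (reverse (τ p)) (here refl))

  deal-fixed : ∀ θ es w → Distinct w → deal θ es w (χ w) ≡ multichoose (falses es) (length w)
  deal-fixed θ []           []      dw = refl
  deal-fixed θ []           (x ∷ w) dw = refl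
  deal-fixed θ (true ∷ es)  w       dw = begin
    ∑ш (λ p q → deal θ es q (λ r → χ w (act θ true p ++ r))) w
      -- A nonempty marked pile puts the bar of one of its letters into the outcome, while no letter
      -- of `w` occurs there barred as well; hence the marked pile is empty.
      ≡⟨ ∑ш-head _ (All.tabulate (barL∉ dw)) (λ { x p q (bx∉ ∷ _) → trans
           (deal-cong θ es q λ r → χ-≢ {w} {act θ true (x ∷ p) ++ r} λ e →
             bx∉ (subst (barL x ∈_) (sym e) (∈-++⁺ˡ (barL∈act θ x p)))) (deal-0 θ es q) }) ⟩
    deal θ es w (λ r → χ w (act θ true [] ++ r))
      ≡⟨ cong (λ v → deal θ es w (λ r → χ w (v ++ r))) (act-[] θ true) ⟩
    deal θ es w (χ w)
      ≡⟨ deal-fixed θ es w dw ⟩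
    multichoose (falses es) (length w) ∎
  deal-fixed θ (false ∷ es) []      dw = deal-word[] θ es (χ [])
  deal-fixed θ (false ∷ es) (x ∷ w) (dx ∷ dw) = cong₂ _+_
    (trans (∑ш-cong w λ p q → deal-cong θ es q λ r → χ-∷ x w (p ++ r)) (deal-fixed θ (false ∷ es) w dw))
    -- If `x` goes to a later pile, a nonempty first pile would start the outcome with a letter of
    -- another value than `x`; so the first pile is empty and is dropped.
    (trans (∑ш-head (λ p q → deal θ es (x ∷ q) (λ r → χ (x ∷ w) (p ++ r))) dx
              (λ { y p q (y≢x ∷ _) → trans
                     (deal-cong θ es (x ∷ q) λ r → χ-≢ {x ∷ w} {y ∷ p ++ r} λ e → y≢x (cong proj₁ (proj₁ (∷-injective e)))) (deal-0 θ es (x ∷ q)) }))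
           (deal-fixed θ es (x ∷ w) (dx ∷ dw)))

-- Signed permutations: enumeration and closure under deals

module SignedPermutations where

  open Dealing
  open import Data.Bool using (Bool; true; false; not; if_then_else_)
  open import Data.Empty using (⊥; ⊥-elim)
  open import Data.List using (List; []; _∷_; _++_; map; length; reverse; concatMap; upTo; applyUpTo)
  open import Data.List.Properties using (unfold-reverse; map-upTo; length-upTo; length-map)
  open import Data.List.Membership.Propositional using (_∈_; _∉_)
  open import Data.List.Membership.Propositional.Properties using (∈-upTo⁻; ∈-map⁻)
  open import Data.List.Relation.Unary.Any using (here; there)
  open import Data.List.Relation.Unary.All as All using (All; []; _∷_)
  import Data.List.Relation.Unary.All.Properties as All
  open import Data.List.Relation.Unary.AllPairs using ([]; _∷_)
  open import Data.List.Relation.Unary.Unique.Propositional using (Unique)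
  import Data.List.Relation.Unary.Unique.Propositional.Properties as Unique
  open import Data.Nat using (ℕ; zero; suc; _+_; _*_; _^_; _!; _∸_; _/_; _≤_; _≡ᵇ_; z≤n; s≤s; NonZero)
  open import Data.Nat.DivMod using (m*n/n≡m)
  open import Data.Nat.Properties hiding (_≟_)
  import Data.Nat.Properties as ℕ
  open import Data.List.Membership.DecPropositional ℕ._≟_ using (_∈?_)
  open import Data.Nat.Tactic.RingSolver using (solve-∀)
  open import Data.Product using (_×_; _,_; ∃; proj₁; proj₂)
  open import Function using (_∘_; id)
  open import Relation.Binary.PropositionalEquality
  open import Relation.Nullary using (yes; no; does)
  open import Relation.Nullary.Decidable using (dec-true; dec-false)
  open ≡-Reasoning

  Σ-+ : ∀ {A : Set} (f g : A → ℕ) xs → Σ[ (λ x → f x + g x) ] xs ≡ Σ[ f ] xs + Σ[ g ] xs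
  Σ-+ f g []       = refl
  Σ-+ f g (x ∷ xs) = trans (cong (f x + g x +_) (Σ-+ f g xs)) (swap (f x) (g x) _ _)
    where
    swap : ∀ a b c d → (a + b) + (c + d) ≡ (a + c) + (b + d)
    swap = solve-∀

  Σ-0 : ∀ {A : Set} (xs : List A) → Σ[ (λ _ → 0) ] xs ≡ 0
  Σ-0 []       = refl
  Σ-0 (_ ∷ xs) = Σ-0 xs

  Σ-swap : ∀ {A B : Set} (f : A → B → ℕ) xs ys →
           Σ[ (λ x → Σ[ f x ] ys) ] xs ≡ Σ[ (λ y → Σ[ (λ x → f x y) ] xs) ] ys
  Σ-swap f []       ys = sym (Σ-0 ys)
  Σ-swap f (x ∷ xs) ys = trans (cong (Σ[ f x ] ys +_) (Σ-swap f xs ys)) (sym (Σ-+ (f x) _ ys))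

  Σ-const : ∀ {A : Set} k (xs : List A) → Σ[ (λ _ → k) ] xs ≡ length xs * k
  Σ-const k []       = refl
  Σ-const k (x ∷ xs) = cong (k +_) (Σ-const k xs)

  Σ-χ : ∀ (f : Word → ℕ) {bs} w → Unique bs → w ∈ bs → Σ[ (λ v → χ v w * f v) ] bs ≡ f w
  Σ-χ f {_ ∷ bs} w (w∉ ∷ _) (here refl) = begin
    χ w w * f w + Σ[ (λ v → χ v w * f v) ] bs
      ≡⟨ cong₂ (λ y z → y * f w + z) (χ-refl w) (trans (Σ-cong bs λ v v∈ → cong (_* f v) (χ-≢ λ e → All.lookup w∉ v∈ (sym e))) (Σ-0 bs)) ⟩
    1 * f w + 0
      ≡⟨ trans (+-identityʳ _) (*-identityˡ _) ⟩
    f w ∎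
  Σ-χ f {b ∷ bs} w (b∉ ∷ ub) (there w∈) =
    cong₂ (λ y z → y * f b + z) (χ-≢ (All.lookup b∉ w∈)) (Σ-χ f w ub w∈)

  [_≐_] : ℕ → ℕ → ℕ
  [ i ≐ j ] = if does (j ℕ.≟ i) then 1 else 0

  [≐]-refl : ∀ i → [ i ≐ i ] ≡ 1
  [≐]-refl i = cong (if_then 1 else 0) (dec-true (i ℕ.≟ i) refl)

  [≐]-≢ : ∀ {i j} → i ≢ j → [ i ≐ j ] ≡ 0
  [≐]-≢ {i} {j} i≢j = cong (if_then 1 else 0) (dec-false (j ℕ.≟ i) λ e → i≢j (sym e))

  occurrences-wt : ∀ i w → occurrences i w ≡ wt [ i ≐_] w
  occurrences-wt i []            = refl
  occurrences-wt i ((j , b) ∷ w) with j ≡ᵇ i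
  ... | true  = cong suc (occurrences-wt i w)
  ... | false = occurrences-wt i w

  length-wt : ∀ w → length w ≡ wt (λ _ → 1) w
  length-wt []      = refl
  length-wt (x ∷ w) = cong suc (length-wt w)

  signedPerm-wt : ∀ {n} u v → (∀ φ → wt φ v ≡ wt φ u) → IsSignedPerm n u → IsSignedPerm n v
  signedPerm-wt u v e (len , occ) =
    trans (length-wt v) (trans (e _) (trans (sym (length-wt u)) len)) ,
    λ i 1≤i i≤n → trans (occurrences-wt i v) (trans (e _) (trans (sym (occurrences-wt i u)) (occ i 1≤i i≤n)))

  Σ-occurrences-≤ : ∀ {is} → Unique is → ∀ w → Σ[ (λ i → wt [ i ≐_] w) ] is ≤ length w
  Σ-occurrences-≤ {is} ui []            = ≤-reflexive (Σ-0 is)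
  Σ-occurrences-≤ {is} ui ((j , b) ∷ w) = ≤-trans (≤-reflexive (Σ-+ [_≐ j ] (λ i → wt [ i ≐_] w) is))
    (+-mono-≤ (atMostOnce ui) (Σ-occurrences-≤ ui w))
    where
    atMostOnce : ∀ {is} → Unique is → Σ[ [_≐ j ] ] is ≤ 1
    atMostOnce [] = z≤n
    atMostOnce {i ∷ is} (i∉ ∷ ui) with j ℕ.≟ i
    ... | yes refl = ≤-reflexive (cong₂ _+_ ([≐]-refl i) (trans (Σ-cong is λ k k∈ → [≐]-≢ λ e → All.lookup i∉ k∈ (sym e)) (Σ-0 is)))
    ... | no j≢i   = ≤-trans (≤-reflexive (cong (_+ Σ[ [_≐ j ] ] is) ([≐]-≢ λ e → j≢i (sym e)))) (atMostOnce ui)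

  -- By pigeonhole: the values 1, ..., n already account for n letters, which is the length of the
  -- word. `IsSignedPerm` does not bound the letters explicitly, so this has to be derived.
  signedPerm-outside : ∀ {n} w → IsSignedPerm n w → ∀ i → i ∉ map suc (upTo n) → wt [ i ≐_] w ≡ 0
  signedPerm-outside {n} w (len , occ) i i∉ = n≤0⇒n≡0 (+-cancelʳ-≤ n _ 0
    (subst₂ (λ k l → wt [ i ≐_] w + k ≤ l) total len
      (Σ-occurrences-≤ (All.¬Any⇒All¬ _ i∉ ∷ Unique.map⁺ suc-injective (Unique.upTo⁺ n)) w)))
    where
    once : ∀ k → k ∈ map suc (upTo n) → wt [ k ≐_] w ≡ 1
    once k k∈ with ∈-map⁻ suc k∈
    ... | m , m∈ , refl = trans (sym (occurrences-wt k w)) (occ (suc m) (s≤s z≤n) (∈-upTo⁻ m∈))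
    total : Σ[ (λ k → wt [ k ≐_] w) ] (map suc (upTo n)) ≡ n
    total = begin
      Σ[ (λ k → wt [ k ≐_] w) ] (map suc (upTo n)) ≡⟨ Σ-cong (map suc (upTo n)) once ⟩
      Σ[ (λ _ → 1) ] (map suc (upTo n))            ≡⟨ Σ-map _ suc (upTo n) ⟩
      Σ[ (λ _ → 1) ] (upTo n)                      ≡⟨ Σ-const 1 (upTo n) ⟩
      length (upTo n) * 1                          ≡⟨ *-identityʳ _ ⟩
      length (upTo n)                              ≡⟨ length-upTo n ⟩
      n                                            ∎

  signedPerm-distinct : ∀ {n} w → IsSignedPerm n w → Distinct w
  signedPerm-distinct {n} w sp = go w atMostOnce
    where
    atMostOnce : ∀ i → wt [ i ≐_] w ≤ 1
    atMostOnce i with i ∈? map suc (upTo n)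
    ... | no i∉ = ≤-trans (≤-reflexive (signedPerm-outside w sp i i∉)) z≤n
    ... | yes i∈ with ∈-map⁻ suc i∈
    ...   | m , m∈ , refl = ≤-reflexive (trans (sym (occurrences-wt i w)) (proj₂ sp i (s≤s z≤n) (∈-upTo⁻ m∈)))
    absent : ∀ i v → wt [ i ≐_] v ≡ 0 → All (λ y → i ≢ proj₁ y) v
    absent i []            e = []
    absent i ((j , _) ∷ v) e with j ℕ.≟ i
    ... | no j≢i   = (λ i≡j → j≢i (sym i≡j)) ∷ absent i v (m+n≡0⇒n≡0 [ i ≐ j ] e)
    ... | yes refl = ⊥-elim (0≢1+n (trans (sym e) (cong (_+ wt [ i ≐_] v) ([≐]-refl i))))
    go : ∀ v → (∀ i → wt [ i ≐_] v ≤ 1) → Distinct v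
    go []            h = []
    go ((j , b) ∷ v) h =
      absent j v (n≤0⇒n≡0 (≤-pred (subst (λ k → k + wt [ j ≐_] v ≤ 1) ([≐]-refl j) (h j)))) ∷
      go v λ i → ≤-trans (m≤n+m _ _) (h i)

  shuffle-wt : ∀ p q → All (λ r → ∀ φ → wt φ r ≡ wt φ p + wt φ q) (shuffle p q)
  shuffle-wt []      q       = (λ φ → refl) ∷ []
  shuffle-wt (x ∷ p) []      = (λ φ → sym (+-identityʳ _)) ∷ []
  shuffle-wt (x ∷ p) (y ∷ q) = All.++⁺
    (All.map⁺ (All.map (λ e φ → trans (cong (φ (proj₁ x) +_) (e φ)) (sym (+-assoc (φ (proj₁ x)) _ _))) (shuffle-wt p (y ∷ q))))
    (All.map⁺ (All.map (λ e φ → trans (cong (φ (proj₁ y) +_) (e φ)) (shift (φ (proj₁ y)) (φ (proj₁ x) + wt φ p) (wt φ q))) (shuffle-wt (x ∷ p) q)))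
    where
    shift : ∀ a b c → a + (b + c) ≡ b + (a + c)
    shift = solve-∀

  -- Shuffling with a one-letter word inserts that letter at every position, which makes
  -- `shuffle-dual` available for counting.
  insertions : ℕ → Word → List Word
  insertions i v = shuffle ((i , false) ∷ []) v ++ shuffle ((i , true) ∷ []) v

  -- A reference enumeration: the list `bs` of the theorem is arbitrary, and its length is found by
  -- comparison with this one.
  signedPerms : ℕ → List Word
  signedPerms zero    = [] ∷ []
  signedPerms (suc n) = concatMap (insertions (suc n)) (signedPerms n)

  signedPerms-sound : ∀ n → All (IsSignedPerm n) (signedPerms n)
  signedPerms-sound zero    = (refl , λ { (suc i) _ () }) ∷ []
  signedPerms-sound (suc n) = All.concat⁺ (All.map⁺ (All.map (λ {v} sp →
    All.++⁺ (All.map (λ {r} → insert v sp r) (shuffle-wt ((suc n , false) ∷ []) v)) (All.map (λ {r} → insert v sp r) (shuffle-wt ((suc n , true) ∷ []) v)))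
    (signedPerms-sound n)))
    where
    insert : ∀ v → IsSignedPerm n v → ∀ r → (∀ φ → wt φ r ≡ φ (suc n) + 0 + wt φ v) → IsSignedPerm (suc n) r
    insert v sp@(len , occ) r e =
      trans (length-wt r) (trans (e _) (cong suc (trans (sym (length-wt v)) len))) ,
      λ i 1≤i i≤1+n → trans (occurrences-wt i r) (trans (e _) (count i 1≤i i≤1+n))
      where
      count : ∀ i → 1 ≤ i → i ≤ suc n → [ i ≐ suc n ] + 0 + wt [ i ≐_] v ≡ 1
      count i 1≤i i≤1+n with i ℕ.≟ suc n
      ... | yes refl = cong₂ (λ y z → y + 0 + z) ([≐]-refl i) (signedPerm-outside v sp i λ i∈ → outside (∈-map⁻ suc i∈))
        where
        outside : ∃ (λ m → m ∈ upTo n × i ≡ suc m) → ⊥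
        outside (m , m∈ , refl) = <-irrefl refl (∈-upTo⁻ m∈)
      ... | no i≢ = cong₂ (λ y z → y + 0 + z) ([≐]-≢ i≢)
        (trans (sym (occurrences-wt i v)) (occ i 1≤i (≤-pred (≤∧≢⇒< i≤1+n i≢))))

  length-signedPerms : ∀ n → Σ[ (λ _ → 1) ] (signedPerms n) ≡ 2 ^ n * n !
  length-signedPerms zero    = refl
  length-signedPerms (suc n) = begin
    Σ[ (λ _ → 1) ] (concatMap (insertions (suc n)) (signedPerms n))
      ≡⟨ Σ-concatMap _ (insertions (suc n)) (signedPerms n) ⟩
    Σ[ (λ v → Σ[ (λ _ → 1) ] (insertions (suc n) v)) ] (signedPerms n)
      ≡⟨ Σ-cong (signedPerms n) (λ v v∈ → trans (Σ-++ _ (shuffle ((suc n , false) ∷ []) v) _)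
           (cong₂ _+_ (count _ v (proj₁ (All.lookup (signedPerms-sound n) v∈))) (count _ v (proj₁ (All.lookup (signedPerms-sound n) v∈))))) ⟩
    Σ[ (λ _ → suc n + suc n) ] (signedPerms n)
      ≡⟨ trans (Σ-cong (signedPerms n) λ _ _ → sym (*-identityʳ _)) (Σ-* (suc n + suc n) (λ _ → 1) (signedPerms n)) ⟩
    (suc n + suc n) * Σ[ (λ _ → 1) ] (signedPerms n)
      ≡⟨ cong ((suc n + suc n) *_) (length-signedPerms n) ⟩
    (suc n + suc n) * (2 ^ n * n !)
      ≡⟨ rearrange (suc n) (2 ^ n) (n !) ⟩
    2 ^ suc n * suc n ! ∎
    where
    rearrange : ∀ m p f → (m + m) * (p * f) ≡ 2 * p * (m * f)
    rearrange = solve-∀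
    count′ : ∀ x v → Σ[ (λ _ → 1) ] (shuffle (x ∷ []) v) ≡ suc (length v)
    count′ x []      = refl
    count′ x (y ∷ v) = cong suc (trans (Σ-map (λ _ → 1) (y ∷_) (shuffle (x ∷ []) v)) (count′ x v))
    count : ∀ x v → length v ≡ n → Σ[ (λ _ → 1) ] (shuffle (x ∷ []) v) ≡ suc n
    count x v e = trans (count′ x v) (cong suc e)

  ∑ш-singleton : ∀ x w → ∑ш (λ p _ → χ (x ∷ []) p) w ≡ Σ[ χL x ] w
  ∑ш-singleton x []      = refl
  ∑ш-singleton x (y ∷ w) = cong₂ _+_
    (trans (∑ш-* (χL x y) (λ p _ → χ [] p) w)
      (trans (cong (χL x y *_) (∑ш-nil (λ p _ → χ [] p) w λ _ _ _ → refl)) (*-identityʳ _)))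
    (∑ш-singleton x w)

  χL-either : ∀ i y → χL (i , false) y + χL (i , true) y ≡ [ i ≐ proj₁ y ]
  χL-either i (j , b) with j ℕ.≟ i
  ... | no j≢i = trans (cong₂ _+_ (χL-≢ λ e → j≢i (sym (cong proj₁ e))) (χL-≢ λ e → j≢i (sym (cong proj₁ e))))
                       (sym ([≐]-≢ λ e → j≢i (sym e)))
  χL-either i (i , false) | yes refl = trans (cong₂ _+_ (χL-refl (i , false)) (χL-≢ λ ())) (sym ([≐]-refl i))
  χL-either i (i , true)  | yes refl = trans (cong₂ _+_ (χL-≢ λ ()) (χL-refl (i , true))) (sym ([≐]-refl i))

  -- By duality the count ranges over ways to remove a letter of value n + 1 from `w`. The rest is a
  -- signed permutation of n, counted once by induction, and exactly one letter of `w` has that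
  -- value.
  signedPerms-complete : ∀ n w → IsSignedPerm n w → Σ[ (λ v → χ v w) ] (signedPerms n) ≡ 1
  signedPerms-complete zero    []      sp = refl
  signedPerms-complete zero    (_ ∷ _) (() , _)
  signedPerms-complete (suc n) w sp@(len , occ) = begin
    Σ[ (λ v → χ v w) ] (concatMap (insertions (suc n)) (signedPerms n))
      ≡⟨ Σ-concatMap _ (insertions (suc n)) (signedPerms n) ⟩
    Σ[ (λ v → Σ[ (λ r → χ r w) ] (insertions (suc n) v)) ] (signedPerms n)
      ≡⟨ Σ-cong (signedPerms n) (λ v _ → Σ-++ _ (shuffle (x ∷ []) v) (shuffle (y ∷ []) v)) ⟩
    Σ[ (λ v → Σ[ (λ r → χ r w) ] (shuffle (x ∷ []) v) + Σ[ (λ r → χ r w) ] (shuffle (y ∷ []) v)) ] (signedPerms n)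
      ≡⟨ Σ-+ _ _ (signedPerms n) ⟩
    Σ[ (λ v → Σ[ (λ r → χ r w) ] (shuffle (x ∷ []) v)) ] (signedPerms n)
    + Σ[ (λ v → Σ[ (λ r → χ r w) ] (shuffle (y ∷ []) v)) ] (signedPerms n)
      ≡⟨ cong₂ _+_ (count false) (count true) ⟩
    Σ[ χL x ] w + Σ[ χL y ] w
      ≡⟨ Σ-+ (χL x) (χL y) w ⟨
    Σ[ (λ z → χL x z + χL y z) ] w
      ≡⟨ Σ-cong w (λ z _ → χL-either (suc n) z) ⟩
    wt [ suc n ≐_] w
      ≡⟨ occurrences-wt (suc n) w ⟨
    occurrences (suc n) w
      ≡⟨ occ (suc n) (s≤s z≤n) ≤-refl ⟩
    1 ∎
    where
    x y : Letter
    x = (suc n , false)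
    y = (suc n , true)
    count : ∀ b → Σ[ (λ v → Σ[ (λ r → χ r w) ] (shuffle ((suc n , b) ∷ []) v)) ] (signedPerms n) ≡ Σ[ χL (suc n , b) ] w
    count b = begin
      Σ[ (λ v → Σ[ (λ r → χ r w) ] (shuffle (z ∷ []) v)) ] (signedPerms n)
        ≡⟨ Σ-cong (signedPerms n) (λ v _ → shuffle-dual (z ∷ []) v w) ⟩
      Σ[ (λ v → ∑ш (λ p q → χ (z ∷ []) p * χ v q) w) ] (signedPerms n)
        ≡⟨ Σ-∑ш (λ v p q → χ (z ∷ []) p * χ v q) (signedPerms n) w ⟩
      ∑ш (λ p q → Σ[ (λ v → χ (z ∷ []) p * χ v q) ] (signedPerms n)) w
        ≡⟨ ∑ш-cong-wt w (λ p q e → trans (Σ-* (χ (z ∷ []) p) (λ v → χ v q) (signedPerms n)) (remove p q e)) ⟩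
      ∑ш (λ p q → χ (z ∷ []) p) w
        ≡⟨ ∑ш-singleton z w ⟩
      Σ[ χL z ] w ∎
      where
      z : Letter
      z = (suc n , b)
      remove : ∀ p q → (∀ φ → wt φ p + wt φ q ≡ wt φ w) →
               χ (z ∷ []) p * Σ[ (λ v → χ v q) ] (signedPerms n) ≡ χ (z ∷ []) p
      remove p q e with (z ∷ []) ≟W p
      ... | no z≢p = trans (cong (_* _) (χ-≢ z≢p)) (sym (χ-≢ z≢p))
      ... | yes refl = trans (cong (χ (z ∷ []) (z ∷ []) *_) (signedPerms-complete n q
        ( suc-injective (trans (cong suc (length-wt q)) (trans (e _) (trans (sym (length-wt w)) len)))
        , λ i 1≤i i≤n → trans (occurrences-wt i q) (trans
            (cong (λ k → k + 0 + wt [ i ≐_] q) (sym ([≐]-≢ {i} {suc n} λ { refl → <-irrefl refl i≤n })))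
            (trans (e [ i ≐_]) (trans (sym (occurrences-wt i w)) (occ i 1≤i (m≤n⇒m≤1+n i≤n)))))))) (*-identityʳ _)

  module _ {n : ℕ} {bs : List Word} (ub : Unique bs) (sound : ∀ {w} → w ∈ bs → IsSignedPerm n w)
           (complete : ∀ {w} → IsSignedPerm n w → w ∈ bs) where

    -- Double counting of the equal pairs between `bs` and `signedPerms n`: each word of either list
    -- has exactly one partner in the other.
    length-bs : length bs ≡ 2 ^ n * n !
    length-bs = begin
      length bs
        ≡⟨ trans (sym (*-identityʳ _)) (sym (Σ-const 1 bs)) ⟩
      Σ[ (λ _ → 1) ] bs
        ≡⟨ Σ-cong bs (λ w w∈ → sym (signedPerms-complete n w (sound w∈))) ⟩
      Σ[ (λ w → Σ[ (λ v → χ v w) ] (signedPerms n)) ] bs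
        ≡⟨ Σ-swap (λ w v → χ v w) bs (signedPerms n) ⟩
      Σ[ (λ v → Σ[ (λ w → χ v w) ] bs) ] (signedPerms n)
        ≡⟨ Σ-cong (signedPerms n) (λ v v∈ → trans (Σ-cong bs λ w _ → trans (χ-sym v w) (sym (*-identityʳ _)))
             (Σ-χ (λ _ → 1) v ub (complete (All.lookup (signedPerms-sound n) v∈)))) ⟩
      Σ[ (λ _ → 1) ] (signedPerms n)
        ≡⟨ length-signedPerms n ⟩
      2 ^ n * n ! ∎
      where
      χ-sym : ∀ u v → χ u v ≡ χ v u
      χ-sym u v with u ≟W v
      ... | yes refl = refl
      ... | no u≢v   = trans (χ-≢ u≢v) (sym (χ-≢ λ e → u≢v (sym e)))

    -- Matrix multiplication is composition of deals. The sum over `bs` collapses at the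
    -- intermediate word, which lies in `bs` because a deal preserves the multiset of values.
    Σ-deal : ∀ θ fs es {u} → u ∈ bs → ∀ w →
             Σ[ (λ v → deal θ es u (χ v) * deal θ fs v (χ w)) ] bs ≡ deal θ (compose θ fs es) u (χ w)
    Σ-deal θ fs es {u} u∈ w = begin
      Σ[ (λ v → deal θ es u (χ v) * deal θ fs v (χ w)) ] bs
        ≡⟨ Σ-cong bs (λ v _ → trans (*-comm (deal θ es u (χ v)) _) (trans (sym (deal-* θ es (deal θ fs v (χ w)) (χ v) u))
             (deal-cong θ es u λ r → *-comm (deal θ fs v (χ w)) (χ v r)))) ⟩
      Σ[ (λ v → deal θ es u (λ r → χ v r * deal θ fs v (χ w))) ] bs
        ≡⟨ deal-Σ θ es (λ v r → χ v r * deal θ fs v (χ w)) bs u ⟩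
      deal θ es u (λ r → Σ[ (λ v → χ v r * deal θ fs v (χ w)) ] bs)
        ≡⟨ deal-cong-wt θ es u (λ r e → Σ-χ (λ v → deal θ fs v (χ w)) r ub (complete (signedPerm-wt u r e (sound u∈)))) ⟩
      deal θ es u (λ r → deal θ fs r (χ w))
        ≡⟨ deal-compose θ fs es (χ w) u ⟩
      deal θ (compose θ fs es) u (χ w) ∎

  -- Multiset counts and rising factorials

  prodVal : (ℕ → ℕ) → ℕ → ℕ → ℕ
  prodVal f y zero    = 1
  prodVal f y (suc m) = (y + f m) * prodVal f y m

  prodVal-cong : ∀ {f g y z} m → (∀ j → y + f j ≡ z + g j) → prodVal f y m ≡ prodVal g z m
  prodVal-cong zero    h = refl
  prodVal-cong (suc m) h = cong₂ _*_ (h m) (prodVal-cong m h)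

  prodVal-shift : ∀ f y m → prodVal f y (suc m) ≡ (y + f 0) * prodVal (f ∘ suc) y m
  prodVal-shift f y zero    = refl
  prodVal-shift f y (suc m) = trans (cong ((y + f (suc m)) *_) (prodVal-shift f y m))
    (swap (y + f (suc m)) (y + f 0) (prodVal (f ∘ suc) y m))
    where
    swap : ∀ a b c → a * (b * c) ≡ b * (a * c)
    swap = solve-∀

  rising-suc : ∀ b n → prodVal id b (suc n) ≡ b * prodVal id (suc b) n
  rising-suc b n = trans (prodVal-shift id b n) (cong₂ _*_ (+-identityʳ b) (prodVal-cong n λ j → +-suc b j))

  -- `prodVal id b n` is the rising factorial b(b + 1)⋯(b + n - 1). Both summands of the recursion
  -- share the factor (b + 1)⋯(b + n), with coefficients n + 1 and b.
  multichoose-rising : ∀ b n → n ! * multichoose b n ≡ prodVal id b n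
  multichoose-rising zero    zero    = refl
  multichoose-rising zero    (suc n) = trans (*-zeroʳ (suc n !)) (sym (rising-suc 0 n))
  multichoose-rising (suc b) zero    = refl
  multichoose-rising (suc b) (suc n) = begin
    suc n * n ! * (multichoose (suc b) n + multichoose b (suc n))
      ≡⟨ expand (suc n) (n !) (multichoose (suc b) n) (multichoose b (suc n)) ⟩
    suc n * (n ! * multichoose (suc b) n) + suc n ! * multichoose b (suc n)
      ≡⟨ cong₂ (λ y z → suc n * y + z) (multichoose-rising (suc b) n) (trans (multichoose-rising b (suc n)) (rising-suc b n)) ⟩
    suc n * prodVal id (suc b) n + b * prodVal id (suc b) n
      ≡⟨ collect n b (prodVal id (suc b) n) ⟩
    (suc b + n) * prodVal id (suc b) n ∎
    where
    expand : ∀ m f p q → m * f * (p + q) ≡ m * (f * p) + m * f * q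
    expand = solve-∀
    collect : ∀ n b r → suc n * r + b * r ≡ (suc b + n) * r
    collect = solve-∀

  prodVal-double : ∀ b n → 2 ^ n * prodVal id b n ≡ prodVal (2 *_) (2 * b) n
  prodVal-double b zero    = refl
  prodVal-double b (suc n) = trans (rearrange (2 ^ n) b n (prodVal id b n)) (cong ((2 * b + 2 * n) *_) (prodVal-double b n))
    where
    rearrange : ∀ p b n r → 2 * p * ((b + n) * r) ≡ (2 * b + 2 * n) * (p * r)
    rearrange = solve-∀

  fixed-count : ∀ b n → 2 ^ n * n ! * multichoose b n ≡ prodVal (2 *_) (2 * b) n
  fixed-count b n = trans (*-assoc (2 ^ n) _ _)
    (trans (cong (2 ^ n *_) (multichoose-rising b n)) (prodVal-double b n))

  -- Numbers of marked and unmarked piles in composed patterns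

  falses-++ : ∀ es fs → falses (es ++ fs) ≡ falses es + falses fs
  falses-++ []           fs = refl
  falses-++ (false ∷ es) fs = cong suc (falses-++ es fs)
  falses-++ (true ∷ es)  fs = falses-++ es fs

  trues≡falses-not : ∀ es → trues es ≡ falses (map not es)
  trues≡falses-not []           = refl
  trues≡falses-not (false ∷ es) = trues≡falses-not es
  trues≡falses-not (true ∷ es)  = cong suc (trues≡falses-not es)

  falses≡trues-not : ∀ es → falses es ≡ trues (map not es)
  falses≡trues-not []           = refl
  falses≡trues-not (false ∷ es) = cong suc (falses≡trues-not es)
  falses≡trues-not (true ∷ es)  = falses≡trues-not es

  trues-++ : ∀ es fs → trues (es ++ fs) ≡ trues es + trues fs
  trues-++ []           fs = refl
  trues-++ (false ∷ es) fs = trues-++ es fs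
  trues-++ (true ∷ es)  fs = cong suc (trues-++ es fs)

  falses-reverse : ∀ es → falses (reverse es) ≡ falses es
  falses-reverse []       = refl
  falses-reverse (e ∷ es) = begin
    falses (reverse (e ∷ es))              ≡⟨ cong falses (unfold-reverse e es) ⟩
    falses (reverse es ++ e ∷ [])          ≡⟨ falses-++ (reverse es) (e ∷ []) ⟩
    falses (reverse es) + falses (e ∷ [])  ≡⟨ cong (_+ falses (e ∷ [])) (falses-reverse es) ⟩
    falses es + falses (e ∷ [])            ≡⟨ +-comm (falses es) _ ⟩
    falses (e ∷ []) + falses es            ≡⟨ falses-++ (e ∷ []) es ⟨
    falses (e ∷ es)                        ∎

  trues-reverse : ∀ es → trues (reverse es) ≡ trues es
  trues-reverse []       = refl
  trues-reverse (e ∷ es) = begin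
    trues (reverse (e ∷ es))             ≡⟨ cong trues (unfold-reverse e es) ⟩
    trues (reverse es ++ e ∷ [])         ≡⟨ trues-++ (reverse es) (e ∷ []) ⟩
    trues (reverse es) + trues (e ∷ [])  ≡⟨ cong (_+ trues (e ∷ [])) (trues-reverse es) ⟩
    trues es + trues (e ∷ [])            ≡⟨ +-comm (trues es) _ ⟩
    trues (e ∷ []) + trues es            ≡⟨ trues-++ (e ∷ []) es ⟨
    trues (e ∷ es)                       ∎

  falses-twist : ∀ θ es → falses (twist θ true es) ≡ trues es
  falses-twist rot  es = sym (trues≡falses-not es)
  falses-twist flip es = trans (falses-reverse (map not es)) (sym (trues≡falses-not es))

  trues-twist : ∀ θ es → trues (twist θ true es) ≡ falses es
  trues-twist rot  es = sym (falses≡trues-not es)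
  trues-twist flip es = trans (trues-reverse (map not es)) (sym (falses≡trues-not es))

  -- A pile of the composed pattern is unmarked exactly when its two marks agree.
  falses-compose : ∀ θ fs es → falses (compose θ fs es) ≡ falses fs * falses es + trues fs * trues es
  falses-compose θ []           es = refl
  falses-compose θ (false ∷ fs) es = trans (falses-++ es _)
    (trans (cong (falses es +_) (falses-compose θ fs es)) (sym (+-assoc (falses es) _ _)))
  falses-compose θ (true ∷ fs)  es = trans (falses-++ (twist θ true es) _)
    (trans (cong₂ _+_ (falses-twist θ es) (falses-compose θ fs es)) (swap (trues es) (falses fs * falses es) _))
    where
    swap : ∀ a b c → a + (b + c) ≡ b + (a + c)
    swap = solve-∀

  trues-compose : ∀ θ fs es → trues (compose θ fs es) ≡ falses fs * trues es + trues fs * falses es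
  trues-compose θ []           es = refl
  trues-compose θ (false ∷ fs) es = trans (trues-++ es _)
    (trans (cong (trues es +_) (trues-compose θ fs es)) (sym (+-assoc (trues es) _ _)))
  trues-compose θ (true ∷ fs)  es = trans (trues-++ (twist θ true es) _)
    (trans (cong₂ _+_ (trues-twist θ es) (trues-compose θ fs es)) (swap (falses es) (falses fs * trues es) _))
    where
    swap : ∀ a b c → a + (b + c) ≡ b + (a + c)
    swap = solve-∀

  -- Indexed from the first power, like `matPow`.
  composePow : Inv → List Bool → ℕ → List Bool
  composePow θ es zero    = es
  composePow θ es (suc k) = compose θ es (composePow θ es k)

  composePow-size : ∀ θ es k → falses (composePow θ es k) + trues (composePow θ es k) ≡ (falses es + trues es) ^ suc k
  composePow-size θ es zero    = sym (*-identityʳ _)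
  composePow-size θ es (suc k) = begin
    falses (compose θ es fs) + trues (compose θ es fs)
      ≡⟨ cong₂ _+_ (falses-compose θ es fs) (trues-compose θ es fs) ⟩
    (falses es * falses fs + trues es * trues fs) + (falses es * trues fs + trues es * falses fs)
      ≡⟨ factor (falses es) (trues es) (falses fs) (trues fs) ⟩
    (falses es + trues es) * (falses fs + trues fs)
      ≡⟨ cong ((falses es + trues es) *_) (composePow-size θ es k) ⟩
    (falses es + trues es) ^ suc (suc k) ∎
    where
    fs = composePow θ es k
    factor : ∀ a b c d → (a * c + b * d) + (a * d + b * c) ≡ (a + b) * (c + d)
    factor = solve-∀

  falses-balanced : ∀ θ es k → falses es ≡ trues es →
                    2 * falses (composePow θ es k) ≡ (falses es + trues es) ^ suc k
  falses-balanced θ es k h = begin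
    2 * falses fs          ≡⟨ cong (falses fs +_) (+-identityʳ _) ⟩
    falses fs + falses fs  ≡⟨ cong (falses fs +_) (balanced k) ⟩
    falses fs + trues fs   ≡⟨ composePow-size θ es k ⟩
    _                      ∎
    where
    fs = composePow θ es k
    balanced : ∀ k → falses (composePow θ es k) ≡ trues (composePow θ es k)
    balanced zero    = h
    balanced (suc k) = begin
      falses (compose θ es gs)                            ≡⟨ falses-compose θ es gs ⟩
      falses es * falses gs + trues es * trues gs         ≡⟨ cong₂ (λ x y → falses es * x + trues es * y) (balanced k) (sym (balanced k)) ⟩
      falses es * trues gs + trues es * falses gs         ≡⟨ trues-compose θ es gs ⟨
      trues (compose θ es gs)                             ∎
      where gs = composePow θ es k

  -- The sign rule for differences, here 1 · 1 = 1, followed by (-1)(-1) = 1 and (-1) · 1 = -1. Each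
  -- difference is written as a successor equation in order to stay within ℕ.
  excess-compose : ∀ θ fs es → falses fs ≡ suc (trues fs) → falses es ≡ suc (trues es) →
                   falses (compose θ fs es) ≡ suc (trues (compose θ fs es))
  excess-compose θ fs es hf he = begin
    falses (compose θ fs es)                               ≡⟨ falses-compose θ fs es ⟩
    falses fs * falses es + trues fs * trues es            ≡⟨ cong₂ (λ x y → x * y + trues fs * trues es) hf he ⟩
    suc (trues fs) * suc (trues es) + trues fs * trues es  ≡⟨ arith (trues fs) (trues es) ⟩
    suc (suc (trues fs) * trues es + trues fs * suc (trues es)) ≡⟨ cong₂ (λ x y → suc (x * trues es + trues fs * y)) hf he ⟨
    suc (falses fs * trues es + trues fs * falses es)      ≡⟨ cong suc (trues-compose θ fs es) ⟨
    suc (trues (compose θ fs es))                          ∎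
    where
    arith : ∀ s t → suc s * suc t + s * t ≡ suc (suc s * t + s * suc t)
    arith = solve-∀

  deficit-compose : ∀ θ fs es → trues fs ≡ suc (falses fs) → trues es ≡ suc (falses es) →
                    falses (compose θ fs es) ≡ suc (trues (compose θ fs es))
  deficit-compose θ fs es hf he = begin
    falses (compose θ fs es)                               ≡⟨ falses-compose θ fs es ⟩
    falses fs * falses es + trues fs * trues es            ≡⟨ cong₂ (λ x y → falses fs * falses es + x * y) hf he ⟩
    falses fs * falses es + suc (falses fs) * suc (falses es)  ≡⟨ arith (falses fs) (falses es) ⟩
    suc (falses fs * suc (falses es) + suc (falses fs) * falses es) ≡⟨ cong₂ (λ x y → suc (falses fs * y + x * falses es)) hf he ⟨
    suc (falses fs * trues es + trues fs * falses es)      ≡⟨ cong suc (trues-compose θ fs es) ⟨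
    suc (trues (compose θ fs es))                          ∎
    where
    arith : ∀ s t → s * t + suc s * suc t ≡ suc (s * suc t + suc s * t)
    arith = solve-∀

  mixed-compose : ∀ θ fs es → trues fs ≡ suc (falses fs) → falses es ≡ suc (trues es) →
                  trues (compose θ fs es) ≡ suc (falses (compose θ fs es))
  mixed-compose θ fs es hf he = begin
    trues (compose θ fs es)                                ≡⟨ trues-compose θ fs es ⟩
    falses fs * trues es + trues fs * falses es            ≡⟨ cong₂ (λ x y → falses fs * trues es + x * y) hf he ⟩
    falses fs * trues es + suc (falses fs) * suc (trues es)  ≡⟨ arith (falses fs) (trues es) ⟩
    suc (falses fs * suc (trues es) + suc (falses fs) * trues es) ≡⟨ cong₂ (λ x y → suc (falses fs * y + x * trues es)) hf he ⟨
    suc (falses fs * falses es + trues fs * trues es)      ≡⟨ cong suc (falses-compose θ fs es) ⟨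
    suc (falses (compose θ fs es))                         ∎
    where
    arith : ∀ s t → s * t + suc s * suc t ≡ suc (s * suc t + suc s * t)
    arith = solve-∀

  alternation-size : ∀ b a → falses (alternation b a) + trues (alternation b a) ≡ a
  alternation-size b     zero    = refl
  alternation-size false (suc a) = cong suc (alternation-size true a)
  alternation-size true  (suc a) = trans (+-suc _ _) (cong suc (alternation-size false a))

  alternation-even : ∀ b m → falses (alternation b (m * 2)) ≡ trues (alternation b (m * 2))
  alternation-even b     zero    = refl
  alternation-even false (suc m) = cong suc (alternation-even false m)
  alternation-even true  (suc m) = cong suc (alternation-even true m)

  -- Values of polynomials given by coefficient lists

  polyEval : Poly → ℕ → ℕ
  polyEval []      y = 0
  polyEval (c ∷ p) y = c + y * polyEval p y

  -- mulLin is defined through a local function that cannot be named from outside;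
  -- unification with the unfolding of mulLin recovers it.
  mutual
    polyAdd : ℕ → Poly → Poly → Poly → Poly
    polyAdd = _

    mulLin-polyAdd : ∀ c p → mulLin c p ≡ polyAdd c p (0 ∷ p) (map (c *_) p)
    mulLin-polyAdd c p with 0 ∷ p | map (c *_) p
    ... | q | r = refl

  module _ (b : ℕ) (s : Poly) where

    polyEval-polyAdd : ∀ p q y → polyEval (polyAdd b s p q) y ≡ polyEval p y + polyEval q y
    polyEval-polyAdd []      q       y = refl
    polyEval-polyAdd (c ∷ p) []      y = sym (+-identityʳ _)
    polyEval-polyAdd (c ∷ p) (d ∷ q) y = trans (cong (λ r → c + d + y * r) (polyEval-polyAdd p q y))
      (arith c d y (polyEval p y) (polyEval q y))
      where
      arith : ∀ c d y p q → c + d + y * (p + q) ≡ (c + y * p) + (d + y * q)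
      arith = solve-∀

    length-polyAdd : ∀ p q → length q ≤ length p → length (polyAdd b s p q) ≡ length p
    length-polyAdd []      []      _       = refl
    length-polyAdd (c ∷ p) []      _       = refl
    length-polyAdd (c ∷ p) (d ∷ q) (s≤s h) = cong suc (length-polyAdd p q h)

  polyEval-scale : ∀ c p y → polyEval (map (c *_) p) y ≡ c * polyEval p y
  polyEval-scale c []      y = sym (*-zeroʳ c)
  polyEval-scale c (d ∷ p) y = trans (cong (λ r → c * d + y * r) (polyEval-scale c p y)) (arith c d y (polyEval p y))
    where
    arith : ∀ c d y p → c * d + y * (c * p) ≡ c * (d + y * p)
    arith = solve-∀

  polyEval-mulLin : ∀ c p y → polyEval (mulLin c p) y ≡ (y + c) * polyEval p y
  polyEval-mulLin c p y = begin
    polyEval (mulLin c p) y                              ≡⟨ cong (λ q → polyEval q y) (mulLin-polyAdd c p) ⟩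
    polyEval (polyAdd c p (0 ∷ p) (map (c *_) p)) y      ≡⟨ polyEval-polyAdd c p (0 ∷ p) (map (c *_) p) y ⟩
    y * polyEval p y + polyEval (map (c *_) p) y         ≡⟨ cong (y * polyEval p y +_) (polyEval-scale c p y) ⟩
    y * polyEval p y + c * polyEval p y                  ≡⟨ *-distribʳ-+ (polyEval p y) y c ⟨
    (y + c) * polyEval p y                               ∎

  length-mulLin : ∀ c p → length (mulLin c p) ≡ suc (length p)
  length-mulLin c p = trans (cong length (mulLin-polyAdd c p))
    (length-polyAdd c p (0 ∷ p) (map (c *_) p) (≤-trans (≤-reflexive (length-map (c *_) p)) (n≤1+n _)))

  polyEval-prodLin : ∀ f m y → polyEval (prodLin f m) y ≡ prodVal f y m
  polyEval-prodLin f zero    y = cong suc (*-zeroʳ y)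
  polyEval-prodLin f (suc m) y = trans (polyEval-mulLin (f m) (prodLin f m) y)
    (cong ((y + f m) *_) (polyEval-prodLin f m y))

  length-prodLin : ∀ f m → length (prodLin f m) ≡ suc m
  length-prodLin f zero    = refl
  length-prodLin f (suc m) = trans (length-mulLin (f m) (prodLin f m)) (cong suc (length-prodLin f m))

  -- Links the multiplicities, read off by `coeffAt`, to the Horner form; any range that covers the
  -- list will do, as the missing coefficients are 0.
  polyEval-coeffAt : ∀ p y m → length p ≤ m → Σ[ (λ k → coeffAt p k * y ^ k) ] (upTo m) ≡ polyEval p y
  polyEval-coeffAt []      y m       h       = Σ-0 (upTo m)
  polyEval-coeffAt (c ∷ p) y (suc m) (s≤s h) = cong₂ _+_ (*-identityʳ c) (begin
    Σ[ g ] (applyUpTo suc m)                             ≡⟨ cong Σ[ g ] (map-upTo suc m) ⟨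
    Σ[ g ] (map suc (upTo m))                            ≡⟨ Σ-map g suc (upTo m) ⟩
    Σ[ (λ k → coeffAt p k * (y * y ^ k)) ] (upTo m)      ≡⟨ Σ-cong (upTo m) (λ k _ → swap (coeffAt p k) y (y ^ k)) ⟩
    Σ[ (λ k → y * (coeffAt p k * y ^ k)) ] (upTo m)      ≡⟨ Σ-* y _ (upTo m) ⟩
    y * Σ[ (λ k → coeffAt p k * y ^ k) ] (upTo m)        ≡⟨ cong (y *_) (polyEval-coeffAt p y m h) ⟩
    y * polyEval p y                                     ∎)
    where
    g : ℕ → ℕ
    g k = coeffAt (c ∷ p) k * y ^ k
    swap : ∀ a b c → a * (b * c) ≡ b * (a * c)
    swap = solve-∀

  -- The odd factors of (2n)! are separated from the even ones. `prodVal (2 *_) 1 n` is the double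
  -- factorial 1 · 3 ⋯ (2n - 1), which is `polyEven n` at 1: the total multiplicity of the nonzero
  -- eigenvalues for a even.
  factorial-double : ∀ n → (2 * n) ! ≡ prodVal (2 *_) 1 n * (2 ^ n * n !)
  factorial-double zero    = refl
  factorial-double (suc n) = begin
    (2 * suc n) !
      ≡⟨ cong _! (double n) ⟩
    suc (suc (2 * n)) * (suc (2 * n) * (2 * n) !)
      ≡⟨ cong (λ f → suc (suc (2 * n)) * (suc (2 * n) * f)) (factorial-double n) ⟩
    suc (suc (2 * n)) * (suc (2 * n) * (prodVal (2 *_) 1 n * (2 ^ n * n !)))
      ≡⟨ rearrange n (prodVal (2 *_) 1 n) (2 ^ n) (n !) ⟩
    (suc (2 * n) * prodVal (2 *_) 1 n) * (2 * 2 ^ n * (suc n * n !)) ∎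
    where
    double : ∀ n → 2 * suc n ≡ suc (suc (2 * n))
    double = solve-∀
    rearrange : ∀ n p q f → suc (suc (2 * n)) * (suc (2 * n) * (p * (q * f))) ≡ (suc (2 * n) * p) * (2 * q * (suc n * f))
    rearrange = solve-∀

  oddFactorial-≤ : ∀ n → prodVal (2 *_) 1 n ≤ 2 ^ n * n !
  oddFactorial-≤ zero    = ≤-refl
  oddFactorial-≤ (suc n) = ≤-trans
    (*-mono-≤ (n≤1+n (suc (2 * n))) (oddFactorial-≤ n))
    (≤-reflexive (rearrange n (2 ^ n) (n !)))
    where
    rearrange : ∀ n q f → suc (suc (2 * n)) * (q * f) ≡ 2 * q * (suc n * f)
    rearrange = solve-∀

  -- `zeroMult` uses truncated subtraction; the bound on the double factorial shows that nothing is
  -- truncated.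
  zeroMult-+ : ∀ n → zeroMult n + prodVal (2 *_) 1 n ≡ 2 ^ n * n !
  zeroMult-+ n = trans (cong (λ q → 2 ^ n * n ! ∸ q + prodVal (2 *_) 1 n) quotient)
    (m∸n+n≡m (oddFactorial-≤ n))
    where
    instance
      2ⁿn!≢0 : NonZero (2 ^ n * n !)
      2ⁿn!≢0 = m*n≢0 (2 ^ n) (n !) {{m^n≢0 2 n}} {{n !≢0}}
    quotient : (2 * n) ! / (2 ^ n * n !) ≡ prodVal (2 *_) 1 n
    quotient = trans (cong (_/ (2 ^ n * n !)) (factorial-double n)) (m*n/n≡m (prodVal (2 *_) 1 n) (2 ^ n * n !))

  prodVal-2 : ∀ n → prodVal (2 *_) 2 n ≡ 2 ^ n * n !
  prodVal-2 zero    = refl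
  prodVal-2 (suc n) = trans (cong ((2 + 2 * n) *_) (prodVal-2 n)) (rearrange n (2 ^ n) (n !))
    where
    rearrange : ∀ n q f → (2 + 2 * n) * (q * f) ≡ 2 * q * (suc n * f)
    rearrange = solve-∀

  double-excess : ∀ es → falses es ≡ suc (trues es) → 2 * falses es ≡ suc (falses es + trues es)
  double-excess es h = trans (cong (2 *_) h) (trans (double (trues es)) (cong (λ f → suc (f + trues es)) (sym h)))
    where
    double : ∀ t → 2 * suc t ≡ suc (suc t + t)
    double = solve-∀

open CharacteristicPolynomial
open Dealing
open SignedPermutations
open import Data.Bool using (Bool; true; false)
open import Data.Empty using (⊥-elim)
import Data.Integer as ℤ
import Data.Integer.Tactic.RingSolver as ℤSolver
open import Data.List using (List; []; _∷_; _++_; map; length; concatMap; replicate; upTo)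
open import Data.List.Membership.Propositional using (_∈_)
open import Data.List.Membership.Propositional.Properties using (∈-upTo⁻)
open import Data.List.Properties using (length-++; length-replicate; map-++; length-map)
open import Data.List.Relation.Unary.Unique.Propositional using (Unique)
open import Data.Nat as ℕ using (ℕ; zero; suc; NonZero; _!; _∸_)
open import Data.Nat.Divisibility using (_∣_; divides)
import Data.Nat.Properties as ℕ
import Data.Nat.Tactic.RingSolver as ℕSolver
open import Data.Product using (_×_; _,_; ∃)
open import Data.Rational as ℚ using (ℚ; _+_; _*_; _-_; -_; 0ℚ; 1ℚ; toℚᵘ)
open import Data.Rational.Properties as ℚ
import Data.Rational.Unnormalised as ℚᵘ
import Data.Rational.Unnormalised.Properties as ℚᵘ
open import Data.Rational.Solver using (module +-*-Solver)
open import Data.Sum using (_⊎_; inj₁; inj₂)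
open import Function.Bundles using (_⇔_; Equivalence)
open import Relation.Binary.PropositionalEquality
open import Relation.Nullary using (¬_)
open ≡-Reasoning
open PS using (fromℕ)
open Q using (∑)

-- Natural numbers inside the rationals

fromℕ-+ : ∀ m n → fromℕ (m ℕ.+ n) ≡ fromℕ m + fromℕ n
fromℕ-+ zero    n = sym (+-identityˡ (fromℕ n))
fromℕ-+ (suc m) n = trans (cong (1ℚ +_) (fromℕ-+ m n)) (sym (+-assoc 1ℚ (fromℕ m) (fromℕ n)))

fromℕ-* : ∀ m n → fromℕ (m ℕ.* n) ≡ fromℕ m * fromℕ n
fromℕ-* zero    n = sym (*-zeroˡ (fromℕ n))
fromℕ-* (suc m) n = begin
  fromℕ (n ℕ.+ m ℕ.* n)              ≡⟨ fromℕ-+ n (m ℕ.* n) ⟩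
  fromℕ n + fromℕ (m ℕ.* n)          ≡⟨ cong₂ _+_ (sym (*-identityˡ (fromℕ n))) (fromℕ-* m n) ⟩
  1ℚ * fromℕ n + fromℕ m * fromℕ n   ≡⟨ *-distribʳ-+ (fromℕ n) 1ℚ (fromℕ m) ⟨
  (1ℚ + fromℕ m) * fromℕ n           ∎

fromℕ-Σ : ∀ {A : Set} (f : A → ℕ) xs → fromℕ (Σ[ f ] xs) ≡ ∑ (λ x → fromℕ (f x)) xs
fromℕ-Σ f []       = refl
fromℕ-Σ f (x ∷ xs) = trans (fromℕ-+ (f x) (Σ[ f ] xs)) (cong (fromℕ (f x) +_) (fromℕ-Σ f xs))

-- The division of ℚ normalises its result, so the comparison goes through unnormalised fractions,
-- where it is an identity of integers.
fromℕ-fraction : ∀ n → fromℕ n ≡ ℤ.+ n ℚ./ 1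
fromℕ-fraction zero    = refl
fromℕ-fraction (suc n) = trans (cong (1ℚ +_) (fromℕ-fraction n)) (toℚᵘ-injective (ℚᵘ.≃-trans
  (toℚᵘ-homo-+ 1ℚ (ℤ.+ n ℚ./ 1)) (ℚᵘ.≃-trans
  (ℚᵘ.+-congʳ (toℚᵘ 1ℚ) (toℚᵘ-fromℚᵘ (ℚᵘ.mkℚᵘ (ℤ.+ n) 0))) (ℚᵘ.≃-trans
  (ℚᵘ.*≡* (arith (ℤ.+ n)))
  (ℚᵘ.≃-sym (toℚᵘ-fromℚᵘ (ℚᵘ.mkℚᵘ (ℤ.+ suc n) 0)))))))
  where
  arith : ∀ z → (ℤ.1ℤ ℤ.* ℤ.1ℤ ℤ.+ z ℤ.* ℤ.1ℤ) ℤ.* ℤ.1ℤ ≡ (ℤ.1ℤ ℤ.+ z) ℤ.* (ℤ.1ℤ ℤ.* ℤ.1ℤ)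
  arith = ℤSolver.solve-∀

fromℕ-/ : ∀ c d .{{_ : NonZero d}} → (ℤ.+ c ℚ./ d) * fromℕ d ≡ fromℕ c
fromℕ-/ c (suc d) = begin
  (ℤ.+ c ℚ./ suc d) * fromℕ (suc d)   ≡⟨ cong ((ℤ.+ c ℚ./ suc d) *_) (fromℕ-fraction (suc d)) ⟩
  (ℤ.+ c ℚ./ suc d) * (ℤ.+ suc d ℚ./ 1) ≡⟨ toℚᵘ-injective (ℚᵘ.≃-trans
    (toℚᵘ-homo-* (ℤ.+ c ℚ./ suc d) (ℤ.+ suc d ℚ./ 1)) (ℚᵘ.≃-trans
    (ℚᵘ.*-cong (toℚᵘ-fromℚᵘ (ℚᵘ.mkℚᵘ (ℤ.+ c) d)) (toℚᵘ-fromℚᵘ (ℚᵘ.mkℚᵘ (ℤ.+ suc d) 0))) (ℚᵘ.≃-trans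
    (ℚᵘ.*≡* (arith (ℤ.+ c) (ℤ.+ suc d)))
    (ℚᵘ.≃-sym (toℚᵘ-fromℚᵘ (ℚᵘ.mkℚᵘ (ℤ.+ c) 0)))))) ⟩
  ℤ.+ c ℚ./ 1                         ≡⟨ fromℕ-fraction c ⟨
  fromℕ c                           ∎
  where
  arith : ∀ c d → (c ℤ.* d) ℤ.* ℤ.1ℤ ≡ c ℤ.* (d ℤ.* ℤ.1ℤ)
  arith = ℤSolver.solve-∀

fromℕ-cancelʳ : ∀ d .{{_ : NonZero d}} {x y} → x * fromℕ d ≡ y * fromℕ d → x ≡ y
fromℕ-cancelʳ (suc d) {x} {y} e =
  fromℕ-suc-cancel d (trans (*-comm (fromℕ (suc d)) x) (trans e (*-comm y (fromℕ (suc d)))))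

*-interchange : ∀ w x y z → (w * x) * (y * z) ≡ (w * y) * (x * z)
*-interchange = solve 4 (λ w x y z → (w :* x) :* (y :* z) := (w :* y) :* (x :* z)) refl
  where open +-*-Solver

^ℚ-distrib : ∀ x y m → (x * y) ^ℚ m ≡ x ^ℚ m * y ^ℚ m
^ℚ-distrib x y zero    = refl
^ℚ-distrib x y (suc m) = trans (cong (x * y *_) (^ℚ-distrib x y m)) (*-interchange x y (x ^ℚ m) (y ^ℚ m))

fromℕ-^ : ∀ a m → fromℕ (a ℕ.^ m) ≡ fromℕ a ^ℚ m
fromℕ-^ a zero    = refl
fromℕ-^ a (suc m) = trans (fromℕ-* a (a ℕ.^ m)) (cong (fromℕ a *_) (fromℕ-^ a m))

1^ℚ : ∀ m → 1ℚ ^ℚ m ≡ 1ℚ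
1^ℚ zero    = refl
1^ℚ (suc m) = trans (*-identityˡ (1ℚ ^ℚ m)) (1^ℚ m)

prodℚ-++ : ∀ xs ys → prodℚ (xs ++ ys) ≡ prodℚ xs * prodℚ ys
prodℚ-++ []       ys = sym (*-identityˡ (prodℚ ys))
prodℚ-++ (x ∷ xs) ys = trans (cong (x *_) (prodℚ-++ xs ys)) (sym (*-assoc x (prodℚ xs) (prodℚ ys)))

-- Lists of eigenvalues with multiplicities

charProd : ℚ → List ℚ → ℚ
charProd x μs = prodℚ (map (λ μ → x - μ) μs)

charProd-++ : ∀ x μs νs → charProd x (μs ++ νs) ≡ charProd x μs * charProd x νs
charProd-++ x μs νs = trans (cong prodℚ (map-++ (λ μ → x - μ) μs νs)) (prodℚ-++ (map (λ μ → x - μ) μs) (map (λ μ → x - μ) νs))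

charProd-replicate : ∀ x m μ → charProd x (replicate m μ) ≡ (x - μ) ^ℚ m
charProd-replicate x zero    μ = refl
charProd-replicate x (suc m) μ = cong ((x - μ) *_) (charProd-replicate x m μ)

powerSum-++ : ∀ μs νs k → powerSum (μs ++ νs) k ≡ powerSum μs k + powerSum νs k
powerSum-++ μs νs k = Q.∑-++ (λ μ → μ ^ℚ suc k) μs νs

powerSum-replicate : ∀ m μ k → powerSum (replicate m μ) k ≡ fromℕ m * μ ^ℚ suc k
powerSum-replicate zero    μ k = sym (*-zeroˡ (μ ^ℚ suc k))
powerSum-replicate (suc m) μ k = begin
  μ ^ℚ suc k + powerSum (replicate m μ) k    ≡⟨ cong₂ _+_ (sym (*-identityˡ (μ ^ℚ suc k))) (powerSum-replicate m μ k) ⟩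
  1ℚ * μ ^ℚ suc k + fromℕ m * μ ^ℚ suc k     ≡⟨ *-distribʳ-+ (μ ^ℚ suc k) 1ℚ (fromℕ m) ⟨
  (1ℚ + fromℕ m) * μ ^ℚ suc k                ∎

module _ (g : ℕ → ℕ) (f : ℕ → ℚ) where

  withMultiplicity : List ℕ → List ℚ
  withMultiplicity = concatMap (λ k → replicate (g k) (f k))

  charProd-withMultiplicity : ∀ x ks →
    prodℚ (map (λ k → (x - f k) ^ℚ g k) ks) ≡ charProd x (withMultiplicity ks)
  charProd-withMultiplicity x []       = refl
  charProd-withMultiplicity x (k ∷ ks) = trans
    (cong₂ _*_ (sym (charProd-replicate x (g k) (f k))) (charProd-withMultiplicity x ks))
    (sym (charProd-++ x (replicate (g k) (f k)) (withMultiplicity ks)))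

  length-withMultiplicity : ∀ ks → length (withMultiplicity ks) ≡ Σ[ g ] ks
  length-withMultiplicity []       = refl
  length-withMultiplicity (k ∷ ks) = trans (length-++ (replicate (g k) (f k)))
    (cong₂ ℕ._+_ (length-replicate (g k)) (length-withMultiplicity ks))

  powerSum-withMultiplicity : ∀ ks m →
    powerSum (withMultiplicity ks) m ≡ ∑ (λ k → fromℕ (g k) * f k ^ℚ suc m) ks
  powerSum-withMultiplicity []       m = refl
  powerSum-withMultiplicity (k ∷ ks) m = trans (powerSum-++ (replicate (g k) (f k)) (withMultiplicity ks) m)
    (cong₂ _+_ (powerSum-replicate (g k) (f k) m) (powerSum-withMultiplicity ks m))

-- Traces and power sums over a common denominator

module _ (n a : ℕ) .{{a≢0 : NonZero a}} where

  private
    -- Clears the factor (1/aⁿ)^(k+1) of the power M^(k+1), so that traces become counts of deals.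
    denominator : ℕ → ℕ
    denominator k = (a ℕ.^ n) ℕ.^ suc k

  apow-scale : ∀ k → k ℕ.≤ n → apow a k n * fromℕ (a ℕ.^ n) ≡ fromℕ (a ℕ.^ k)
  apow-scale k k≤n = begin
    apow a k n * fromℕ (a ℕ.^ n)
      -- The bound k ≤ n makes `n ∸ k` a true difference, so that aⁿ factors as a^(n-k) a^k.
      ≡⟨ cong (λ m → apow a k n * fromℕ m) (trans (cong (a ℕ.^_) (sym (ℕ.m∸n+n≡m k≤n))) (ℕ.^-distribˡ-+-* a (n ∸ k) k)) ⟩
    apow a k n * fromℕ (a ℕ.^ (n ∸ k) ℕ.* a ℕ.^ k)
      ≡⟨ cong (apow a k n *_) (fromℕ-* (a ℕ.^ (n ∸ k)) (a ℕ.^ k)) ⟩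
    apow a k n * (fromℕ (a ℕ.^ (n ∸ k)) * fromℕ (a ℕ.^ k))
      ≡⟨ *-assoc (apow a k n) (fromℕ (a ℕ.^ (n ∸ k))) (fromℕ (a ℕ.^ k)) ⟨
    apow a k n * fromℕ (a ℕ.^ (n ∸ k)) * fromℕ (a ℕ.^ k)
      ≡⟨ cong (_* fromℕ (a ℕ.^ k)) (fromℕ-/ 1 (a ℕ.^ (n ∸ k)) {{ℕ.m^n≢0 a (n ∸ k)}}) ⟩
    fromℕ 1 * fromℕ (a ℕ.^ k)
      ≡⟨ *-identityˡ (fromℕ (a ℕ.^ k)) ⟩
    fromℕ (a ℕ.^ k) ∎

  eigenvalues : ℚ → Poly → List ℚ
  eigenvalues σ p = withMultiplicity (coeffAt p) (λ k → σ * apow a k n) (upTo (suc n))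

  length-eigenvalues : ∀ σ p → length p ℕ.≤ suc n → length (eigenvalues σ p) ≡ polyEval p 1
  length-eigenvalues σ p len = begin
    length (eigenvalues σ p)
      ≡⟨ length-withMultiplicity (coeffAt p) (λ k → σ * apow a k n) (upTo (suc n)) ⟩
    Σ[ coeffAt p ] (upTo (suc n))
      ≡⟨ Σ-cong (upTo (suc n)) (λ k _ → trans (sym (ℕ.*-identityʳ _)) (cong (coeffAt p k ℕ.*_) (sym (ℕ.^-zeroˡ k)))) ⟩
    Σ[ (λ k → coeffAt p k ℕ.* 1 ℕ.^ k) ] (upTo (suc n))
      ≡⟨ polyEval-coeffAt p 1 (suc n) len ⟩
    polyEval p 1 ∎

  -- Once scaled, the power of σ a^(k-n) becomes σ^(m+1) yᵏ with y = a^(m+1). Weighted by the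
  -- coefficients of `p`, these sum to `p` evaluated at y.
  powerSum-eigenvalues : ∀ σ p → length p ℕ.≤ suc n → ∀ m →
    powerSum (eigenvalues σ p) m * fromℕ (denominator m) ≡ σ ^ℚ suc m * fromℕ (polyEval p (a ℕ.^ suc m))
  powerSum-eigenvalues σ p len m = begin
    powerSum (eigenvalues σ p) m * S
      ≡⟨ cong (_* S) (powerSum-withMultiplicity (coeffAt p) (λ k → σ * apow a k n) (upTo (suc n)) m) ⟩
    ∑ (λ k → fromℕ (coeffAt p k) * (σ * apow a k n) ^ℚ suc m) (upTo (suc n)) * S
      ≡⟨ Q.∑-distribʳ (λ k → fromℕ (coeffAt p k) * (σ * apow a k n) ^ℚ suc m) S (upTo (suc n)) ⟨
    ∑ (λ k → fromℕ (coeffAt p k) * (σ * apow a k n) ^ℚ suc m * S) (upTo (suc n))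
      ≡⟨ Q.∑-cong (upTo (suc n)) term ⟩
    ∑ (λ k → fromℕ (coeffAt p k ℕ.* (a ℕ.^ suc m) ℕ.^ k) * σ ^ℚ suc m) (upTo (suc n))
      ≡⟨ Q.∑-distribʳ (λ k → fromℕ (coeffAt p k ℕ.* (a ℕ.^ suc m) ℕ.^ k)) (σ ^ℚ suc m) (upTo (suc n)) ⟩
    ∑ (λ k → fromℕ (coeffAt p k ℕ.* (a ℕ.^ suc m) ℕ.^ k)) (upTo (suc n)) * σ ^ℚ suc m
      ≡⟨ cong (_* σ ^ℚ suc m) (sym (fromℕ-Σ (λ k → coeffAt p k ℕ.* (a ℕ.^ suc m) ℕ.^ k) (upTo (suc n)))) ⟩
    fromℕ (Σ[ (λ k → coeffAt p k ℕ.* (a ℕ.^ suc m) ℕ.^ k) ] (upTo (suc n))) * σ ^ℚ suc m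
      ≡⟨ cong (λ v → fromℕ v * σ ^ℚ suc m) (polyEval-coeffAt p (a ℕ.^ suc m) (suc n) len) ⟩
    fromℕ (polyEval p (a ℕ.^ suc m)) * σ ^ℚ suc m
      ≡⟨ *-comm (fromℕ (polyEval p (a ℕ.^ suc m))) (σ ^ℚ suc m) ⟩
    σ ^ℚ suc m * fromℕ (polyEval p (a ℕ.^ suc m)) ∎
    where
    S : ℚ
    S = fromℕ (denominator m)
    eigenvalue-scale : ∀ k → k ℕ.≤ n → (σ * apow a k n) ^ℚ suc m * S ≡ σ ^ℚ suc m * fromℕ ((a ℕ.^ suc m) ℕ.^ k)
    eigenvalue-scale k k≤n = begin
      (σ * apow a k n) ^ℚ suc m * fromℕ ((a ℕ.^ n) ℕ.^ suc m)
        ≡⟨ cong ((σ * apow a k n) ^ℚ suc m *_) (fromℕ-^ (a ℕ.^ n) (suc m)) ⟩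
      (σ * apow a k n) ^ℚ suc m * fromℕ (a ℕ.^ n) ^ℚ suc m
        ≡⟨ ^ℚ-distrib (σ * apow a k n) (fromℕ (a ℕ.^ n)) (suc m) ⟨
      (σ * apow a k n * fromℕ (a ℕ.^ n)) ^ℚ suc m
        ≡⟨ cong (_^ℚ suc m) (trans (*-assoc σ (apow a k n) (fromℕ (a ℕ.^ n))) (cong (σ *_) (apow-scale k k≤n))) ⟩
      (σ * fromℕ (a ℕ.^ k)) ^ℚ suc m
        ≡⟨ ^ℚ-distrib σ (fromℕ (a ℕ.^ k)) (suc m) ⟩
      σ ^ℚ suc m * fromℕ (a ℕ.^ k) ^ℚ suc m
        ≡⟨ cong (σ ^ℚ suc m *_) (trans (sym (fromℕ-^ (a ℕ.^ k) (suc m))) (cong fromℕ powers)) ⟩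
      σ ^ℚ suc m * fromℕ ((a ℕ.^ suc m) ℕ.^ k) ∎
      where
      powers : (a ℕ.^ k) ℕ.^ suc m ≡ (a ℕ.^ suc m) ℕ.^ k
      powers = trans (ℕ.^-*-assoc a k (suc m)) (trans (cong (a ℕ.^_) (ℕ.*-comm k (suc m))) (sym (ℕ.^-*-assoc a (suc m) k)))
    term : ∀ k → k ∈ upTo (suc n) → fromℕ (coeffAt p k) * (σ * apow a k n) ^ℚ suc m * S ≡
           fromℕ (coeffAt p k ℕ.* (a ℕ.^ suc m) ℕ.^ k) * σ ^ℚ suc m
    term k k∈ = begin
      fromℕ (coeffAt p k) * (σ * apow a k n) ^ℚ suc m * S
        ≡⟨ *-assoc (fromℕ (coeffAt p k)) ((σ * apow a k n) ^ℚ suc m) S ⟩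
      fromℕ (coeffAt p k) * ((σ * apow a k n) ^ℚ suc m * S)
        ≡⟨ cong (fromℕ (coeffAt p k) *_) (trans (eigenvalue-scale k (ℕ.≤-pred (∈-upTo⁻ k∈))) (*-comm (σ ^ℚ suc m) (fromℕ ((a ℕ.^ suc m) ℕ.^ k)))) ⟩
      fromℕ (coeffAt p k) * (fromℕ ((a ℕ.^ suc m) ℕ.^ k) * σ ^ℚ suc m)
        ≡⟨ *-assoc (fromℕ (coeffAt p k)) (fromℕ ((a ℕ.^ suc m) ℕ.^ k)) (σ ^ℚ suc m) ⟨
      fromℕ (coeffAt p k) * fromℕ ((a ℕ.^ suc m) ℕ.^ k) * σ ^ℚ suc m
        ≡⟨ cong (_* σ ^ℚ suc m) (fromℕ-* (coeffAt p k) ((a ℕ.^ suc m) ℕ.^ k)) ⟨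
      fromℕ (coeffAt p k ℕ.* (a ℕ.^ suc m) ℕ.^ k) * σ ^ℚ suc m ∎

  module _ {bs : List Word} (ub : Unique bs) (sound : ∀ {w} → w ∈ bs → IsSignedPerm n w)
           (complete : ∀ {w} → IsSignedPerm n w → w ∈ bs) (θ : Inv) (s : Sign) where

    private
      es : List Bool
      es = alternation (firstApplied s) a
      M : Word → Word → ℚ
      M = opMatrix θ s n a

    opMatrix-scale : ∀ u w → M u w * fromℕ (a ℕ.^ n) ≡ fromℕ (deal θ es u (χ w))
    opMatrix-scale u w = trans (fromℕ-/ (coeff u (op θ s a w)) (a ℕ.^ n) {{ℕ.m^n≢0 a n}}) (cong fromℕ (coeff-op′ a))
      where
      coeff-op′ : ∀ a .{{_ : NonZero a}} → coeff u (op θ s a w) ≡ deal θ (alternation (firstApplied s) a) u (χ w)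
      coeff-op′ (suc a) = coeff-op θ s a w u

    matPow-scale : ∀ k u → u ∈ bs → ∀ w →
      matPow M bs k u w * fromℕ (denominator k) ≡ fromℕ (deal θ (composePow θ es k) u (χ w))
    matPow-scale zero    u u∈ w = trans (cong (λ d → M u w * fromℕ d) (ℕ.*-identityʳ (a ℕ.^ n))) (opMatrix-scale u w)
    matPow-scale (suc k) u u∈ w = begin
      ∑ (λ v → matPow M bs k u v * M v w) bs * fromℕ (a ℕ.^ n ℕ.* denominator k)
        ≡⟨ Q.∑-distribʳ (λ v → matPow M bs k u v * M v w) (fromℕ (a ℕ.^ n ℕ.* denominator k)) bs ⟨
      ∑ (λ v → matPow M bs k u v * M v w * fromℕ (a ℕ.^ n ℕ.* denominator k)) bs
        ≡⟨ Q.∑-cong bs (λ v _ → term v) ⟩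
      ∑ (λ v → fromℕ (deal θ (composePow θ es k) u (χ v) ℕ.* deal θ es v (χ w))) bs
        ≡⟨ fromℕ-Σ (λ v → deal θ (composePow θ es k) u (χ v) ℕ.* deal θ es v (χ w)) bs ⟨
      fromℕ (Σ[ (λ v → deal θ (composePow θ es k) u (χ v) ℕ.* deal θ es v (χ w)) ] bs)
        ≡⟨ cong fromℕ (Σ-deal {n} ub sound complete θ es (composePow θ es k) u∈ w) ⟩
      fromℕ (deal θ (composePow θ es (suc k)) u (χ w)) ∎
      where
      term : ∀ v → matPow M bs k u v * M v w * fromℕ (a ℕ.^ n ℕ.* denominator k) ≡
                   fromℕ (deal θ (composePow θ es k) u (χ v) ℕ.* deal θ es v (χ w))
      term v = begin
        matPow M bs k u v * M v w * fromℕ (a ℕ.^ n ℕ.* denominator k)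
          ≡⟨ cong (matPow M bs k u v * M v w *_) (trans (cong fromℕ (ℕ.*-comm (a ℕ.^ n) (denominator k))) (fromℕ-* (denominator k) (a ℕ.^ n))) ⟩
        matPow M bs k u v * M v w * (fromℕ (denominator k) * fromℕ (a ℕ.^ n))
          ≡⟨ *-interchange (matPow M bs k u v) (M v w) (fromℕ (denominator k)) (fromℕ (a ℕ.^ n)) ⟩
        (matPow M bs k u v * fromℕ (denominator k)) * (M v w * fromℕ (a ℕ.^ n))
          ≡⟨ cong₂ _*_ (matPow-scale k u u∈ v) (opMatrix-scale v w) ⟩
        fromℕ (deal θ (composePow θ es k) u (χ v)) * fromℕ (deal θ es v (χ w))
          ≡⟨ fromℕ-* (deal θ (composePow θ es k) u (χ v)) (deal θ es v (χ w)) ⟨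
        fromℕ (deal θ (composePow θ es k) u (χ v) ℕ.* deal θ es v (χ w)) ∎

    -- Every word of `bs` has distinct values and contributes the same number of fixed deals, so the
    -- trace is the size of `bs` times that number.
    trace-scale : ∀ k → trace M bs k * fromℕ (denominator k) ≡
                        fromℕ (prodVal (2 ℕ.*_) (2 ℕ.* falses (composePow θ es k)) n)
    trace-scale k = begin
      ∑ (λ u → matPow M bs k u u) bs * fromℕ (denominator k)
        ≡⟨ Q.∑-distribʳ (λ u → matPow M bs k u u) (fromℕ (denominator k)) bs ⟨
      ∑ (λ u → matPow M bs k u u * fromℕ (denominator k)) bs
        ≡⟨ Q.∑-cong bs (λ u u∈ → trans (matPow-scale k u u∈ u) (cong fromℕ (fixed u u∈))) ⟩
      ∑ (λ u → fromℕ (multichoose b n)) bs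
        ≡⟨ fromℕ-Σ (λ _ → multichoose b n) bs ⟨
      fromℕ (Σ[ (λ _ → multichoose b n) ] bs)
        ≡⟨ cong fromℕ (trans (Σ-const (multichoose b n) bs) (trans (cong (ℕ._* multichoose b n) (length-bs {n} ub sound complete)) (fixed-count b n))) ⟩
      fromℕ (prodVal (2 ℕ.*_) (2 ℕ.* b) n) ∎
      where
      b : ℕ
      b = falses (composePow θ es k)
      fixed : ∀ u → u ∈ bs → deal θ (composePow θ es k) u (χ u) ≡ multichoose b n
      fixed u u∈ with sound u∈
      ... | sp@(len , _) = trans (deal-fixed θ (composePow θ es k) u (signedPerm-distinct {n} u sp)) (cong (multichoose b) len)

    charPoly-eigenvalues : ∀ μs → length μs ≡ 2 ℕ.^ n ℕ.* n ! →
      (∀ k → powerSum μs k * fromℕ (denominator k) ≡ fromℕ (prodVal (2 ℕ.*_) (2 ℕ.* falses (composePow θ es k)) n)) →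
      ∀ x → charPoly M bs x ≡ charProd x μs
    charPoly-eigenvalues μs len h = charPoly-from-traces M bs ub μs
      (trans len (sym (length-bs {n} ub sound complete)))
      λ k → fromℕ-cancelʳ (denominator k) {{ℕ.m^n≢0 (a ℕ.^ n) (suc k) {{ℕ.m^n≢0 a n}}}} (trans (trace-scale k) (sym (h k)))

  -- The three cases: a even, a odd with sign plus, a odd with sign minus

  module _ {bs : List Word} (ub : Unique bs) (sound : ∀ {w} → w ∈ bs → IsSignedPerm n w)
           (complete : ∀ {w} → IsSignedPerm n w → w ∈ bs) (θ : Inv) where

    -- Marked and unmarked piles balance in every power, so 2b = a^(k+1) and the trace is
    -- `polyEven n` at that value. The zeros fill the list up to length 2ⁿ n! without changing its
    -- power sums.
    charPoly-even : ∀ q → a ≡ q ℕ.* 2 → ∀ s x → charPoly (opMatrix θ s n a) bs x ≡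
                    x ^ℚ zeroMult n * eigenProduct a n true (polyEven n) x
    charPoly-even q a≡ s x = trans (charPoly-eigenvalues ub sound complete θ s μs len sums x) (begin
      charProd x (replicate z 0ℚ ++ νs)
        ≡⟨ charProd-++ x (replicate z 0ℚ) νs ⟩
      charProd x (replicate z 0ℚ) * charProd x νs
        ≡⟨ cong₂ _*_ (trans (charProd-replicate x z 0ℚ) (cong (_^ℚ z) (+-identityʳ x)))
             (sym (charProd-withMultiplicity (coeffAt (polyEven n)) (λ k → 1ℚ * apow a k n) x (upTo (suc n)))) ⟩
      x ^ℚ z * eigenProduct a n true (polyEven n) x ∎)
      where
      z : ℕ
      z = zeroMult n
      νs μs : List ℚ
      νs = eigenvalues 1ℚ (polyEven n)
      μs = replicate z 0ℚ ++ νs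
      es : List Bool
      es = alternation (firstApplied s) a
      deg : length (polyEven n) ℕ.≤ suc n
      deg = ℕ.≤-reflexive (length-prodLin (2 ℕ.*_) n)
      len : length μs ≡ 2 ℕ.^ n ℕ.* n !
      len = begin
        length (replicate z 0ℚ ++ νs)     ≡⟨ length-++ (replicate z 0ℚ) ⟩
        length (replicate z 0ℚ) ℕ.+ length νs ≡⟨ cong₂ ℕ._+_ (length-replicate z) (trans (length-eigenvalues 1ℚ (polyEven n) deg) (polyEval-prodLin (2 ℕ.*_) n 1)) ⟩
        z ℕ.+ prodVal (2 ℕ.*_) 1 n        ≡⟨ zeroMult-+ n ⟩
        2 ℕ.^ n ℕ.* n !                   ∎
      balanced : falses es ≡ trues es
      balanced = subst (λ m → falses (alternation (firstApplied s) m) ≡ trues (alternation (firstApplied s) m)) (sym a≡)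
        (alternation-even (firstApplied s) q)
      sums : ∀ k → powerSum μs k * fromℕ (denominator k) ≡ fromℕ (prodVal (2 ℕ.*_) (2 ℕ.* falses (composePow θ es k)) n)
      sums k = begin
        powerSum μs k * fromℕ (denominator k)
          ≡⟨ cong (_* fromℕ (denominator k)) (trans (powerSum-++ (replicate z 0ℚ) νs k) (cong (_+ powerSum νs k) zeros)) ⟩
        (0ℚ + powerSum νs k) * fromℕ (denominator k)
          ≡⟨ cong (_* fromℕ (denominator k)) (+-identityˡ (powerSum νs k)) ⟩
        powerSum νs k * fromℕ (denominator k)
          ≡⟨ powerSum-eigenvalues 1ℚ (polyEven n) deg k ⟩
        1ℚ ^ℚ suc k * fromℕ (polyEval (polyEven n) (a ℕ.^ suc k))
          ≡⟨ cong₂ (λ y m → y * fromℕ m) (1^ℚ (suc k)) (polyEval-prodLin (2 ℕ.*_) n (a ℕ.^ suc k)) ⟩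
        1ℚ * fromℕ (prodVal (2 ℕ.*_) (a ℕ.^ suc k) n)
          ≡⟨ *-identityˡ (fromℕ (prodVal (2 ℕ.*_) (a ℕ.^ suc k) n)) ⟩
        fromℕ (prodVal (2 ℕ.*_) (a ℕ.^ suc k) n)
          ≡⟨ cong (λ y → fromℕ (prodVal (2 ℕ.*_) y n)) (trans (falses-balanced θ es k balanced)
               (cong (ℕ._^ suc k) (alternation-size (firstApplied s) a))) ⟨
        fromℕ (prodVal (2 ℕ.*_) (2 ℕ.* falses (composePow θ es k)) n) ∎
        where
        zeros : powerSum (replicate z 0ℚ) k ≡ 0ℚ
        zeros = trans (powerSum-replicate z 0ℚ k) (trans (cong (fromℕ z *_) (*-zeroˡ (0ℚ ^ℚ k))) (*-zeroʳ (fromℕ z)))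

    -- Every power has one unmarked pile in excess, so 2b = a^(k+1) + 1; this shift by 1 turns the
    -- factors y + 2j into y + 2j + 1.
    charPoly-odd-plus : ∀ q → a ≡ suc (q ℕ.* 2) → ∀ x →
                        charPoly (opMatrix θ plus n a) bs x ≡ eigenProduct a n true (polyOddPlus n) x
    charPoly-odd-plus q a≡ x = trans (charPoly-eigenvalues ub sound complete θ plus μs len sums x)
      (sym (charProd-withMultiplicity (coeffAt (polyOddPlus n)) (λ k → 1ℚ * apow a k n) x (upTo (suc n))))
      where
      odd : ℕ → ℕ
      odd j = 2 ℕ.* j ℕ.+ 1
      μs : List ℚ
      μs = eigenvalues 1ℚ (polyOddPlus n)
      es : List Bool
      es = alternation false a
      deg : length (polyOddPlus n) ℕ.≤ suc n
      deg = ℕ.≤-reflexive (length-prodLin odd n)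
      shift : ∀ y j → y ℕ.+ (2 ℕ.* j ℕ.+ 1) ≡ suc y ℕ.+ 2 ℕ.* j
      shift = ℕSolver.solve-∀
      len : length μs ≡ 2 ℕ.^ n ℕ.* n !
      len = trans (length-eigenvalues 1ℚ (polyOddPlus n) deg) (trans (polyEval-prodLin odd n 1)
        (trans (prodVal-cong n (shift 1)) (prodVal-2 n)))
      excess : ∀ k → falses (composePow θ es k) ≡ suc (trues (composePow θ es k))
      excess zero    = subst (λ m → falses (alternation false m) ≡ suc (trues (alternation false m))) (sym a≡)
        (cong suc (alternation-even true q))
      excess (suc k) = excess-compose θ es (composePow θ es k) (excess zero) (excess k)
      sums : ∀ k → powerSum μs k * fromℕ (denominator k) ≡ fromℕ (prodVal (2 ℕ.*_) (2 ℕ.* falses (composePow θ es k)) n)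
      sums k = begin
        powerSum μs k * fromℕ (denominator k)
          ≡⟨ powerSum-eigenvalues 1ℚ (polyOddPlus n) deg k ⟩
        1ℚ ^ℚ suc k * fromℕ (polyEval (polyOddPlus n) (a ℕ.^ suc k))
          ≡⟨ cong₂ (λ y m → y * fromℕ m) (1^ℚ (suc k)) (polyEval-prodLin odd n (a ℕ.^ suc k)) ⟩
        1ℚ * fromℕ (prodVal odd (a ℕ.^ suc k) n)
          ≡⟨ *-identityˡ (fromℕ (prodVal odd (a ℕ.^ suc k) n)) ⟩
        fromℕ (prodVal odd (a ℕ.^ suc k) n)
          ≡⟨ cong fromℕ (prodVal-cong n (shift (a ℕ.^ suc k))) ⟩
        fromℕ (prodVal (2 ℕ.*_) (suc (a ℕ.^ suc k)) n)
          ≡⟨ cong (λ y → fromℕ (prodVal (2 ℕ.*_) y n)) (trans (double-excess (composePow θ es k) (excess k))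
               (cong suc (trans (composePow-size θ es k) (cong (ℕ._^ suc k) (alternation-size false a))))) ⟨
        fromℕ (prodVal (2 ℕ.*_) (2 ℕ.* falses (composePow θ es k)) n) ∎

  module _ {bs : List Word} (ub : Unique bs) (sound : ∀ {w} → w ∈ bs → IsSignedPerm n w)
           (complete : ∀ {w} → IsSignedPerm n w → w ∈ bs) (θ : Inv) where

    -- Here 2b = a^(k+1) + (-1)^(k+1), and the sign of the negative eigenvalues follows the same
    -- parity. Writing n = m + 1 resolves the `n ∸ 1` in both polynomials.
    charPoly-odd-minus : ∀ m → n ≡ suc m → ∀ q → a ≡ suc (q ℕ.* 2) → ∀ x →
      charPoly (opMatrix θ minus n a) bs x ≡
      eigenProduct a n true (polyOddMinusPos n) x * eigenProduct a n false (polyOddMinusNeg n) x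
    charPoly-odd-minus m refl q a≡ x = trans (charPoly-eigenvalues ub sound complete θ minus (μs ++ νs) len sums x)
      (trans (charProd-++ x μs νs) (sym (cong₂ _*_
        (charProd-withMultiplicity (coeffAt (polyOddMinusPos n)) (λ k → 1ℚ * apow a k n) x (upTo (suc n)))
        (charProd-withMultiplicity (coeffAt (polyOddMinusNeg n)) (λ k → - 1ℚ * apow a k n) x (upTo (suc n))))))
      where
      odd : ℕ → ℕ
      odd j = 2 ℕ.* j ℕ.+ 1
      μs νs : List ℚ
      μs = eigenvalues 1ℚ (polyOddMinusPos n)
      νs = eigenvalues (- 1ℚ) (polyOddMinusNeg n)
      es : List Bool
      es = alternation true a
      degPos : length (polyOddMinusPos n) ℕ.≤ suc n
      degPos = ℕ.≤-reflexive (trans (length-mulLin m (prodLin odd m)) (cong suc (length-prodLin odd m)))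
      degNeg : length (polyOddMinusNeg n) ℕ.≤ suc n
      degNeg = ℕ.≤-trans (ℕ.≤-reflexive (trans (length-map (n ℕ.*_) (prodLin odd m)) (length-prodLin odd m))) (ℕ.n≤1+n n)
      evalPos : ∀ y → polyEval (polyOddMinusPos n) y ≡ (y ℕ.+ m) ℕ.* prodVal odd y m
      evalPos y = trans (polyEval-mulLin m (prodLin odd m) y) (cong ((y ℕ.+ m) ℕ.*_) (polyEval-prodLin odd m y))
      evalNeg : ∀ y → polyEval (polyOddMinusNeg n) y ≡ suc m ℕ.* prodVal odd y m
      evalNeg y = trans (polyEval-scale n (prodLin odd m) y) (cong (n ℕ.*_) (polyEval-prodLin odd m y))
      shift : ∀ y j → y ℕ.+ (2 ℕ.* j ℕ.+ 1) ≡ suc y ℕ.+ 2 ℕ.* j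
      shift = ℕSolver.solve-∀
      len : length (μs ++ νs) ≡ 2 ℕ.^ n ℕ.* n !
      len = begin
        length (μs ++ νs)                  ≡⟨ length-++ μs ⟩
        length μs ℕ.+ length νs            ≡⟨ cong₂ ℕ._+_ (trans (length-eigenvalues 1ℚ (polyOddMinusPos n) degPos) (evalPos 1))
                                                (trans (length-eigenvalues (- 1ℚ) (polyOddMinusNeg n) degNeg) (evalNeg 1)) ⟩
        suc m ℕ.* prodVal odd 1 m ℕ.+ suc m ℕ.* prodVal odd 1 m
                                           ≡⟨ cong (λ r → suc m ℕ.* r ℕ.+ suc m ℕ.* r) (trans (prodVal-cong m (shift 1)) (prodVal-2 m)) ⟩
        suc m ℕ.* (2 ℕ.^ m ℕ.* m !) ℕ.+ suc m ℕ.* (2 ℕ.^ m ℕ.* m !)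
                                           ≡⟨ arith m (2 ℕ.^ m) (m !) ⟩
        2 ℕ.* 2 ℕ.^ m ℕ.* (suc m ℕ.* m !)  ∎
        where
        arith : ∀ m p f → suc m ℕ.* (p ℕ.* f) ℕ.+ suc m ℕ.* (p ℕ.* f) ≡ 2 ℕ.* p ℕ.* (suc m ℕ.* f)
        arith = ℕSolver.solve-∀
      -- Even and odd powers are told apart by the value of (-1)^(k+1), paired with the side that
      -- has the extra pile.
      parity : ∀ k → ((- 1ℚ) ^ℚ suc k ≡ - 1ℚ × trues (composePow θ es k) ≡ suc (falses (composePow θ es k)))
                   ⊎ ((- 1ℚ) ^ℚ suc k ≡ 1ℚ × falses (composePow θ es k) ≡ suc (trues (composePow θ es k)))
      deficit : trues es ≡ suc (falses es)
      deficit = subst (λ m → trues (alternation true m) ≡ suc (falses (alternation true m))) (sym a≡)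
        (cong suc (sym (alternation-even false q)))
      parity zero    = inj₁ (refl , deficit)
      parity (suc k) with parity k
      ... | inj₁ (e , h) = inj₂ (cong (- 1ℚ *_) e , deficit-compose θ es (composePow θ es k) deficit h)
      ... | inj₂ (e , h) = inj₁ (cong (- 1ℚ *_) e , mixed-compose θ es (composePow θ es k) deficit h)
      combine : ∀ k y ε b → (- 1ℚ) ^ℚ suc k ≡ ε → a ℕ.^ suc k ≡ y →
        fromℕ ((y ℕ.+ m) ℕ.* prodVal odd y m) + ε * fromℕ (suc m ℕ.* prodVal odd y m) ≡ fromℕ (prodVal (2 ℕ.*_) (2 ℕ.* b) n) →
        powerSum (μs ++ νs) k * fromℕ (denominator k) ≡ fromℕ (prodVal (2 ℕ.*_) (2 ℕ.* b) n)
      combine k y ε b refl refl h = begin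
        powerSum (μs ++ νs) k * S
          ≡⟨ cong (_* S) (powerSum-++ μs νs k) ⟩
        (powerSum μs k + powerSum νs k) * S
          ≡⟨ *-distribʳ-+ S (powerSum μs k) (powerSum νs k) ⟩
        powerSum μs k * S + powerSum νs k * S
          ≡⟨ cong₂ _+_ (powerSum-eigenvalues 1ℚ (polyOddMinusPos n) degPos k) (powerSum-eigenvalues (- 1ℚ) (polyOddMinusNeg n) degNeg k) ⟩
        1ℚ ^ℚ suc k * fromℕ (polyEval (polyOddMinusPos n) y) + ε * fromℕ (polyEval (polyOddMinusNeg n) y)
          ≡⟨ cong₂ (λ p r → p + ε * fromℕ r)
               (trans (cong₂ (λ o r → o * fromℕ r) (1^ℚ (suc k)) (evalPos y)) (*-identityˡ (fromℕ ((y ℕ.+ m) ℕ.* prodVal odd y m)))) (evalNeg y) ⟩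
        fromℕ ((y ℕ.+ m) ℕ.* prodVal odd y m) + ε * fromℕ (suc m ℕ.* prodVal odd y m)
          ≡⟨ h ⟩
        fromℕ (prodVal (2 ℕ.*_) (2 ℕ.* b) n) ∎
        where
        S : ℚ
        S = fromℕ (denominator k)
      size : ∀ k → falses (composePow θ es k) ℕ.+ trues (composePow θ es k) ≡ a ℕ.^ suc k
      size k = trans (composePow-size θ es k) (cong (ℕ._^ suc k) (alternation-size true a))
      sums : ∀ k → powerSum (μs ++ νs) k * fromℕ (denominator k) ≡ fromℕ (prodVal (2 ℕ.*_) (2 ℕ.* falses (composePow θ es k)) n)
      sums k with falses (composePow θ es k) | trues (composePow θ es k) | parity k | size k
      -- Odd power: y = 2b + 1. The first factor of the trace is y - 1 = (y + m) - (m + 1), and the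
      -- remaining ones y + 1, y + 3, ... form the common product `R`.
      ... | b | _ | inj₁ (e , refl) | sz = combine k (suc (2 ℕ.* b)) (- 1ℚ) b e (trans (sym sz) (arith b)) (begin
        fromℕ ((suc (2 ℕ.* b) ℕ.+ m) ℕ.* R) + - 1ℚ * fromℕ (suc m ℕ.* R)
          ≡⟨ cong (_+ - 1ℚ * fromℕ (suc m ℕ.* R)) (trans (cong fromℕ (split b m R)) (fromℕ-+ (2 ℕ.* b ℕ.* R) (suc m ℕ.* R))) ⟩
        fromℕ (2 ℕ.* b ℕ.* R) + fromℕ (suc m ℕ.* R) + - 1ℚ * fromℕ (suc m ℕ.* R)
          ≡⟨ solve 2 (λ u v → u :+ v :+ con (- 1ℚ) :* v := u) refl (fromℕ (2 ℕ.* b ℕ.* R)) (fromℕ (suc m ℕ.* R)) ⟩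
        fromℕ (2 ℕ.* b ℕ.* R)
          ≡⟨ cong fromℕ (trans (prodVal-shift (2 ℕ.*_) (2 ℕ.* b) m) (cong₂ ℕ._*_ (ℕ.+-identityʳ (2 ℕ.* b)) (prodVal-cong m (align b)))) ⟨
        fromℕ (prodVal (2 ℕ.*_) (2 ℕ.* b) n) ∎)
        where
        open +-*-Solver using (solve; _:+_; _:*_; con; _:=_)
        R : ℕ
        R = prodVal odd (suc (2 ℕ.* b)) m
        arith : ∀ b → b ℕ.+ suc b ≡ suc (2 ℕ.* b)
        arith = ℕSolver.solve-∀
        split : ∀ b m r → (suc (2 ℕ.* b) ℕ.+ m) ℕ.* r ≡ 2 ℕ.* b ℕ.* r ℕ.+ suc m ℕ.* r
        split = ℕSolver.solve-∀
        align : ∀ b j → 2 ℕ.* b ℕ.+ 2 ℕ.* suc j ≡ suc (2 ℕ.* b) ℕ.+ (2 ℕ.* j ℕ.+ 1)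
        align = ℕSolver.solve-∀
      -- Even power: y = 2t + 1 with b = t + 1. Now the last factor of the trace stands out, y + 2m
      -- + 1 = (y + m) + (m + 1), and the others form `R`.
      ... | _ | t | inj₂ (e , refl) | sz = combine k (suc (2 ℕ.* t)) 1ℚ (suc t) e (trans (sym sz) (arith t)) (begin
        fromℕ ((suc (2 ℕ.* t) ℕ.+ m) ℕ.* R) + 1ℚ * fromℕ (suc m ℕ.* R)
          ≡⟨ cong (fromℕ ((suc (2 ℕ.* t) ℕ.+ m) ℕ.* R) +_) (*-identityˡ (fromℕ (suc m ℕ.* R))) ⟩
        fromℕ ((suc (2 ℕ.* t) ℕ.+ m) ℕ.* R) + fromℕ (suc m ℕ.* R)
          ≡⟨ fromℕ-+ ((suc (2 ℕ.* t) ℕ.+ m) ℕ.* R) (suc m ℕ.* R) ⟨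
        fromℕ ((suc (2 ℕ.* t) ℕ.+ m) ℕ.* R ℕ.+ suc m ℕ.* R)
          ≡⟨ cong fromℕ (trans (merge t m R) (cong ((2 ℕ.* suc t ℕ.+ 2 ℕ.* m) ℕ.*_) (prodVal-cong m (align t)))) ⟩
        fromℕ (prodVal (2 ℕ.*_) (2 ℕ.* suc t) n) ∎)
        where
        R : ℕ
        R = prodVal odd (suc (2 ℕ.* t)) m
        arith : ∀ t → suc t ℕ.+ t ≡ suc (2 ℕ.* t)
        arith = ℕSolver.solve-∀
        merge : ∀ t m r → (suc (2 ℕ.* t) ℕ.+ m) ℕ.* r ℕ.+ suc m ℕ.* r ≡ (2 ℕ.* suc t ℕ.+ 2 ℕ.* m) ℕ.* r
        merge = ℕSolver.solve-∀
        align : ∀ t j → suc (2 ℕ.* t) ℕ.+ (2 ℕ.* j ℕ.+ 1) ≡ 2 ℕ.* suc t ℕ.+ 2 ℕ.* j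
        align = ℕSolver.solve-∀

parity : ∀ a → ∃ (λ q → a ≡ q ℕ.* 2) ⊎ ∃ (λ q → a ≡ suc (q ℕ.* 2))
parity zero          = inj₁ (0 , refl)
parity (suc zero)    = inj₂ (0 , refl)
parity (suc (suc a)) with parity a
... | inj₁ (q , e) = inj₁ (suc q , cong (λ m → suc (suc m)) e)
... | inj₂ (q , e) = inj₂ (suc q , cong (λ m → suc (suc m)) e)

odd-form : ∀ {a} → ¬ (2 ∣ a) → ∃ (λ q → a ≡ suc (q ℕ.* 2))
odd-form {a} ¬2∣a with parity a
... | inj₁ (q , e) = ⊥-elim (¬2∣a (divides q e))
... | inj₂ odd     = odd

theorem5p10 : (n a : ℕ) → .{{_ : NonZero n}} → .{{_ : NonZero a}} →
    (bs : List Word) → Unique bs → (∀ w → (w ∈ bs) ⇔ IsSignedPerm n w) →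
    (2 ∣ a → ∀ θ s (x : ℚ) →
    charPoly (opMatrix θ s n a) bs x
    ≡ (x ^ℚ zeroMult n) * eigenProduct a n true (polyEven n) x)
    × (¬ (2 ∣ a) → ∀ θ (x : ℚ) →
    charPoly (opMatrix θ plus n a) bs x
    ≡ eigenProduct a n true (polyOddPlus n) x)
    × (¬ (2 ∣ a) → ∀ θ (x : ℚ) →
    charPoly (opMatrix θ minus n a) bs x
    ≡ eigenProduct a n true (polyOddMinusPos n) x
    * eigenProduct a n false (polyOddMinusNeg n) x)
theorem5p10 n@(suc m) a bs ub iff =
    (λ { (divides q e) θ s x → charPoly-even n a ub sound complete θ q e s x })
  , (λ ¬2∣a θ x → let q , e = odd-form ¬2∣a in charPoly-odd-plus n a ub sound complete θ q e x)
  , (λ ¬2∣a θ x → let q , e = odd-form ¬2∣a in charPoly-odd-minus n a ub sound complete θ m refl q e x)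
  where
  sound : ∀ {w} → w ∈ bs → IsSignedPerm n w
  sound {w} = Equivalence.to (iff w)
  complete : ∀ {w} → IsSignedPerm n w → w ∈ bs
  complete {w} = Equivalence.from (iff w)
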